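{- Let $a,b,n$ be positive integers with $a>b$, and define \[ \tau_0(an,bn,q)'=\sum_{k=an-bn-\lfloor n/2\rfloor}^{an-bn}(-1)^kq^{ank-\binom{k}{2}}\begin{bmatrix} an\\ k\end{bmatrix}\begin{bmatrix} 2an-2k\\ an-bn-k\end{bmatrix}. \] Then, modulo $\Phi_n(q)^2$, \[ \tau_0(an,bn,q)'\equiv(-1)^{an-bn}q^{(an-bn)(an+bn+1)/2}\begin{bmatrix} an\\ bn\end{bmatrix}\Big\{1-(a-b)\big(2-\theta_n(q)-\vartheta_n(q)\big)\Big\}, \] where \[ \theta_n(q)=\begin{cases} (-1)^m(1+q^m)q^{m(3m-1)/2}, &\text{if } n=3m,\\ (-1)^mq^{m(3m+1)/2}, &\text{if } n=3m+1,\\ (-1)^{m+1}q^{(m+1)(3m+2)/2}, &\text{if } n=3m+2,\end{cases} \qquad \vartheta_n(q)=\begin{cases} (-1)^m(1+q^{2m})q^{m(3m-5)/2}, &\text{if } n=3m,\\ (-1)^mq^{m(3m+1)/2}, &\text{if } n=3m+1,\\ (-1)^{m+1}q^{(m-1)(3m+2)/2}, &\text{if } n=3m+2.\end{cases} \]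
   Context: For integers $n,m$, the $q$-binomial coefficient is $\begin{bmatrix} n\\ m\end{bmatrix}=\frac{(1-q^n)(1-q^{n-1})\cdots(1-q^{n-m+1})}{(1-q)(1-q^2)\cdots(1-q^m)}$ if $0\le m\le n$, and $0$ otherwise; $\binom{k}{2}=k(k-1)/2$. $\Phi_n(q)$ denotes the $n$-th cyclotomic polynomial. $\lfloor x\rfloor$ is the integer part of $x$. For rational functions (including Laurent polynomials) $A(q),B(q)$, $A\equiv B\pmod{\Phi_n(q)^2}$ means $A-B=\Phi_n(q)^2P(q)/Q(q)$ with $P,Q\in\mathbb{Z}[q]$ and $Q$ coprime to $\Phi_n(q)$. -}

module Defs where

open import Data.Nat as ℕ using (ℕ; zero; suc)
import Data.Nat.DivMod as ℕD
open import Data.Integer as ℤ using (ℤ; +_; -[1+_])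
import Data.Integer.DivMod as ℤD
open import Data.List using (List; []; _∷_; map; foldr; filter; reverse; upTo)
open import Data.Product using (_×_; _,_; proj₁; proj₂; ∃; ∃-syntax)
open import Relation.Binary.PropositionalEquality using (_≡_)
open import Data.Bool using (Bool; true; false)

-- Polynomials in ℤ[q] as coefficient lists (lowest degree first).

Poly : Set
Poly = List ℤ

coeff : Poly → ℕ → ℤ
coeff []       _       = + 0
coeff (c ∷ _)  zero    = c
coeff (_ ∷ cs) (suc i) = coeff cs i

-- equality of polynomials (trailing zeros irrelevant)
infix 4 _≈P_
_≈P_ : Poly → Poly → Set
p ≈P r = ∀ i → coeff p i ≡ coeff r i

infixl 6 _+P_ _-P_
infixl 7 _*P_

_+P_ : Poly → Poly → Poly
[]       +P r        = r
(c ∷ cs) +P []       = c ∷ cs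
(c ∷ cs) +P (d ∷ ds) = (c ℤ.+ d) ∷ (cs +P ds)

-P_ : Poly → Poly
-P p = map ℤ.-_ p

_-P_ : Poly → Poly → Poly
p -P r = p +P (-P r)

_*P_ : Poly → Poly → Poly
[]       *P r = []
(c ∷ cs) *P r = map (c ℤ.*_) r +P (+ 0 ∷ (cs *P r))

constP : ℤ → Poly
constP c = c ∷ []

oneP : Poly
oneP = constP (+ 1)

qP : ℕ → Poly
qP zero    = oneP
qP (suc k) = + 0 ∷ qP k

prodP : List Poly → Poly
prodP = foldr _*P_ oneP

infix 4 _∣P_
_∣P_ : Poly → Poly → Set
d ∣P f = ∃[ e ] (d *P e ≈P f)

CoprimeP : Poly → Poly → Set
CoprimeP f g = ∀ d → d ∣P f → d ∣P g → d ∣P oneP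

-- Cyclotomic polynomials.
-- Formal power series quotient f / g, for g with constant term 1,
-- returning the first N coefficients.  When g divides f in ℤ[q] and
-- deg (f / g) < N this is exactly the polynomial quotient.

divSeries : Poly → Poly → ℕ → Poly
divSeries f g N = reverse (loop N 0 [])
  where
  conv : ℕ → List ℤ → ℤ
  conv j []       = + 0
  conv j (x ∷ xs) = coeff g j ℤ.* x ℤ.+ conv (suc j) xs
  -- hs = [h_{i-1}, ..., h_0]
  loop : ℕ → ℕ → List ℤ → List ℤ
  loop zero    i hs = hs
  loop (suc k) i hs = loop k (suc i) ((coeff f i ℤ.- conv 1 hs) ∷ hs)

properDivisors : ℕ → List ℕ
properDivisors n = filterᵇ (λ i → (n ℕD.% suc i) ℕ.≡ᵇ 0) (upTo (n ℕ.∸ 1))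
  where
  -- keeps d = i + 1 (1 ≤ d ≤ n - 1) when d divides n
  filterᵇ : (ℕ → Bool) → List ℕ → List ℕ
  filterᵇ p []       = []
  filterᵇ p (i ∷ is) with p i
  ... | true  = suc i ∷ filterᵇ p is
  ... | false = filterᵇ p is

-- Ψ_n with Ψ_1 = 1 - q and  ∏_{d ∣ n} Ψ_d = 1 - q^n ; Ψ_n = Φ_n for n ≥ 2.
-- The first argument is fuel (fuel n suffices for index n).
psi : ℕ → ℕ → Poly
psi zero     n = oneP
psi (suc f)  zero = oneP
psi (suc f)  (suc zero) = oneP -P qP 1
psi (suc f)  (suc (suc k)) =
  let n = suc (suc k) in
  divSeries (oneP -P qP n) (prodP (map (psi f) (properDivisors n))) (suc n)

-- The n-th cyclotomic polynomial Φ_n(q) (n ≥ 1), ∏_{d ∣ n} Φ_d(q) = q^n - 1.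
Φ : ℕ → Poly
Φ zero          = oneP           -- unused
Φ (suc zero)    = qP 1 -P oneP
Φ (suc (suc k)) = psi (suc (suc k)) (suc (suc k))

Frac : Set
Frac = Poly × Poly

num den : Frac → Poly
num = proj₁
den = proj₂

infixl 6 _+F_ _-F_
infixl 7 _*F_

_+F_ : Frac → Frac → Frac
(a , b) +F (c , d) = (a *P d +P c *P b , b *P d)

_*F_ : Frac → Frac → Frac
(a , b) *F (c , d) = (a *P c , b *P d)

-F_ : Frac → Frac
-F (a , b) = (-P a , b)

_-F_ : Frac → Frac → Frac
x -F y = x +F (-F y)

intF : ℤ → Frac
intF c = (constP c , oneP)

zeroF oneF : Frac
zeroF = intF (+ 0)
oneF  = intF (+ 1)

sumF : List Frac → Frac
sumF = foldr _+F_ zeroF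

qF : ℕ → Frac
qF k = (qP k , oneP)

qZ : ℤ → Frac
qZ (+ k)     = (qP k , oneP)
qZ -[1+ k ]  = (oneP , qP (suc k))

sgn : ℕ → ℤ
sgn zero    = + 1
sgn (suc k) = ℤ.- sgn k

qbinom : ℕ → ℕ → Frac
qbinom n m with m ℕ.≤ᵇ n
... | false = zeroF
... | true  = ( prodP (map (λ i → oneP -P qP (n ℕ.∸ i)) (upTo m))
              , prodP (map (λ i → oneP -P qP (suc i)) (upTo m)) )

-- Congruence modulo Φ_n(q)^2 for rational functions:
-- A - B = Φ_n^2 P / Q with P, Q ∈ ℤ[q], Q coprime to Φ_n.

CongΦ² : ℕ → Frac → Frac → Set
CongΦ² n A B =
  ∃[ P ] ∃[ Q ] ( CoprimeP Q (Φ n)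
    × ((num A *P den B -P num B *P den A) *P Q
        ≈P Φ n *P Φ n *P P *P den A *P den B) )

-- integer halving (used only on even integers)
half : ℤ → ℤ
half x = x ℤD./ (+ 2)

_/2 : ℕ → ℕ
k /2 = k ℕD./ 2

choose2 : ℕ → ℕ
choose2 k = (k ℕ.* (k ℕ.∸ 1)) /2

tau0' : ℕ → ℕ → ℕ → Frac
tau0' a b n = sumF (map term ks)
  where
  an = a ℕ.* n
  bn = b ℕ.* n
  lo = an ℕ.∸ bn ℕ.∸ (n /2)
  ks = map (lo ℕ.+_) (upTo (suc (n /2)))
  term : ℕ → Frac
  term k = intF (sgn k) *F qF (an ℕ.* k ℕ.∸ choose2 k)
           *F qbinom an k *F qbinom (2 ℕ.* an ℕ.∸ 2 ℕ.* k) (an ℕ.∸ bn ℕ.∸ k)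

zm : ℕ → ℤ
zm m = + m

θ : ℕ → Frac
θ n with n ℕD.% 3
... | 0 = intF (sgn m) *F (oneF +F qF m)
            *F qZ (half (zm m ℤ.* (+ 3 ℤ.* zm m ℤ.- + 1)))
  where m = n ℕD./ 3
... | 1 = intF (sgn m) *F qZ (half (zm m ℤ.* (+ 3 ℤ.* zm m ℤ.+ + 1)))
  where m = n ℕD./ 3
... | _ = intF (sgn (suc m))
            *F qZ (half ((zm m ℤ.+ + 1) ℤ.* (+ 3 ℤ.* zm m ℤ.+ + 2)))
  where m = n ℕD./ 3

ϑ : ℕ → Frac
ϑ n with n ℕD.% 3
... | 0 = intF (sgn m) *F (oneF +F qF (2 ℕ.* m))
            *F qZ (half (zm m ℤ.* (+ 3 ℤ.* zm m ℤ.- + 5)))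
  where m = n ℕD./ 3
... | 1 = intF (sgn m) *F qZ (half (zm m ℤ.* (+ 3 ℤ.* zm m ℤ.+ + 1)))
  where m = n ℕD./ 3
... | _ = intF (sgn (suc m))
            *F qZ (half ((zm m ℤ.- + 1) ℤ.* (+ 3 ℤ.* zm m ℤ.+ + 2)))
  where m = n ℕD./ 3

rhs : ℕ → ℕ → ℕ → Frac
rhs a b n =
  intF (sgn (an ℕ.∸ bn))
  *F qF (((an ℕ.∸ bn) ℕ.* (an ℕ.+ bn ℕ.+ 1)) /2)
  *F qbinom an bn
  *F (oneF -F intF (+ a ℤ.- + b) *F (intF (+ 2) -F θ n -F ϑ n))
  where
  an = a ℕ.* n
  bn = b ℕ.* n

{-# OPTIONS --safe #-}
-- For j > 0 the summand with k = an - bn - j contains the factor 1 - q^(an-bn), which is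
-- (a - b)(1 - q^n) modulo (1 - q^n)², so its other factors matter only modulo 1 - q^n, where
-- q^n = 1.  On the other side, with A_n = Σ_j (-1)^j q^C(j,2) [n-j; j] one has
--   θ_n = A_n - q^(n-1) A_(n-2)   and   q ϑ_n = q A_n - A_(n-2),
-- because A_(n+3) = - q^(n+1) A_n by the two Pascal rules, and by the absorption rules the j-th
-- summand of either combination has the exact factor 1 - q^n when j > 0.  The two sides agree
-- term by term once the products (1 - q^(P+1)) ⋯ (1 - q^(P+k)) are reflected by q^n = 1.
--
-- The cleared denominators are products of powers of q and of 1 - q^i with n ∤ i.  They are
-- coprime to Φ_n since 1 - q^gcd(n,i) lies in the ideal (1 - q^n, 1 - q^i) and, for a proper
-- divisor g of n, Φ_n divides (1 - q^n) / (1 - q^g), which is n / g modulo 1 - q^g.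

module Submission where

open import Defs
open import Algebra.Bundles using (CommutativeRing)
open import Algebra.Solver.Ring.AlmostCommutativeRing
  using (fromCommutativeRing; _-Raw-AlmostCommutative⟶_)
import Algebra.Solver.Ring
open import Data.Bool using (Bool; true; false; if_then_else_)
open import Data.Integer as ℤ using (ℤ; +_; -[1+_])
import Data.Integer.Properties as ℤP
import Data.Integer.Tactic.RingSolver as ℤ-Solver
open import Data.List using (List; []; _∷_; _++_; length; map; foldl; reverse; upTo; applyUpTo)
import Data.List.Properties as ListP
open import Data.List.Relation.Unary.All as All using (All)
import Data.List.Relation.Unary.All.Properties as AllP
open import Data.Maybe using (Maybe; nothing; just)
open import Data.Nat as ℕ using (ℕ; zero; suc; _<_; _≤_; s≤s; z≤n)
open import Data.Nat.Divisibility using (_∣_; divides; ∣⇒≤; ∣-trans; ∣m+n∣m⇒∣n; n∣m*n; m%n≡0⇒n∣m;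
  n∣m⇒m%n≡0)
import Data.Nat.DivMod as ℕD
open import Data.Nat.GCD using (gcd; gcd-GCD; gcd[m,n]∣m; gcd[m,n]∣n; gcd[m,n]≢0; module Bézout)
import Data.Nat.Properties as ℕP
import Data.Nat.Tactic.RingSolver as ℕ-Solver
open import Data.Product using (_×_; _,_; proj₁; proj₂; ∃-syntax; map₂)
open import Data.Sum using (_⊎_; inj₁; inj₂)
open import Level using (0ℓ)
open import Relation.Binary.PropositionalEquality as ≡ using (_≡_; refl; cong; cong₂; subst)
open import Relation.Nullary using (¬_; yes; no; contradiction)

-- Two obstacles shape the proof. First, ϑ_n may contain q^(-1) and the reflected products carry
-- powers of q and denominators. So both sides are multiplied by q, each summand with j > 0 by an
-- explicit clearing factor, every reflection is stated with the power of q on the side where its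
-- exponent is positive, and the outcome is an exact multiple of (1 - q^n)^2. The q-series part
-- works over any commutative ring with elements `Q i` satisfying Q (i + j) = Q i * Q j, so
-- coefficient lists stay out of it. Second, Φ_n is given as a truncated power series quotient, so
-- even the factorisation of 1 - q^n has to be established. Comaximality over ℚ shows that the
-- product over the proper divisors divides a non-zero integer multiple of 1 - q^n. Uniqueness of
-- the series quotient, with a degree bound, then removes the integer. Coprimality in ℤ[q] is
-- stronger than coprimality over ℚ; the gap is closed by the constant term 1 of the cyclotomic
-- factor.

-- Coefficient lists as the commutative ring ℤ[q].

coeff-+ : ∀ p r i → coeff (p +P r) i ≡ coeff p i ℤ.+ coeff r i
coeff-+ []       r        i       = ≡.sym (ℤP.+-identityˡ _)
coeff-+ (c ∷ cs) []       i       = ≡.sym (ℤP.+-identityʳ _)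
coeff-+ (c ∷ cs) (d ∷ ds) zero    = refl
coeff-+ (c ∷ cs) (d ∷ ds) (suc i) = coeff-+ cs ds i

coeff-neg : ∀ p i → coeff (-P p) i ≡ ℤ.- coeff p i
coeff-neg []       i       = refl
coeff-neg (c ∷ cs) zero    = refl
coeff-neg (c ∷ cs) (suc i) = coeff-neg cs i

coeff-scale : ∀ c p i → coeff (map (c ℤ.*_) p) i ≡ c ℤ.* coeff p i
coeff-scale c []       i       = ≡.sym (ℤP.*-zeroʳ c)
coeff-scale c (d ∷ ds) zero    = refl
coeff-scale c (d ∷ ds) (suc i) = coeff-scale c ds i

coeff-*-zero : ∀ p r → coeff (p *P r) 0 ≡ coeff p 0 ℤ.* coeff r 0
coeff-*-zero []       r = refl
coeff-*-zero (c ∷ cs) r =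
  ≡.trans (coeff-+ (map (c ℤ.*_) r) _ 0)
    (≡.trans (ℤP.+-identityʳ _) (coeff-scale c r 0))

coeff-*-suc : ∀ c cs r i →
  coeff ((c ∷ cs) *P r) (suc i) ≡ c ℤ.* coeff r (suc i) ℤ.+ coeff (cs *P r) i
coeff-*-suc c cs r i =
  ≡.trans (coeff-+ (map (c ℤ.*_) r) _ (suc i))
    (cong (ℤ._+ coeff (cs *P r) i) (coeff-scale c r (suc i)))

coeff-*-[] : ∀ p i → coeff (p *P []) i ≡ + 0
coeff-*-[] []       i       = refl
coeff-*-[] (c ∷ cs) zero    = refl
coeff-*-[] (c ∷ cs) (suc i) = coeff-*-[] cs i

coeff-*-sucʳ : ∀ p d ds i →
  coeff (p *P (d ∷ ds)) (suc i) ≡ d ℤ.* coeff p (suc i) ℤ.+ coeff (p *P ds) i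
coeff-*-sucʳ []       d ds i       = ≡.sym (≡.trans (ℤP.+-identityʳ _) (ℤP.*-zeroʳ d))
coeff-*-sucʳ (c ∷ cs) d ds zero
  rewrite coeff-*-suc c cs (d ∷ ds) 0 | coeff-*-zero (c ∷ cs) ds | coeff-*-zero cs (d ∷ ds) =
  lemma c (coeff ds 0) (coeff cs 0) d
  where
  lemma : ∀ c x y d → c ℤ.* x ℤ.+ y ℤ.* d ≡ d ℤ.* y ℤ.+ c ℤ.* x
  lemma = ℤ-Solver.solve-∀
coeff-*-sucʳ (c ∷ cs) d ds (suc i)
  rewrite coeff-*-suc c cs (d ∷ ds) (suc i) | coeff-*-suc c cs ds i | coeff-*-sucʳ cs d ds i =
  lemma (c ℤ.* coeff ds (suc i)) (d ℤ.* coeff cs (suc i)) (coeff (cs *P ds) i)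
  where
  lemma : ∀ x y z → x ℤ.+ (y ℤ.+ z) ≡ y ℤ.+ (x ℤ.+ z)
  lemma = ℤ-Solver.solve-∀

*P-comm : ∀ p r i → coeff (p *P r) i ≡ coeff (r *P p) i
*P-comm p []       i       = coeff-*-[] p i
*P-comm p (d ∷ ds) zero    =
  ≡.trans (coeff-*-zero p _) (≡.trans (ℤP.*-comm _ d) (≡.sym (coeff-*-zero (d ∷ ds) p)))
*P-comm p (d ∷ ds) (suc i) =
  ≡.trans (coeff-*-sucʳ p d ds i)
    (≡.trans (cong (λ x → d ℤ.* coeff p (suc i) ℤ.+ x) (*P-comm p ds i))
      (≡.sym (coeff-*-suc d ds p i)))

*P-congʳ : ∀ p {r s} → r ≈P s → p *P r ≈P p *P s
*P-congʳ []       e i = refl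
*P-congʳ (c ∷ cs) {r} {s} e zero
  rewrite coeff-*-zero (c ∷ cs) r | coeff-*-zero (c ∷ cs) s = cong (c ℤ.*_) (e 0)
*P-congʳ (c ∷ cs) {r} {s} e (suc i)
  rewrite coeff-*-suc c cs r i | coeff-*-suc c cs s i =
  cong₂ (λ x y → c ℤ.* x ℤ.+ y) (e (suc i)) (*P-congʳ cs {r} {s} e i)

*P-distribˡ : ∀ p r s i → coeff (p *P (r +P s)) i ≡ coeff (p *P r +P p *P s) i
*P-distribˡ []       r s i = refl
*P-distribˡ (c ∷ cs) r s zero
  rewrite coeff-+ ((c ∷ cs) *P r) ((c ∷ cs) *P s) 0 | coeff-*-zero (c ∷ cs) (r +P s)
        | coeff-*-zero (c ∷ cs) r | coeff-*-zero (c ∷ cs) s | coeff-+ r s 0 =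
  ℤP.*-distribˡ-+ c (coeff r 0) (coeff s 0)
*P-distribˡ (c ∷ cs) r s (suc i)
  rewrite coeff-+ ((c ∷ cs) *P r) ((c ∷ cs) *P s) (suc i) | coeff-*-suc c cs (r +P s) i
        | coeff-*-suc c cs r i | coeff-*-suc c cs s i | coeff-+ r s (suc i)
        | *P-distribˡ cs r s i | coeff-+ (cs *P r) (cs *P s) i =
  lemma c (coeff r (suc i)) (coeff s (suc i)) (coeff (cs *P r) i) (coeff (cs *P s) i)
  where
  lemma : ∀ c x y u v →
    c ℤ.* (x ℤ.+ y) ℤ.+ (u ℤ.+ v) ≡ (c ℤ.* x ℤ.+ u) ℤ.+ (c ℤ.* y ℤ.+ v)
  lemma = ℤ-Solver.solve-∀

*P-distribʳ : ∀ p r s i → coeff ((r +P s) *P p) i ≡ coeff (r *P p +P s *P p) i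
*P-distribʳ p r s i
  rewrite *P-comm (r +P s) p i | *P-distribˡ p r s i
        | coeff-+ (p *P r) (p *P s) i | coeff-+ (r *P p) (s *P p) i =
  cong₂ ℤ._+_ (*P-comm p r i) (*P-comm p s i)

scale-*P : ∀ c r s i → coeff (map (c ℤ.*_) r *P s) i ≡ c ℤ.* coeff (r *P s) i
scale-*P c []       s i = ≡.sym (ℤP.*-zeroʳ c)
scale-*P c (d ∷ ds) s zero
  rewrite coeff-*-zero (c ℤ.* d ∷ map (c ℤ.*_) ds) s | coeff-*-zero (d ∷ ds) s =
  ℤP.*-assoc c d (coeff s 0)
scale-*P c (d ∷ ds) s (suc i)
  rewrite coeff-*-suc (c ℤ.* d) (map (c ℤ.*_) ds) s i | coeff-*-suc d ds s i
        | scale-*P c ds s i =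
  lemma c d (coeff s (suc i)) (coeff (ds *P s) i)
  where
  lemma : ∀ c d x y → c ℤ.* d ℤ.* x ℤ.+ c ℤ.* y ≡ c ℤ.* (d ℤ.* x ℤ.+ y)
  lemma = ℤ-Solver.solve-∀

*P-assoc : ∀ p r s i → coeff ((p *P r) *P s) i ≡ coeff (p *P (r *P s)) i
*P-assoc []       r s i = refl
*P-assoc (c ∷ cs) r s i =
  ≡.trans (*P-distribʳ s (map (c ℤ.*_) r) (+ 0 ∷ (cs *P r)) i)
    (≡.trans (coeff-+ (map (c ℤ.*_) r *P s) _ i) (step i))
  where
  step : ∀ i → coeff (map (c ℤ.*_) r *P s) i ℤ.+ coeff ((+ 0 ∷ (cs *P r)) *P s) i
         ≡ coeff ((c ∷ cs) *P (r *P s)) i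
  step zero
    rewrite scale-*P c r s 0 | coeff-*-zero (+ 0 ∷ (cs *P r)) s
          | coeff-*-zero (c ∷ cs) (r *P s) = ℤP.+-identityʳ _
  step (suc i)
    rewrite scale-*P c r s (suc i) | coeff-*-suc (+ 0) (cs *P r) s i
          | coeff-*-suc c cs (r *P s) i | *P-assoc cs r s i =
    cong (λ x → c ℤ.* coeff (r *P s) (suc i) ℤ.+ x) (ℤP.+-identityˡ _)

-- A record, so that the two polynomials can be inferred from the type.
infix 4 _≋_
record _≋_ (p r : Poly) : Set where
  constructor ≋-in
  field ≋-out : p ≈P r
open _≋_ public

constP-+ : ∀ c d → constP (c ℤ.+ d) ≋ constP c +P constP d
constP-+ c d = ≋-in λ { zero → refl ; (suc i) → refl }

constP-* : ∀ c d → constP (c ℤ.* d) ≋ constP c *P constP d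
constP-* c d = ≋-in λ
  { zero → ≡.sym (ℤP.+-identityʳ _)
  ; (suc i) → refl }

constP-0 : constP (+ 0) ≋ []
constP-0 = ≋-in λ { zero → refl ; (suc i) → refl }

polyRing : CommutativeRing 0ℓ 0ℓ
polyRing = record
  { Carrier = Poly
  ; _≈_ = _≋_
  ; _+_ = _+P_
  ; _*_ = _*P_
  ; -_ = -P_
  ; 0# = []
  ; 1# = oneP
  ; isCommutativeRing = record
    { isRing = record
      { +-isAbelianGroup = record
        { isGroup = record
          { isMonoid = record
            { isSemigroup = record
              { isMagma = record
                { isEquivalence = record
                  { refl = ≋-in λ i → refl
                  ; sym = λ e → ≋-in λ i → ≡.sym (≋-out e i)
                  ; trans = λ e f → ≋-in λ i → ≡.trans (≋-out e i) (≋-out f i) }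
                ; ∙-cong = λ {p} {r} {s} {t} e f → ≋-in λ i →
                    ≡.trans (coeff-+ p s i)
                      (≡.trans (cong₂ ℤ._+_ (≋-out e i) (≋-out f i)) (≡.sym (coeff-+ r t i))) }
              ; assoc = λ p r s → ≋-in (+P-assoc p r s) }
            ; identity = (λ p → ≋-in λ i → refl) , λ p → ≋-in λ i →
                ≡.trans (coeff-+ p [] i) (ℤP.+-identityʳ _) }
          ; inverse =
              (λ p → ≋-in λ i → ≡.trans (coeff-+ (-P p) p i)
                (≡.trans (cong (ℤ._+ coeff p i) (coeff-neg p i)) (ℤP.+-inverseˡ (coeff p i))))
            , (λ p → ≋-in λ i → ≡.trans (coeff-+ p (-P p) i)
                (≡.trans (cong (λ x → coeff p i ℤ.+ x) (coeff-neg p i))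
                  (ℤP.+-inverseʳ (coeff p i))))
          ; ⁻¹-cong = λ {p} {r} e → ≋-in λ i →
              ≡.trans (coeff-neg p i) (≡.trans (cong ℤ.-_ (≋-out e i)) (≡.sym (coeff-neg r i))) }
        ; comm = λ p r → ≋-in λ i →
            ≡.trans (coeff-+ p r i) (≡.trans (ℤP.+-comm (coeff p i) _) (≡.sym (coeff-+ r p i))) }
      ; *-cong = λ {p} {r} {s} {t} e f → ≋-in λ i →
          ≡.trans (*P-congʳ p (≋-out f) i)
            (≡.trans (*P-comm p t i)
              (≡.trans (*P-congʳ t (≋-out e) i) (*P-comm t r i)))
      ; *-assoc = λ p r s → ≋-in (*P-assoc p r s)
      ; *-identity = (λ p → ≋-in (oneP-* p)) , λ p → ≋-in λ i →
          ≡.trans (*P-comm p oneP i) (oneP-* p i)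
      ; distrib = (λ p r s → ≋-in (*P-distribˡ p r s)) , λ p r s → ≋-in (*P-distribʳ p r s) }
    ; *-comm = λ p r → ≋-in (*P-comm p r) } }
  where
  +P-assoc : ∀ p r s → (p +P r) +P s ≈P p +P (r +P s)
  +P-assoc p r s i
    rewrite coeff-+ (p +P r) s i | coeff-+ p r i | coeff-+ p (r +P s) i | coeff-+ r s i =
    ℤP.+-assoc (coeff p i) (coeff r i) (coeff s i)
  oneP-* : ∀ p → oneP *P p ≈P p
  oneP-* p zero    = ≡.trans (coeff-*-zero oneP p) (ℤP.*-identityˡ _)
  oneP-* p (suc i) = ≡.trans (coeff-*-suc (+ 1) [] p i)
    (≡.trans (ℤP.+-identityʳ _) (ℤP.*-identityˡ _))

constP-hom : CommutativeRing.rawRing ℤP.+-*-commutativeRing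
             -Raw-AlmostCommutative⟶ fromCommutativeRing polyRing
constP-hom = record
  { ⟦_⟧    = constP
  ; +-homo = constP-+
  ; *-homo = constP-*
  ; -‿homo = λ c → ≋-in λ i → refl
  ; 0-homo = constP-0
  ; 1-homo = ≋-in λ i → refl }

-- Equational tools, finite sums and products in a commutative ring.

module RingTools (R : CommutativeRing 0ℓ 0ℓ)
  (ι : CommutativeRing.rawRing ℤP.+-*-commutativeRing
       -Raw-AlmostCommutative⟶ fromCommutativeRing R) where

  open CommutativeRing R public
    hiding (zero) renaming (refl to ≈-refl; sym to ≈-sym; trans to ≈-trans)
  module ≈-Reasoning where
    open import Relation.Binary.Reasoning.Setoid setoid public
  open ≈-Reasoning
  open import Algebra.Properties.Ring ring public using (-‿distribˡ-*)
  open _-Raw-AlmostCommutative⟶_ ι public using (⟦_⟧; +-homo; *-homo; -‿homo; 0-homo; 1-homo)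

  -- The solver evaluates the constants 0 and 1 by the homomorphism, so this one
  -- sends them to 0# and 1# definitionally.
  ⟦_⟧′ : ℤ → Carrier
  ⟦ + 0 ⟧′ = 0#
  ⟦ + 1 ⟧′ = 1#
  ⟦ + suc (suc n) ⟧′ = ⟦ + suc (suc n) ⟧
  ⟦ -[1+ n ] ⟧′ = ⟦ -[1+ n ] ⟧

  ⟦⟧′≈⟦⟧ : ∀ c → ⟦ c ⟧′ ≈ ⟦ c ⟧
  ⟦⟧′≈⟦⟧ (+ 0)           = ≈-sym 0-homo
  ⟦⟧′≈⟦⟧ (+ 1)           = ≈-sym 1-homo
  ⟦⟧′≈⟦⟧ (+ suc (suc n)) = ≈-refl
  ⟦⟧′≈⟦⟧ -[1+ n ]        = ≈-refl

  private
    ⟦⟧′-dec : ∀ c d → Maybe (⟦ c ⟧′ ≈ ⟦ d ⟧′)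
    ⟦⟧′-dec c d with c ℤP.≟ d
    ... | yes c≡d = just (reflexive (cong ⟦_⟧′ c≡d))
    ... | no  _   = nothing

    hom′ : CommutativeRing.rawRing ℤP.+-*-commutativeRing
           -Raw-AlmostCommutative⟶ fromCommutativeRing R
    hom′ = record
      { ⟦_⟧    = ⟦_⟧′
      ; +-homo = λ c d → ≈-trans (⟦⟧′≈⟦⟧ (c ℤ.+ d)) (≈-trans (+-homo c d)
                   (+-cong (≈-sym (⟦⟧′≈⟦⟧ c)) (≈-sym (⟦⟧′≈⟦⟧ d))))
      ; *-homo = λ c d → ≈-trans (⟦⟧′≈⟦⟧ (c ℤ.* d)) (≈-trans (*-homo c d)
                   (*-cong (≈-sym (⟦⟧′≈⟦⟧ c)) (≈-sym (⟦⟧′≈⟦⟧ d))))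
      ; -‿homo = λ c → ≈-trans (⟦⟧′≈⟦⟧ (ℤ.- c)) (≈-trans (-‿homo c)
                   (-‿cong (≈-sym (⟦⟧′≈⟦⟧ c))))
      ; 0-homo = ≈-refl
      ; 1-homo = ≈-refl }

  open Algebra.Solver.Ring (CommutativeRing.rawRing ℤP.+-*-commutativeRing)
    (fromCommutativeRing R)
    hom′
    ⟦⟧′-dec
    public using (solve; _:=_; _:+_; _:*_; _:-_; :-_; con)

  infixr 5.5 _⊙_
  infixl 5.2 _⊕_

  _⊙_ : ∀ c {x y} → x ≈ y → c * x ≈ c * y
  c ⊙ e = *-congˡ e

  _⊕_ : ∀ {x y u v} → x ≈ y → u ≈ v → x + u ≈ y + v
  _⊕_ = +-cong

  -- A goal follows from a linear combination of equations by a ring identity.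
  combine : ∀ {c d x y} → c ≈ d → x + d ≈ y + c → x ≈ y
  combine {c} {d} {x} {y} c≈d e = begin
    x              ≈⟨ solve 2 (λ x d → x := (x :+ d) :- d) ≈-refl x d ⟩
    (x + d) - d    ≈⟨ +-congʳ e ⟩
    (y + c) - d    ≈⟨ +-congʳ (+-congˡ c≈d) ⟩
    (y + d) - d    ≈⟨ solve 2 (λ y d → (y :+ d) :- d := y) ≈-refl y d ⟩
    y              ∎

  ∑ : ℕ → (ℕ → Carrier) → Carrier
  ∑ zero    f = 0#
  ∑ (suc k) f = ∑ k f + f k

  ∏ : ℕ → (ℕ → Carrier) → Carrier
  ∏ zero    f = 1#
  ∏ (suc k) f = ∏ k f * f k

  ∑-zero : ∀ k {f} → (∀ i → f i ≈ 0#) → ∑ k f ≈ 0#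
  ∑-zero zero    e = ≈-refl
  ∑-zero (suc k) e = ≈-trans (+-cong (∑-zero k e) (e k)) (+-identityˡ 0#)

  ∑-front : ∀ k f → ∑ (suc k) f ≈ f 0 + ∑ k (λ i → f (suc i))
  ∑-front zero    f = +-comm _ _
  ∑-front (suc k) f = ≈-trans (+-congʳ (∑-front k f)) (+-assoc _ _ _)

  ∏-cong : ∀ k {f g} → (∀ i → i < k → f i ≈ g i) → ∏ k f ≈ ∏ k g
  ∏-cong zero    e = ≈-refl
  ∏-cong (suc k) e =
    *-cong (∏-cong k (λ i i<k → e i (ℕP.m<n⇒m<1+n i<k))) (e k (ℕP.n<1+n k))

  ∏-front : ∀ k f → ∏ (suc k) f ≈ f 0 * ∏ k (λ i → f (suc i))
  ∏-front zero    f = *-comm _ _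
  ∏-front (suc k) f = ≈-trans (*-congʳ (∏-front k f)) (*-assoc _ _ _)

  ∏-* : ∀ k f g → ∏ k f * ∏ k g ≈ ∏ k (λ i → f i * g i)
  ∏-* zero    f g = *-identityˡ 1#
  ∏-* (suc k) f g = begin
    (∏ k f * f k) * (∏ k g * g k)
      ≈⟨ solve 4 (λ x a y b → (x :* a) :* (y :* b) := (x :* y) :* (a :* b)) ≈-refl _ _ _ _ ⟩
    (∏ k f * ∏ k g) * (f k * g k)
      ≈⟨ *-congʳ (∏-* k f g) ⟩
    ∏ k (λ i → f i * g i) * (f k * g k) ∎

  ∑-reverse : ∀ k f → ∑ (suc k) (λ i → f (k ℕ.∸ i)) ≈ ∑ (suc k) f
  ∑-reverse zero    f = ≈-refl
  ∑-reverse (suc k) f = begin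
    ∑ (suc (suc k)) (λ i → f (suc k ℕ.∸ i))  ≈⟨ ∑-front (suc k) _ ⟩
    f (suc k) + ∑ (suc k) (λ i → f (k ℕ.∸ i)) ≈⟨ +-congˡ (∑-reverse k f) ⟩
    f (suc k) + ∑ (suc k) f                  ≈⟨ +-comm _ _ ⟩
    ∑ (suc (suc k)) f                        ∎

  fromℕ : ℕ → Carrier
  fromℕ zero    = 0#
  fromℕ (suc c) = 1# + fromℕ c

  fromℕ≈⟦⟧ : ∀ c → fromℕ c ≈ ⟦ + c ⟧
  fromℕ≈⟦⟧ zero    = ≈-sym 0-homo
  fromℕ≈⟦⟧ (suc c) = ≈-sym (≈-trans (+-homo (+ 1) (+ c)) (+-cong 1-homo (≈-sym (fromℕ≈⟦⟧ c))))

-- The binomial coefficient C(k,2), as a recursion free of halving.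
tri : ℕ → ℕ
tri zero    = 0
tri (suc k) = tri k ℕ.+ k

-- With `B` = bn and `C` = an - bn this is ank - C(k,2). The subtraction is exact for K ≤ C, by
-- `tauExp-tri`.
tauExp : ℕ → ℕ → ℕ → ℕ
tauExp B C K = (B ℕ.+ C) ℕ.* K ℕ.∸ tri K

-- q-binomial coefficients, the sums A_n and the summands of τ.

module QSeries (R : CommutativeRing 0ℓ 0ℓ)
  (ι : CommutativeRing.rawRing ℤP.+-*-commutativeRing
       -Raw-AlmostCommutative⟶ fromCommutativeRing R)
  (Q : ℕ → CommutativeRing.Carrier R)
  (Q-0 : CommutativeRing._≈_ R (Q 0) (CommutativeRing.1# R))
  (Q-+ : ∀ i j → CommutativeRing._≈_ R (Q (i ℕ.+ j)) (CommutativeRing._*_ R (Q i) (Q j)))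
  where

  open RingTools R ι public
  open ≈-Reasoning

  E : ℕ → Carrier
  E m = 1# - Q m

  sg : ℕ → Carrier
  sg zero    = 1#
  sg (suc k) = - sg k

  Q-≡ : ∀ {m} i j → m ≡ i ℕ.+ j → Q m ≈ Q i * Q j
  Q-≡ i j refl = Q-+ i j

  -- W k n is the q-binomial coefficient [n - k; k].
  W : ℕ → ℕ → Carrier
  W zero    n             = 1#
  W (suc k) zero          = 0#
  W (suc k) (suc zero)    = 0#
  W (suc k) (suc (suc n)) = W k n + Q (suc k) * W (suc k) (suc n)

  W-vanish : ∀ k n → n < k ℕ.+ k → W k n ≈ 0#
  W-vanish (suc k) zero          _ = ≈-refl
  W-vanish (suc k) (suc zero)    _ = ≈-refl
  W-vanish (suc k) (suc (suc n)) (s≤s n<2k+1) = begin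
    W k n + Q (suc k) * W (suc k) (suc n)
      ≈⟨ +-cong (W-vanish k n n<2k)
                (*-congˡ (W-vanish (suc k) (suc n) (s≤s (ℕP.<⇒≤ n<2k+1)))) ⟩
    0# + Q (suc k) * 0#
      ≈⟨ solve 1 (λ x → con (+ 0) :+ x :* con (+ 0) := con (+ 0)) ≈-refl _ ⟩
    0# ∎
    where
    n<2k : n < k ℕ.+ k
    n<2k = ℕP.≤-pred (subst (suc n <_) (ℕP.+-suc k k) n<2k+1)

  W₁-step : ∀ n → W 1 (suc (suc n)) ≈ W 1 (suc n) + Q n
  W₁-step zero = combine (1# ⊙ ≈-sym Q-0)
    (solve 2
      (λ x y →
        con (+ 1) :+ y :* con (+ 0) :+ (con (+ 1) :* x)
        := con (+ 0) :+ x :+ (con (+ 1) :* con (+ 1))) ≈-refl (Q 0) (Q 1))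
  W₁-step (suc n) = combine (Q 1 ⊙ W₁-step n ⊕ - 1# ⊙ Q-+ 1 n)
    (solve 4
      (λ w q x y →
        con (+ 1) :+ q :* (con (+ 1) :+ q :* w) :+ (q :* (w :+ x) :+ (:- con (+ 1)) :* (q :*
        x))
        := (con (+ 1) :+ q :* w) :+ y :+ (q :* (con (+ 1) :+ q :* w) :+ (:- con (+ 1)) :*
        y)) ≈-refl
      (W 1 (suc n)) (Q 1) (Q n) (Q (suc n)))

  -- The second Pascal rule, multiplied by q^2k because n may be less than 2k.
  W-pascal : ∀ k n → Q k * Q k * W (suc k) (suc (suc n))
                     ≈ Q k * Q k * W (suc k) (suc n) + Q n * W k n
  W-pascal zero n = combine (1# ⊙ W₁-step n ⊕ (W 1 (suc (suc n)) - W 1 (suc n)) ⊙ sq)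
    (solve 4
      (λ x y v w →
        x :* x :* v :+ (con (+ 1) :* (w :+ y) :+ (v :- w) :* con (+ 1))
        := x :* x :* w :+ y :* con (+ 1) :+ (con (+ 1) :* v :+ (v :- w) :* (x :* x))) ≈-refl
      (Q 0) (Q n) (W 1 (suc (suc n))) (W 1 (suc n)))
    where
    sq : Q 0 * Q 0 ≈ 1#
    sq = ≈-trans (*-cong Q-0 Q-0) (*-identityˡ 1#)
  W-pascal (suc k) zero =
    solve 3
      (λ x y z →
        x :* x :* (con (+ 0) :+ y :* con (+ 0))
        := x :* x :* con (+ 0) :+ z :* con (+ 0)) ≈-refl (Q (suc k)) (Q (suc (suc k))) (Q 0)
  W-pascal (suc k) (suc zero) =
    solve 3
      (λ x y z →
        x :* x :* (con (+ 0) :+ y :* (con (+ 0) :+ y :* con (+ 0)))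
        := x :* x :* (con (+ 0) :+ y :* con (+ 0)) :+ z :* con (+ 0)) ≈-refl
      (Q (suc k)) (Q (suc (suc k))) (Q 1)
  W-pascal (suc k) (suc (suc n)) = combine
    (Q 1 * Q 1 ⊙ W-pascal k n ⊕ Q (suc (suc k)) ⊙ W-pascal (suc k) (suc n)
      ⊕ (Q (suc k) + Q 1 * Q k) * (W (suc k) (suc (suc n)) - W (suc k) (suc n)) ⊙ Q-+ 1 k
      ⊕ Q (suc n) * W (suc k) (suc n) ⊙ Q-+ 1 (suc k)
      ⊕ - W (suc k) (suc (suc n)) ⊙ Q-+ 1 (suc n) ⊕ - (Q 1 * W k n) ⊙ Q-+ 1 n)
    (solve 10
      (λ w b d x y y₂ z N N₁ N₂ →
        let a = w :+ y :* b ; c = b :+ y₂ :* d in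
        y :* y :* (a :+ y₂ :* c) :+ ((z :* z) :* (x :* x :* b :+ N :* w) :+ y₂ :* (y :* y :*
        d :+ N₁ :* b) :+ ((y :+ z :* x) :* (a :- b)) :* (z :* x) :+ (N₁ :* b) :* (z :* y) :+
        (:- a) :* (z :* N₁) :+ (:- (z :* w)) :* (z :* N))
        := y :* y :* c :+ N₂ :* a :+ ((z :* z) :* (x :* x :* a) :+ y₂ :* (y :* y :* c) :+
        ((y :+ z :* x) :* (a :- b)) :* y :+ (N₁ :* b) :* y₂ :+ (:- a) :* N₂ :+ (:- (z :* w))
        :* N₁)) ≈-refl
      (W k n) (W (suc k) (suc n)) (W (suc (suc k)) (suc (suc n)))
      (Q k) (Q (suc k)) (Q (suc (suc k))) (Q 1) (Q n) (Q (suc n)) (Q (suc (suc n))))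

  -- `α n` is the summand of A_n. The first Pascal rule applied to it produces the weight q^j, so
  -- the sum B_n of `β n` is carried along: A_(n+2) = B_(n+1) - B_n and B_(n+2) = B_(n+1) - q^(n+1)
  -- A_n form a closed system.
  α β : ℕ → ℕ → Carrier
  α n j = sg j * Q (tri j) * W j n
  β n j = Q j * α n j

  α-step : ∀ n j → α (suc (suc n)) (suc j) ≈ β (suc n) (suc j) - β n j
  α-step n j = combine (- (sg j * W j n) ⊙ Q-+ (tri j) j)
    (solve 7
      (λ s P t x y w v →
        (:- s) :* P :* (w :+ y :* v) :+ ((:- (s :* w)) :* (t :* x))
        := y :* ((:- s) :* P :* v) :- x :* (s :* t :* w) :+ ((:- (s :* w)) :* P)) ≈-refl
      (sg j) (Q (tri j ℕ.+ j)) (Q (tri j)) (Q j) (Q (suc j)) (W j n) (W (suc j) (suc n)))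

  -- The weight q^(j+1) together with C(j+1,2) = C(j,2) + j supplies the q^(2j) that `W-pascal`
  -- demands, so no division by a power of q occurs.
  β-step : ∀ n j → β (suc (suc n)) (suc j) ≈ β (suc n) (suc j) - Q (suc n) * α n j
  β-step n j = combine
    (- (sg j * Q (suc j) * (W (suc j) (suc (suc n)) - W (suc j) (suc n))) ⊙ Q-+ (tri j) j
      ⊕ - (sg j * Q (tri j) * Q j * (W (suc j) (suc (suc n)) - W (suc j) (suc n))) ⊙ Q-+ 1 j
      ⊕ - (sg j * Q 1 * Q (tri j)) ⊙ W-pascal j n
      ⊕ sg j * Q (tri j) * W j n ⊙ Q-+ 1 n)
    (solve 11
      (λ s P t x y z N N₁ w v u →
        y :* ((:- s) :* P :* u) :+ ((:- (s :* y :* (u :- v))) :* (t :* x) :+ (:- (s :* t :*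
        x :* (u :- v))) :* (z :* x) :+ (:- (s :* z :* t)) :* (x :* x :* v :+ N :* w) :+ (s
        :* t :* w) :* (z :* N))
        := y :* ((:- s) :* P :* v) :- N₁ :* (s :* t :* w) :+ ((:- (s :* y :* (u :- v))) :* P
        :+ (:- (s :* t :* x :* (u :- v))) :* y :+ (:- (s :* z :* t)) :* (x :* x :* u) :+ (s
        :* t :* w) :* N₁)) ≈-refl
      (sg j) (Q (tri j ℕ.+ j)) (Q (tri j)) (Q j) (Q (suc j)) (Q 1) (Q n) (Q (suc n))
      (W j n) (W (suc j) (suc n)) (W (suc j) (suc (suc n))))

  α-vanish : ∀ n j → n < j ℕ.+ j → α n j ≈ 0#
  α-vanish n j n<2j = ≈-trans (*-congˡ (W-vanish j n n<2j)) (zeroʳ _)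

  ∑α-step : ∀ K n → ∑ (suc K) (α (suc (suc n))) ≈ ∑ (suc K) (β (suc n)) - ∑ K (β n)
  ∑α-step zero n = combine (Q 0 ⊙ ≈-sym Q-0)
    (solve 1
      (λ x →
        con (+ 0) :+ con (+ 1) :* x :* con (+ 1) :+ (x :* x)
        := con (+ 0) :+ x :* (con (+ 1) :* x :* con (+ 1)) :- con (+ 0) :+ (x :* con (+ 1)))
        ≈-refl (Q 0))
  ∑α-step (suc K) n = combine (1# ⊙ ∑α-step K n ⊕ 1# ⊙ α-step n K)
    (solve 6
      (λ A a B b D d →
        A :+ a :+ (con (+ 1) :* (B :- D) :+ con (+ 1) :* (b :- d))
        := B :+ b :- (D :+ d) :+ (con (+ 1) :* A :+ con (+ 1) :* a)) ≈-refl _ _ _ _ _ _)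

  ∑β-step : ∀ K n →
    ∑ (suc K) (β (suc (suc n))) ≈ ∑ (suc K) (β (suc n)) - Q (suc n) * ∑ K (α n)
  ∑β-step zero n = solve 2
    (λ x y →
      x := x :- y :* con (+ 0)) ≈-refl _ (Q (suc n))
  ∑β-step (suc K) n = combine (1# ⊙ ∑β-step K n ⊕ 1# ⊙ β-step n K)
    (solve 7
      (λ A a B b D d q →
        A :+ a :+ (con (+ 1) :* (B :- q :* D) :+ con (+ 1) :* (b :- q :* d))
        := B :+ b :- q :* (D :+ d) :+ (con (+ 1) :* A :+ con (+ 1) :* a)) ≈-refl
      _ _ _ _ _ _ (Q (suc n)))

  -- Substituting one recursion into the other cancels the sums of `β`, except for the top term
  -- `β (suc n) K`, because the lengths differ by one. The bound on `n` makes that term zero.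
  ∑α-step₃ : ∀ K n → suc n < K ℕ.+ K →
    ∑ (suc K) (α (suc (suc (suc n)))) ≈ - (Q (suc n) * ∑ K (α n))
  ∑α-step₃ K n n+1<2K = combine
    (1# ⊙ ∑α-step K (suc n) ⊕ 1# ⊙ ∑β-step K n
      ⊕ Q K ⊙ α-vanish (suc n) K n+1<2K)
    (solve 7
      (λ A B₂ B D q a x →
        A :+ (con (+ 1) :* (B₂ :- B) :+ con (+ 1) :* (B :+ x :* a :- q :* D) :+ x :* con (+
        0))
        := (:- (q :* D)) :+ (con (+ 1) :* A :+ con (+ 1) :* B₂ :+ x :* a)) ≈-refl
      _ _ _ _ (Q (suc n)) _ _)

  -- The value of A_n read off from its three-step recursion. Each value is 0 or a signed power of q
  -- with a generalised pentagonal exponent, which is where the exponents in θ and ϑ come from.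
  pent : ℕ → Carrier
  pent 0                   = 1#
  pent 1                   = 1#
  pent 2                   = 0#
  pent (suc (suc (suc n))) = - (Q (suc n) * pent n)

  -- Any cut-off beyond n/2 gives the same sum. Lowering `n` by three and `K` by one respects this
  -- bound, so the induction runs on both.
  ∑α≈pent : ∀ K n → n < K ℕ.+ K → ∑ K (α n) ≈ pent n
  ∑α≈pent (suc K) 0 _ = begin
    ∑ (suc K) (α 0)                        ≈⟨ ∑-front K (α 0) ⟩
    α 0 0 + ∑ K (λ i → α 0 (suc i))        ≈⟨ +-congˡ (∑-zero K (λ i → zeroʳ _)) ⟩
    α 0 0 + 0#                             ≈⟨ combine (1# ⊙ Q-0)
      (solve 1
        (λ x →
          con (+ 1) :* x :* con (+ 1) :+ con (+ 0) :+ (con (+ 1) :* con (+ 1))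
          := con (+ 1) :+ (con (+ 1) :* x)) ≈-refl (Q 0)) ⟩
    1#                                     ∎
  ∑α≈pent (suc K) 1 _ = begin
    ∑ (suc K) (α 1)                        ≈⟨ ∑-front K (α 1) ⟩
    α 1 0 + ∑ K (λ i → α 1 (suc i))        ≈⟨ +-congˡ (∑-zero K (λ i → zeroʳ _)) ⟩
    α 1 0 + 0#                             ≈⟨ combine (1# ⊙ Q-0)
      (solve 1
        (λ x →
          con (+ 1) :* x :* con (+ 1) :+ con (+ 0) :+ (con (+ 1) :* con (+ 1))
          := con (+ 1) :+ (con (+ 1) :* x)) ≈-refl (Q 0)) ⟩
    1#                                     ∎
  ∑α≈pent (suc zero) 2 (s≤s (s≤s ()))
  ∑α≈pent (suc (suc K)) 2 _ = begin
    ∑ (suc (suc K)) (α 2)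
      ≈⟨ ∑-front (suc K) (α 2) ⟩
    α 2 0 + ∑ (suc K) (λ i → α 2 (suc i))
      ≈⟨ +-congˡ (∑-front K (λ i → α 2 (suc i))) ⟩
    α 2 0 + (α 2 1 + ∑ K (λ i → α 2 (suc (suc i))))
      ≈⟨ +-congˡ (+-congˡ (∑-zero K (λ i → α-vanish 2 (suc (suc i)) (2<2i+4 i)))) ⟩
    α 2 0 + (α 2 1 + 0#)
      ≈⟨ solve 2
        (λ x y →
          con (+ 1) :* x :* con (+ 1) :+ ((:- con (+ 1)) :* x :* (con (+ 1) :+ y :* con (+ 0))
          :+ con (+ 0))
          := con (+ 0)) ≈-refl (Q 0) (Q 1) ⟩
    0# ∎
    where
    2<2i+4 : ∀ i → 2 < suc (suc i) ℕ.+ suc (suc i)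
    2<2i+4 i = s≤s (s≤s (ℕP.≤-trans (s≤s z≤n) (ℕP.m≤n+m (suc (suc i)) i)))
  ∑α≈pent (suc K) (suc (suc (suc n))) (s≤s n+3≤) = begin
    ∑ (suc K) (α (suc (suc (suc n))))  ≈⟨ ∑α-step₃ K n n+1<2K ⟩
    - (Q (suc n) * ∑ K (α n))          ≈⟨ -‿cong (*-congˡ (∑α≈pent K n (ℕP.<⇒≤ n+1<2K))) ⟩
    - (Q (suc n) * pent n)             ∎
    where
    n+1<2K : suc n < K ℕ.+ K
    n+1<2K = ℕP.≤-pred (subst (suc (suc (suc n)) ≤_) (ℕP.+-suc K K) n+3≤)

  -- The product (1 - q^(l+1)) ⋯ (1 - q^(l+k)); `∏E 0 k` is the usual (q;q)_k.
  ∏E : ℕ → ℕ → Carrier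
  ∏E l k = ∏ k (λ i → E (l ℕ.+ suc i))

  E-≡ : ∀ {i j} → i ≡ j → E i ≈ E j
  E-≡ refl = ≈-refl

  ∏E-front : ∀ l k → ∏E l (suc k) ≈ E (suc l) * ∏E (suc l) k
  ∏E-front l k = ≈-trans (∏-front k _)
    (*-cong (E-≡ (ℕP.+-comm l 1)) (∏-cong k (λ i _ → E-≡ (ℕP.+-suc l (suc i)))))

  -- gauss k l is the q-binomial coefficient [k + l; k].
  gauss : ℕ → ℕ → Carrier
  gauss zero    l       = 1#
  gauss (suc k) zero    = 1#
  gauss (suc k) (suc l) = gauss k (suc l) + Q (suc k) * gauss (suc k) l

  -- For n = 2k + l the recursion of `W` is the Pascal recursion of `gauss`; on the boundary l = 0
  -- its second term vanishes by `W-vanish`.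
  W≈gauss : ∀ k l → W k (k ℕ.+ k ℕ.+ l) ≈ gauss k l
  W≈gauss zero    l = ≈-refl
  W≈gauss (suc k) l rewrite ℕP.+-suc k k = step l
    where
    step : ∀ l → W k (k ℕ.+ k ℕ.+ l) + Q (suc k) * W (suc k) (suc (k ℕ.+ k ℕ.+ l))
                 ≈ gauss (suc k) l
    step zero = begin
      _ + Q (suc k) * W (suc k) (suc (k ℕ.+ k ℕ.+ 0))
        ≈⟨ +-cong (W≈gauss k 0) (*-congˡ (W-vanish (suc k) _
             (s≤s (ℕP.≤-reflexive (≡.trans (cong suc (ℕP.+-identityʳ _))
               (≡.sym (ℕP.+-suc k k))))))) ⟩
      gauss k 0 + Q (suc k) * 0#  ≈⟨ +-cong (gauss-0 k) (zeroʳ _) ⟩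
      1# + 0#                     ≈⟨ +-identityʳ 1# ⟩
      1#                          ∎
      where
      gauss-0 : ∀ k → gauss k 0 ≈ 1#
      gauss-0 zero    = ≈-refl
      gauss-0 (suc k) = ≈-refl
    step (suc l) rewrite ℕP.+-suc (k ℕ.+ k) l =
      +-cong (≈-trans (reflexive (cong (W k) (≡.sym (ℕP.+-suc (k ℕ.+ k) l)))) (W≈gauss k (suc l)))
        (*-congˡ (step l))

  gauss-∏E : ∀ k l → gauss k l * ∏E 0 k ≈ ∏E l k
  gauss-∏E zero    l       = *-identityˡ 1#
  gauss-∏E (suc k) zero    = *-identityˡ _
  gauss-∏E (suc k) (suc l) = combine
    (E (suc k) ⊙ gauss-∏E k (suc l) ⊕ Q (suc k) ⊙ gauss-∏E (suc k) l
      ⊕ Q (suc k) ⊙ ∏E-front l k ⊕ ∏E (suc l) k ⊙ Q-≡ (suc k) (suc l) (ℕP.+-comm (suc l) (suc k)))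
    (solve 8
      (λ g x h F r s y z →
        (g :+ x :* h) :* (F :* (con (+ 1) :- x)) :+ ((con (+ 1) :- x) :* r :+ x :* s :+ x :*
        ((con (+ 1) :- y) :* r) :+ r :* (x :* y))
        := r :* (con (+ 1) :- z) :+ ((con (+ 1) :- x) :* (g :* F) :+ x :* (h :* (F :* (con
        (+ 1) :- x))) :+ x :* s :+ r :* z)) ≈-refl
      (gauss k (suc l)) (Q (suc k)) (gauss (suc k) l) (∏E 0 k) (∏E (suc l) k) (∏E l (suc k))
      (Q (suc l)) (Q (suc l ℕ.+ suc k)))

  -- The two absorption rules prove each other through the Pascal recursion. They share their
  -- right-hand side, so `gauss-shift` can exchange one for the other.
  gauss-absorb₁ : ∀ k l → gauss (suc k) l * E (suc k) ≈ gauss k l * E (suc (k ℕ.+ l))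
  gauss-absorb₂ : ∀ k l → gauss k (suc l) * E (suc l) ≈ gauss k l * E (suc (k ℕ.+ l))

  gauss-absorb₁ k zero = *-cong (gauss-0 k) (E-≡ (cong suc (≡.sym (ℕP.+-identityʳ k))))
    where
    gauss-0 : ∀ k → 1# ≈ gauss k 0
    gauss-0 zero    = ≈-refl
    gauss-0 (suc k) = ≈-refl
  gauss-absorb₁ k (suc l) = combine
    (Q (suc k) ⊙ gauss-absorb₁ k l ⊕ - Q (suc k) ⊙ gauss-absorb₂ k l
      ⊕ gauss k (suc l) ⊙ Q-+ (suc k) (suc l))
    (solve 7
      (λ g x h y z w m →
        (g :+ x :* h) :* (con (+ 1) :- x) :+ (x :* (m :* (con (+ 1) :- w)) :+ (:- x) :* (m
        :* (con (+ 1) :- w)) :+ g :* (x :* y))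
        := g :* (con (+ 1) :- z) :+ (x :* (h :* (con (+ 1) :- x)) :+ (:- x) :* (g :* (con (+
        1) :- y)) :+ g :* z)) ≈-refl
      (gauss k (suc l)) (Q (suc k)) (gauss (suc k) l) (Q (suc l)) (Q (suc (k ℕ.+ suc l)))
      (Q (suc (k ℕ.+ l))) (gauss k l))

  gauss-absorb₂ zero    l = ≈-refl
  gauss-absorb₂ (suc k) l = combine
    (- 1# ⊙ gauss-absorb₁ k l ⊕ 1# ⊙ gauss-absorb₂ k l
      ⊕ gauss (suc k) l ⊙ Q-≡ (suc k) (suc l) (cong suc (≡.sym (ℕP.+-suc k l))))
    (solve 7
      (λ g x h y z w m →
        (g :+ x :* h) :* (con (+ 1) :- y) :+ ((:- con (+ 1)) :* (m :* (con (+ 1) :- w)) :+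
        con (+ 1) :* (m :* (con (+ 1) :- w)) :+ h :* (x :* y))
        := h :* (con (+ 1) :- z) :+ ((:- con (+ 1)) :* (h :* (con (+ 1) :- x)) :+ con (+ 1)
        :* (g :* (con (+ 1) :- y)) :+ h :* z)) ≈-refl
      (gauss k (suc l)) (Q (suc k)) (gauss (suc k) l) (Q (suc l)) (Q (suc (suc k ℕ.+ l)))
      (Q (suc (k ℕ.+ l))) (gauss k l))

  -- Moves from [an; k] to [an; bn] by absorbing j times. For K + j = C the last factor of `∏E K j`
  -- is 1 - q^C, the source of the first factor 1 - q^n in each summand.
  gauss-shift : ∀ j K B →
    gauss K (B ℕ.+ j) * ∏E B j ≈ gauss (K ℕ.+ j) B * ∏E K j
  gauss-shift zero    K B rewrite ℕP.+-identityʳ B | ℕP.+-identityʳ K = ≈-refl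
  gauss-shift (suc j) K B rewrite ℕP.+-suc B j = ≈-trans (combine
    (∏E B j ⊙ gauss-absorb₂ K (B ℕ.+ j) ⊕ - ∏E B j ⊙ gauss-absorb₁ K (B ℕ.+ j)
      ⊕ E (suc K) ⊙ gauss-shift j (suc K) B
      ⊕ gauss (suc (K ℕ.+ j)) B ⊙ ≈-sym (∏E-front K j))
    (solve 10
      (λ g r y h x m w u t s →
        g :* (r :* (con (+ 1) :- y)) :+ (r :* (m :* w) :+ (:- r) :* (m :* w) :+ (con (+ 1)
        :- x) :* (u :* t) :+ u :* s)
        := u :* s :+ (r :* (g :* (con (+ 1) :- y)) :+ (:- r) :* (h :* (con (+ 1) :- x)) :+
        (con (+ 1) :- x) :* (h :* r) :+ u :* ((con (+ 1) :- x) :* t))) ≈-refl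
      (gauss K (suc (B ℕ.+ j))) (∏E B j) (Q (suc (B ℕ.+ j))) (gauss (suc K) (B ℕ.+ j))
      (Q (suc K)) (gauss K (B ℕ.+ j)) (E (suc (K ℕ.+ (B ℕ.+ j)))) (gauss (suc (K ℕ.+ j)) B)
      (∏E (suc K) j) (∏E K (suc j))))
    (*-congʳ (reflexive (cong (λ i → gauss i B) (≡.sym (ℕP.+-suc K j)))))

  -- With B = b n and C = a n - b n: the term k = K of the sum, where K = C - j.
  τ-summand : ℕ → ℕ → ℕ → ℕ → Carrier
  τ-summand B C K j = sg K * Q (tauExp B C K) * gauss K (B ℕ.+ j) * gauss j (B ℕ.+ B ℕ.+ j)

  -- The summand j = 0, and at the same time the factor in front of the braces on the right-hand
  -- side. Hence the summands with j > 0 have to account for the multiple of a - b alone.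
  τ-leading : ℕ → ℕ → Carrier
  τ-leading B C = sg C * Q (tauExp B C C) * gauss C B

  τ-summand-0 : ∀ B C → τ-summand B C C 0 ≈ τ-leading B C
  τ-summand-0 B C = ≈-trans (*-identityʳ _) (*-congˡ
    (reflexive (cong (gauss C) (ℕP.+-identityʳ B))))

-- Arithmetic of the exponents.

tri-+ : ∀ i j → tri (i ℕ.+ j) ≡ tri i ℕ.+ tri j ℕ.+ i ℕ.* j
tri-+ i zero    rewrite ℕP.+-identityʳ i | ℕP.*-zeroʳ i = lemma (tri i)
  where
  lemma : ∀ t → t ≡ t ℕ.+ 0 ℕ.+ 0
  lemma = ℕ-Solver.solve-∀
tri-+ i (suc j) rewrite ℕP.+-suc i j | tri-+ i j | ℕP.*-suc i j =
  lemma (tri i) (tri j) i j (i ℕ.* j)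
  where
  lemma : ∀ s t i j p → s ℕ.+ t ℕ.+ p ℕ.+ (i ℕ.+ j) ≡ s ℕ.+ (t ℕ.+ j) ℕ.+ (i ℕ.+ p)
  lemma = ℕ-Solver.solve-∀

tri-double : ∀ j → tri j ℕ.+ tri (suc j) ≡ j ℕ.* j
tri-double zero    = refl
tri-double (suc j) = ≡.trans (lemma (tri j) j)
  (≡.trans (cong (λ i → i ℕ.+ j ℕ.+ suc j) (tri-double j)) (lemma′ j))
  where
  lemma : ∀ t j → t ℕ.+ j ℕ.+ (t ℕ.+ j ℕ.+ suc j) ≡ t ℕ.+ (t ℕ.+ j) ℕ.+ j ℕ.+ suc j
  lemma = ℕ-Solver.solve-∀
  lemma′ : ∀ j → j ℕ.* j ℕ.+ j ℕ.+ suc j ≡ suc j ℕ.* suc j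
  lemma′ = ℕ-Solver.solve-∀

-- The exponent (u+1) + ⋯ + (u+k) that accumulates when k factors are reflected in `∏E-reflect`.
reflExp : ℕ → ℕ → ℕ
reflExp u zero    = 0
reflExp u (suc k) = reflExp u k ℕ.+ (u ℕ.+ suc k)

reflExp≡ : ∀ u k → reflExp u k ≡ u ℕ.* k ℕ.+ tri (suc k)
reflExp≡ u zero    = ≡.sym (≡.trans (ℕP.+-identityʳ _) (ℕP.*-zeroʳ u))
reflExp≡ u (suc k) rewrite reflExp≡ u k | ℕP.*-suc u k = lemma (u ℕ.* k) (tri (suc k)) u k
  where
  lemma : ∀ p t u k → p ℕ.+ t ℕ.+ (u ℕ.+ suc k) ≡ u ℕ.+ p ℕ.+ (t ℕ.+ suc k)
  lemma = ℕ-Solver.solve-∀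

-- With j = k + 1 the sum (j+1) + ⋯ + (j+k) is k j + C(j,2) = 3 C(j,2); this accounts for the cube
-- of q^C(j,2) in `summand~`.
reflExp-suc : ∀ k → reflExp (suc k) k ≡ tri (suc k) ℕ.+ (tri (suc k) ℕ.+ tri (suc k))
reflExp-suc k = ≡.trans (reflExp≡ (suc k) k)
  (≡.trans (ℕP.+-comm (suc k ℕ.* k) _)
    (cong (tri (suc k) ℕ.+_) (≡.trans (cong (k ℕ.+_) (≡.sym (tri-double k))) (lemma (tri k) k))))
  where
  lemma : ∀ t k → k ℕ.+ (t ℕ.+ (t ℕ.+ k)) ≡ t ℕ.+ k ℕ.+ (t ℕ.+ k)
  lemma = ℕ-Solver.solve-∀

-- The difference is (B + C) j - C(j,2) - K j with C = K + j, that is B j + j^2 - C(j,2). The two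
-- exponents are given by additive equations so that truncated subtraction never has to be
-- rearranged.
exponent-shift : ∀ B K j e₀ e → e₀ ℕ.+ tri (K ℕ.+ j) ≡ (B ℕ.+ (K ℕ.+ j)) ℕ.* (K ℕ.+ j) →
  e ℕ.+ tri K ≡ (B ℕ.+ (K ℕ.+ j)) ℕ.* K → e₀ ≡ e ℕ.+ (B ℕ.* j ℕ.+ tri (suc j))
exponent-shift B K j e₀ e h₀ h = ℕP.+-cancelʳ-≡ (tri K ℕ.+ tri j ℕ.+ K ℕ.* j) _ _ (begin
  e₀ ℕ.+ (tri K ℕ.+ tri j ℕ.+ K ℕ.* j)                       ≡⟨ cong (e₀ ℕ.+_) (≡.sym (tri-+ K j)) ⟩
  e₀ ℕ.+ tri (K ℕ.+ j)                                       ≡⟨ h₀ ⟩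
  (B ℕ.+ (K ℕ.+ j)) ℕ.* (K ℕ.+ j)                            ≡⟨ lemma B K j ⟩
  (B ℕ.+ (K ℕ.+ j)) ℕ.* K ℕ.+ (B ℕ.* j ℕ.+ K ℕ.* j) ℕ.+ j ℕ.* j
    ≡⟨ cong₂ (λ u v → u ℕ.+ (B ℕ.* j ℕ.+ K ℕ.* j) ℕ.+ v) (≡.sym h) (≡.sym (tri-double j)) ⟩
  e ℕ.+ tri K ℕ.+ (B ℕ.* j ℕ.+ K ℕ.* j) ℕ.+ (tri j ℕ.+ tri (suc j))
    ≡⟨ lemma′ e (tri K) (B ℕ.* j) (K ℕ.* j) (tri j) (tri (suc j)) ⟩
  e ℕ.+ (B ℕ.* j ℕ.+ tri (suc j)) ℕ.+ (tri K ℕ.+ tri j ℕ.+ K ℕ.* j) ∎)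
  where
  open ≡.≡-Reasoning
  lemma : ∀ B K j → (B ℕ.+ (K ℕ.+ j)) ℕ.* (K ℕ.+ j) ≡ (B ℕ.+ (K ℕ.+ j)) ℕ.* K ℕ.+
    (B ℕ.* j ℕ.+ K ℕ.* j) ℕ.+ j ℕ.* j
  lemma = ℕ-Solver.solve-∀
  lemma′ : ∀ e t p r u v → e ℕ.+ t ℕ.+ (p ℕ.+ r) ℕ.+ (u ℕ.+ v) ≡ e ℕ.+ (p ℕ.+ v) ℕ.+ (t ℕ.+ u ℕ.+ r)
  lemma′ = ℕ-Solver.solve-∀

-- Congruences modulo 1 - q^N.

module Congruence (R : CommutativeRing 0ℓ 0ℓ)
  (ι : CommutativeRing.rawRing ℤP.+-*-commutativeRing
       -Raw-AlmostCommutative⟶ fromCommutativeRing R)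
  (Q : ℕ → CommutativeRing.Carrier R)
  (Q-0 : CommutativeRing._≈_ R (Q 0) (CommutativeRing.1# R))
  (Q-+ : ∀ i j → CommutativeRing._≈_ R (Q (i ℕ.+ j)) (CommutativeRing._*_ R (Q i) (Q j)))
  (N : ℕ) where

  open QSeries R ι Q Q-0 Q-+

  infix 4 _~_
  _~_ : Carrier → Carrier → Set
  x ~ y = ∃[ z ] x ≈ y + z * E N

  ⇑ : ∀ {x y} → x ≈ y → x ~ y
  ⇑ {x} {y} x≈y = 0# , ≈-trans x≈y (solve 2
    (λ y e →
      y := y :+ con (+ 0) :* e) ≈-refl y (E N))

  infixr 5.5 _⊙~_
  infixl 5.2 _⊕~_

  _⊙~_ : ∀ c {x y} → x ~ y → c * x ~ c * y
  _⊙~_ c {x} {y} (z , x≈) = c * z , ≈-trans (*-congˡ x≈)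
    (solve 4
      (λ c y z e →
        c :* (y :+ z :* e) := c :* y :+ c :* z :* e) ≈-refl c y z (E N))

  _⊕~_ : ∀ {x y u v} → x ~ y → u ~ v → x + u ~ y + v
  _⊕~_ {x} {y} {u} {v} (z , x≈) (w , u≈) = z + w , ≈-trans (+-cong x≈ u≈)
    (solve 5
      (λ y z v w e →
        y :+ z :* e :+ (v :+ w :* e) := y :+ v :+ (z :+ w) :* e) ≈-refl y z v w (E N))

  combine~ : ∀ {c d x y} → c ~ d → x + d ≈ y + c → x ~ y
  combine~ {c} {d} {x} {y} (z , c≈) x+d≈y+c = z , combine (1# ⊙ c≈ ⊕ 1# ⊙ x+d≈y+c)
    (solve 6
      (λ c d x y e z →
        x :+ (con (+ 1) :* (d :+ z :* e) :+ con (+ 1) :* (y :+ c))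
        := y :+ z :* e :+ (con (+ 1) :* c :+ con (+ 1) :* (x :+ d))) ≈-refl c d x y (E N) z)

  Q-N : Q N ~ 1#
  Q-N = - 1# , solve 1
    (λ x →
      x := con (+ 1) :+ (:- con (+ 1)) :* (con (+ 1) :- x)) ≈-refl (Q N)

  Q-period : ∀ c → Q (c ℕ.* N) ~ 1#
  Q-period zero    = ⇑ Q-0
  Q-period (suc c) = combine~ (1# ⊙~ ⇑ (Q-+ N (c ℕ.* N)) ⊕~ Q (c ℕ.* N) ⊙~ Q-N ⊕~ 1# ⊙~ Q-period c)
    (solve 3
      (λ v x y →
        v :+ (con (+ 1) :* (x :* y) :+ y :* con (+ 1) :+ con (+ 1) :* con (+ 1))
        := con (+ 1) :+ (con (+ 1) :* v :+ y :* x :+ con (+ 1) :* y)) ≈-refl _ (Q N) (Q (c ℕ.* N)))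

  Q-shift : ∀ c {m i} → m ≡ c ℕ.* N ℕ.+ i → Q m ~ Q i
  Q-shift c {m} {i} refl = combine~ (1# ⊙~ ⇑ (Q-+ (c ℕ.* N) i) ⊕~ Q i ⊙~ Q-period c)
    (solve 3
      (λ v x y →
        v :+ (con (+ 1) :* (x :* y) :+ y :* con (+ 1))
        := y :+ (con (+ 1) :* v :+ y :* x)) ≈-refl _ (Q (c ℕ.* N)) (Q i))

  ∏E-shift : ∀ c l k → ∏E (c ℕ.* N ℕ.+ l) k ~ ∏E l k
  ∏E-shift c l zero    = ⇑ ≈-refl
  ∏E-shift c l (suc k) = combine~
    (E (c ℕ.* N ℕ.+ l ℕ.+ suc k) ⊙~ ∏E-shift c l k
      ⊕~ - ∏E l k ⊙~ Q-shift c (ℕP.+-assoc (c ℕ.* N) l (suc k)))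
    (solve 4
      (λ p r x y →
        p :* (con (+ 1) :- x) :+ ((con (+ 1) :- x) :* r :+ (:- r) :* y)
        := r :* (con (+ 1) :- y) :+ ((con (+ 1) :- x) :* p :+ (:- r) :* x)) ≈-refl _ _ _ _)

  -- E P ~ - q^P E u when P + u is a multiple of N.
  ∏E-reflect : ∀ k P u c → P ℕ.+ (u ℕ.+ suc k) ≡ c ℕ.* N →
    Q (reflExp u k) * ∏E P k ~ sg k * ∏E u k
  ∏E-reflect zero    P u c _   = ⇑ (*-congʳ Q-0)
  ∏E-reflect (suc k) P u c sum = combine~
    (∏E P (suc k) ⊙~ ⇑ (Q-+ (reflExp u k) (u ℕ.+ suc k))
      ⊕~ Q (reflExp u k) * Q (u ℕ.+ suc k) ⊙~ ⇑ (∏E-front P k)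
      ⊕~ - (Q (reflExp u k) * ∏E (suc P) k) ⊙~ inverse
      ⊕~ (Q (u ℕ.+ suc k) - 1#) ⊙~ ∏E-reflect k (suc P) u c sum′)
    (solve 8
      (λ q r y p x t s U →
        q :* p :+ (p :* (r :* y) :+ (r :* y) :* ((con (+ 1) :- x) :* t) :+ (:- (r :* t)) :*
        con (+ 1) :+ (y :- con (+ 1)) :* (s :* U))
        := (:- s) :* (U :* (con (+ 1) :- y)) :+ (p :* q :+ (r :* y) :* p :+ (:- (r :* t)) :*
        (x :* y) :+ (y :- con (+ 1)) :* (r :* t))) ≈-refl
      (Q (reflExp u (suc k))) (Q (reflExp u k)) (Q (u ℕ.+ suc k)) (∏E P (suc k)) (Q (suc P))
      (∏E (suc P) k) (sg k) (∏E u k))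
    where
    sum′ : suc P ℕ.+ (u ℕ.+ suc k) ≡ c ℕ.* N
    sum′ = ≡.trans (≡.sym (ℕP.+-suc P (u ℕ.+ suc k)))
             (≡.trans (cong (P ℕ.+_) (≡.sym (ℕP.+-suc u (suc k)))) sum)
    inverse : Q (suc P) * Q (u ℕ.+ suc k) ~ 1#
    inverse = combine~ (- 1# ⊙~ ⇑ (Q-+ (suc P) (u ℕ.+ suc k)) ⊕~ 1# ⊙~ Q-shift c {i =
      0} (≡.trans sum′ (≡.sym (ℕP.+-identityʳ _))) ⊕~ 1# ⊙~ ⇑ Q-0)
      (solve 4
        (λ x y v o →
          x :* y :+ ((:- con (+ 1)) :* (x :* y) :+ con (+ 1) :* o :+ con (+ 1) :* con (+ 1))
          := con (+ 1) :+ ((:- con (+ 1)) :* v :+ con (+ 1) :* v :+ con (+ 1) :* o)) ≈-refl _ _ _ _)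

  -- The cofactor is 1 + q^N + ⋯ + q^((c-1)N). Recording the exact factorisation and the residue of
  -- the cofactor separately encodes a congruence modulo (1 - q^N)^2.
  E-multiple : ∀ c → ∃[ d ] E (c ℕ.* N) ≈ d * E N × d ~ fromℕ c
  E-multiple zero    = 0# , combine (- 1# ⊙ Q-0)
    (solve 2
      (λ x e →
        con (+ 1) :- x :+ ((:- con (+ 1)) :* con (+ 1))
        := con (+ 0) :* e :+ ((:- con (+ 1)) :* x)) ≈-refl (Q 0) (E N)) , ⇑ ≈-refl
  E-multiple (suc c) with E-multiple c
  ... | d , E≈ , d~ = 1# + Q N * d
    , combine (- 1# ⊙ Q-+ N (c ℕ.* N) ⊕ Q N ⊙ E≈)
        (solve 4
          (λ v x y d →
            con (+ 1) :- v :+ ((:- con (+ 1)) :* (x :* y) :+ x :* (d :* (con (+ 1) :- x)))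
            := (con (+ 1) :+ x :* d) :* (con (+ 1) :- x) :+ ((:- con (+ 1)) :* v :+ x :* (con (+
            1) :- y))) ≈-refl
          _ (Q N) (Q (c ℕ.* N)) d)
    , combine~ (d ⊙~ Q-N ⊕~ 1# ⊙~ d~)
        (solve 3
          (λ x y d →
            con (+ 1) :+ x :* d :+ (d :* con (+ 1) :+ con (+ 1) :* y)
            := con (+ 1) :+ y :+ (d :* x :+ con (+ 1) :* d)) ≈-refl (Q N) (fromℕ c) d)

  module _ (n : ℕ) where

    -- Summand j = k + 1 of A_(n+2) is paired with summand j - 1 = k of A_n; both are multiples of
    -- the same product `∏E l k` up to (q;q) denominators, with l = n - 2k.
    θ-term ϑ-term : ℕ → Carrier
    θ-term k = α (suc (suc n)) (suc k) - Q (suc n) * α n k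
    ϑ-term k = Q 1 * α (suc (suc n)) (suc k) - α n k

    -- Put y = q^(k+1) and v = q^(l+k+1), so that q^(n+2) = v y. After clearing (q;q)_(k+1) and
    -- taking out common factors there remains 2 y (1 - v) + (1 + v y) (1 - y), which factors as (1
    -- + y) (1 - v y).
    θϑ-term : ∀ k l → n ≡ k ℕ.+ k ℕ.+ l → (Q 1 * θ-term k + ϑ-term k) * ∏E 0 (suc k)
      ≈ sg (suc k) * E (suc (suc n)) * (Q 1 * Q (tri (suc k)) + Q (tri k)) * ∏E l k
    θϑ-term k l n≡ = combine
      (- ((1# + 1#) * Q 1 * sg k * Q (tri k ℕ.+ k)) ⊙ W-suc
        ⊕ - ((1# - Q (suc k)) * (Q 1 * Q (suc n) * sg k * Q (tri k) + sg k * Q (tri k))) ⊙ W-k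
        ⊕ Q 1 * sg k * ∏E l k * (1# - Q (suc (suc n)) - (1# + 1#) * (1# - Q (l ℕ.+ suc k))) ⊙ Q-+
          (tri k) k
        ⊕ - (Q (tri k) * sg k * ∏E l k * (1# - Q (suc (suc n)) - (1# + 1#) *
          (1# - Q (l ℕ.+ suc k)))) ⊙ Q-+ 1 k
        ⊕ (1# - Q (suc k)) * sg k * Q (tri k) * ∏E l k ⊙ Q-+ 1 (suc n)
        ⊕ - ((1# + 1#) * sg k * Q (tri k) * ∏E l k) ⊙ Q-≡ (l ℕ.+ suc k) (suc k) n+2≡)
      (solve 13
        (λ s T P x y z F V W r v N₁ N₂ →
          (z :* ((:- s) :* P :* V :- N₁ :* (s :* T :* W)) :+ (z :* ((:- s) :* P :* V) :- s :*
          T :* W)) :* (F :* (con (+ 1) :- y)) :+ ((:- ((con (+ 1) :+ con (+ 1)) :* z :* s :*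
          P)) :* (r :* (con (+ 1) :- v)) :+ (:- ((con (+ 1) :- y) :* (z :* N₁ :* s :* T :+ s
          :* T))) :* r :+ (z :* s :* r :* (con (+ 1) :- N₂ :- (con (+ 1) :+ con (+ 1)) :* (con
          (+ 1) :- v))) :* (T :* x) :+ (:- (T :* s :* r :* (con (+ 1) :- N₂ :- (con (+ 1) :+
          con (+ 1)) :* (con (+ 1) :- v)))) :* (z :* x) :+ ((con (+ 1) :- y) :* s :* T :* r)
          :* (z :* N₁) :+ (:- ((con (+ 1) :+ con (+ 1)) :* s :* T :* r)) :* (v :* y))
          := (:- s) :* (con (+ 1) :- N₂) :* (z :* P :+ T) :* r :+ ((:- ((con (+ 1) :+ con (+
          1)) :* z :* s :* P)) :* (V :* (F :* (con (+ 1) :- y))) :+ (:- ((con (+ 1) :- y) :*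
          (z :* N₁ :* s :* T :+ s :* T))) :* (W :* F) :+ (z :* s :* r :* (con (+ 1) :- N₂ :-
          (con (+ 1) :+ con (+ 1)) :* (con (+ 1) :- v))) :* P :+ (:- (T :* s :* r :* (con (+
          1) :- N₂ :- (con (+ 1) :+ con (+ 1)) :* (con (+ 1) :- v)))) :* y :+ ((con (+ 1) :-
          y) :* s :* T :* r) :* N₂ :+ (:- ((con (+ 1) :+ con (+ 1)) :* s :* T :* r)) :* N₂))
          ≈-refl
        (sg k) (Q (tri k)) (Q (tri k ℕ.+ k)) (Q k) (Q (suc k)) (Q 1) (∏E 0 k)
        (W (suc k) (suc (suc n))) (W k n) (∏E l k) (Q (l ℕ.+ suc k)) (Q (suc n)) (Q (suc (suc n))))
      where
      W-k : W k n * ∏E 0 k ≈ ∏E l k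
      W-k = ≈-trans (*-congʳ (≈-trans (reflexive (cong (W k) n≡)) (W≈gauss k l))) (gauss-∏E k l)
      W-suc : W (suc k) (suc (suc n)) * ∏E 0 (suc k) ≈ ∏E l (suc k)
      W-suc = ≈-trans (*-congʳ (≈-trans (reflexive
        (cong (W (suc k)) (≡.trans (cong (λ i → suc (suc i)) n≡)
          (cong (λ i → suc (i ℕ.+ l)) (≡.sym (ℕP.+-suc k k)))))) (W≈gauss (suc k) l)))
            (gauss-∏E (suc k) l)
      n+2≡ : suc (suc n) ≡ l ℕ.+ suc k ℕ.+ suc k
      n+2≡ = ≡.trans (cong (λ i → suc (suc i)) n≡) (lemma k l)
        where
        lemma : ∀ k l → suc (suc (k ℕ.+ k ℕ.+ l)) ≡ l ℕ.+ suc k ℕ.+ suc k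
        lemma = ℕ-Solver.solve-∀

    -- What remains of the j-th summands of both sides, j = k + 1, after division by 1 - q^N.
    summand~ : ∀ k l b c K → N ≡ suc (suc n) → n ≡ k ℕ.+ k ℕ.+ l → K ℕ.+ suc k ≡ c ℕ.* N →
      let j = suc k ; B = b ℕ.* N in
      Q 1 * Q (tri j) * ∏E K k * ∏E (B ℕ.+ B ℕ.+ j) j
      ~ Q (B ℕ.* j) * Q (tri j ℕ.+ j) * (Q 1 * Q (tri j) + Q (tri k)) * ∏E l k * ∏E B j * Q (tri j)
    summand~ k l b c K N≡ n≡ K+j≡ = combine~
      (z * T * ∏E K k ⊙~ ≡~ ⊕~ z * ∏E j k * (1# - yy) ⊙~ reflK
        ⊕~ - (z * sg k * F * ∏E j k) ⊙~ ⇑ (Q-+ j j)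
        ⊕~ - (P₂ * (z * T + Tk) * r * ∏E B j * T) ⊙~ QB~
        ⊕~ - (P₂ * (z * T + Tk) * r * T) ⊙~ B~
        ⊕~ - ((z * T + Tk) * r * F * (1# - y) * T) ⊙~ ⇑ (Q-+ (tri j) j)
        ⊕~ - (T * T * r * F * (1# - y) * Tk) ⊙~ ⇑ (Q-+ 1 k)
        ⊕~ T * T * r * F * (1# - y) * z ⊙~ ⇑ (Q-+ (tri k) k)
        ⊕~ z * r * F * (1# - y) * (1# + y) ⊙~ ⇑ Q₃
        ⊕~ - (z * F * (1# - y) * (1# + y)) ⊙~ reflL)
      (solve 16
        (λ z T A D Qb P₂ Tk x y r G F J s yy q₃ →
          z :* T :* A :* D :+ ((z :* T :* A) :* (J :* (con (+ 1) :- yy)) :+ (z :* J :* (con (+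
          1) :- yy)) :* (s :* F) :+ (:- (z :* s :* F :* J)) :* (y :* y) :+ (:- (P₂ :* (z :* T
          :+ Tk) :* r :* G :* T)) :* con (+ 1) :+ (:- (P₂ :* (z :* T :+ Tk) :* r :* T)) :* (F
          :* (con (+ 1) :- y)) :+ (:- ((z :* T :+ Tk) :* r :* F :* (con (+ 1) :- y) :* T)) :*
          (T :* y) :+ (:- (T :* T :* r :* F :* (con (+ 1) :- y) :* Tk)) :* (z :* x) :+ (T :* T
          :* r :* F :* (con (+ 1) :- y) :* z) :* (Tk :* x) :+ (z :* r :* F :* (con (+ 1) :- y)
          :* (con (+ 1) :+ y)) :* (T :* (T :* T)) :+ (:- (z :* F :* (con (+ 1) :- y) :* (con
          (+ 1) :+ y))) :* (s :* J))
          := Qb :* P₂ :* (z :* T :+ Tk) :* r :* G :* T :+ ((z :* T :* A) :* D :+ (z :* J :*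
          (con (+ 1) :- yy)) :* (T :* A) :+ (:- (z :* s :* F :* J)) :* yy :+ (:- (P₂ :* (z :*
          T :+ Tk) :* r :* G :* T)) :* Qb :+ (:- (P₂ :* (z :* T :+ Tk) :* r :* T)) :* G :+ (:-
          ((z :* T :+ Tk) :* r :* F :* (con (+ 1) :- y) :* T)) :* P₂ :+ (:- (T :* T :* r :* F
          :* (con (+ 1) :- y) :* Tk)) :* y :+ (T :* T :* r :* F :* (con (+ 1) :- y) :* z) :* T
          :+ (z :* r :* F :* (con (+ 1) :- y) :* (con (+ 1) :+ y)) :* q₃ :+ (:- (z :* F :*
          (con (+ 1) :- y) :* (con (+ 1) :+ y))) :* (q₃ :* r))) ≈-refl
        z T (∏E K k) (∏E (B ℕ.+ B ℕ.+ j) j) (Q (B ℕ.* j)) P₂ Tk (Q k) y r (∏E B j) F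
        (∏E j k) (sg k) yy (Q (reflExp j k)))
      where
      j = suc k
      B = b ℕ.* N
      z = Q 1
      T = Q (tri j)
      Tk = Q (tri k)
      y = Q j
      yy = Q (j ℕ.+ j)
      P₂ = Q (tri j ℕ.+ j)
      r = ∏E l k
      F = ∏E 0 k
      ≡~ : ∏E (B ℕ.+ B ℕ.+ j) j ~ ∏E j k * (1# - yy)
      ≡~ = subst (λ i → ∏E (i ℕ.+ j) j ~ ∏E j j) (ℕP.*-distribʳ-+ N b b) (∏E-shift (b ℕ.+ b) j j)
      B~ : ∏E B j ~ F * (1# - y)
      B~ = subst (λ i → ∏E i j ~ ∏E 0 j) (ℕP.+-identityʳ B) (∏E-shift b 0 j)
      QB~ : Q (B ℕ.* j) ~ 1#
      QB~ = subst (λ i → Q i ~ 1#) (lemma b j N) (Q-period (b ℕ.* j))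
        where
        lemma : ∀ b j N → b ℕ.* j ℕ.* N ≡ b ℕ.* N ℕ.* j
        lemma = ℕ-Solver.solve-∀
      -- K + j is a multiple of N, so the factors from K + 1 to K + k reflect to (q;q)_k at the
      -- price q^C(j,2).
      reflK : T * ∏E K k ~ sg k * F
      reflK = subst (λ i → Q i * ∏E K k ~ sg k * F) (reflExp≡ 0 k) (∏E-reflect k K 0 c K+j≡)
      -- Here l + 2 j = N. After this reflection both sides of the congruence have become (-1)^k q
      -- (1 - q^(2j)) times `∏E 0 k * ∏E j k`.
      reflL : Q (reflExp j k) * r ~ sg k * ∏E j k
      reflL = ∏E-reflect k l j 1 (≡.trans (lemma k l)
        (≡.trans (cong (λ i → suc (suc i)) (≡.sym n≡))
          (≡.trans (≡.sym N≡) (≡.sym (ℕP.*-identityˡ N)))))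
        where
        lemma : ∀ k l → l ℕ.+ (suc k ℕ.+ suc k) ≡ suc (suc (k ℕ.+ k ℕ.+ l))
        lemma = ℕ-Solver.solve-∀
      Q₃ : Q (reflExp j k) ≈ T * (T * T)
      Q₃ = ≈-trans (Q-≡ (tri j) (tri j ℕ.+ tri j) (reflExp-suc k)) (*-congˡ (Q-+ (tri j) (tri j)))

tri≤* : ∀ k m → k ≤ m → tri k ≤ m ℕ.* k
tri≤* zero    m k≤m = z≤n
tri≤* (suc k) m k≤m = subst (tri (suc k) ≤_) (≡.trans (ℕP.+-comm _ m) (≡.sym (ℕP.*-suc m k)))
  (ℕP.+-mono-≤ (tri≤* k m (ℕP.<⇒≤ k≤m)) (ℕP.<⇒≤ k≤m))

tauExp-tri : ∀ B C K → K ≤ C → tauExp B C K ℕ.+ tri K ≡ (B ℕ.+ C) ℕ.* K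
tauExp-tri B C K K≤C = ℕP.m∸n+n≡m (tri≤* K (B ℕ.+ C) (ℕP.≤-trans K≤C (ℕP.m≤n+m C B)))

-- Comparison of the two sides modulo (1 - q^N)^2, where N = n + 2.

module TauSum (R : CommutativeRing 0ℓ 0ℓ)
  (ι : CommutativeRing.rawRing ℤP.+-*-commutativeRing
       -Raw-AlmostCommutative⟶ fromCommutativeRing R)
  (Q : ℕ → CommutativeRing.Carrier R)
  (Q-0 : CommutativeRing._≈_ R (Q 0) (CommutativeRing.1# R))
  (Q-+ : ∀ i j → CommutativeRing._≈_ R (Q (i ℕ.+ j)) (CommutativeRing._*_ R (Q i) (Q j)))
  (n b c : ℕ) where

  open QSeries R ι Q Q-0 Q-+ public
  open Congruence R ι Q Q-0 Q-+ (suc (suc n)) public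
  open ≈-Reasoning

  private
    N = suc (suc n)
    B = b ℕ.* N
    C = c ℕ.* N
    expo = tauExp B C
    τ-term = τ-summand B C
    leading = τ-leading B C

  sg-+ : ∀ i j → sg (i ℕ.+ j) ≈ sg i * sg j
  sg-+ zero    j = ≈-sym (*-identityˡ _)
  sg-+ (suc i) j = ≈-trans (-‿cong (sg-+ i j)) (-‿distribˡ-* _ _)

  sg-cancel : ∀ i j → sg (i ℕ.+ j) * sg j ≈ sg i
  sg-cancel i j = combine (sg j ⊙ sg-+ i j ⊕ sg i ⊙ square j)
    (solve 3
      (λ v x y →
        v :* y :+ (y :* (x :* y) :+ x :* con (+ 1))
        := x :+ (y :* v :+ x :* (y :* y))) ≈-refl _ (sg i) (sg j))
     where
    square : ∀ j → sg j * sg j ≈ 1#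
    square zero    = *-identityˡ 1#
    square (suc j) = ≈-trans (solve 1
      (λ x →
        (:- x) :* (:- x) := x :* x) ≈-refl (sg j)) (square j)

  -- `∏E B j` is required by `gauss-shift`, `∏E 0 j` by [2an - 2k; j] and by `θϑ-term`, and the
  -- power of q by the reflection of `∏E K k`.
  clearing : ℕ → Carrier
  clearing j = ∏E B j * ∏E 0 j * Q (tri j)

  -- Both products carry one visible factor 1 - q^N: 1 - q^C = d (1 - q^N) on the left, the factor
  -- from `θϑ-term` on the right. The remaining cofactors are d Y₁ and c Y₂ up to the common `p`,
  -- and d ~ c with Y₁ ~ Y₂ supplies the second factor.
  summand : ∀ k l K → n ≡ k ℕ.+ k ℕ.+ l → K ℕ.+ suc k ≡ C →
    ∃[ w ] clearing (suc k) * (Q 1 * τ-term K (suc k)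
                               - leading * fromℕ c * (Q 1 * θ-term n k + ϑ-term n k))
           ≈ w * (E N * E N)
  summand k l K n≡ K+j≡C = step (E-multiple c) (summand~ n k l b c K refl n≡ K+j≡C)
    where
    j = suc k
    z = Q 1
    sK = sg K
    qe = Q (expo K)
    q₀ = Q (expo C)
    T = Q (tri j)
    F = ∏E 0 j
    G = ∏E B j
    G₀ = gauss C B
    A = ∏E K k
    D = ∏E (B ℕ.+ B ℕ.+ j) j
    M = fromℕ c
    S = Q 1 * Q (tri j) + Q (tri k)
    r = ∏E l k
    gj = gauss j (B ℕ.+ B ℕ.+ j)
    Y₂ = Q (B ℕ.* j) * Q (tri j ℕ.+ j) * S * r * G * T
    p = sK * qe * G₀
    Y₁ = z * T * A * D
    gauss-K : gauss K (B ℕ.+ j) * G ≈ G₀ * (A * E C)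
    gauss-K = subst (λ i → gauss K (B ℕ.+ j) * G ≈ gauss i B * (A * E i)) K+j≡C (gauss-shift j K B)
    sg-C : sg C * sg j ≈ sK
    sg-C = subst (λ i → sg i * sg j ≈ sK) K+j≡C (sg-cancel K j)
    Q-e₀ : q₀ ≈ qe * (Q (B ℕ.* j) * Q (tri j ℕ.+ j))
    Q-e₀ = ≈-trans (Q-≡ (expo K) _ e₀≡) (*-congˡ (Q-+ (B ℕ.* j) (tri j ℕ.+ j)))
      where
      K≤C : K ≤ C
      K≤C = subst (K ≤_) K+j≡C (ℕP.m≤m+n K j)
      e₀≡ : expo C ≡ expo K ℕ.+ (B ℕ.* j ℕ.+ tri (suc j))
      e₀≡ = exponent-shift B K j (expo C) (expo K)
        (subst (λ i → expo C ℕ.+ tri i ≡ (B ℕ.+ i) ℕ.* i) (≡.sym K+j≡C)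
          (tauExp-tri B C C ℕP.≤-refl))
        (subst (λ i → expo K ℕ.+ tri K ≡ (B ℕ.+ i) ℕ.* K) (≡.sym K+j≡C) (tauExp-tri B C K K≤C))
    left : clearing j * (Q 1 * τ-term K j) ≈ E C * p * Y₁
    left = begin
      G * F * T * (z * (sK * qe * gauss K (B ℕ.+ j) * gj))
        ≈⟨ solve 8
          (λ G F T z s q g h →
            G :* F :* T :* (z :* (s :* q :* g :* h))
            := z :* T :* (s :* q) :* (g :* G) :* (h :* F)) ≈-refl
             G F T z sK qe _ gj ⟩
      z * T * (sK * qe) * (gauss K (B ℕ.+ j) * G) * (gj * F)
        ≈⟨ *-cong (*-congˡ gauss-K) (gauss-∏E j (B ℕ.+ B ℕ.+ j)) ⟩
      z * T * (sK * qe) * (G₀ * (A * E C)) * D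
        ≈⟨ solve 8
          (λ G A T z s q e D →
            z :* T :* (s :* q) :* (G :* (A :* e)) :* D
            := e :* (s :* q :* G) :* (z :* T :* A :* D)) ≈-refl
             G₀ A T z sK qe (E C) D ⟩
      E C * p * Y₁ ∎
    right : clearing j * (leading * M * (Q 1 * θ-term n k + ϑ-term n k)) ≈ M * E N * p * Y₂
    right = begin
      G * F * T * (sg C * q₀ * G₀ * M * (Q 1 * θ-term n k + ϑ-term n k))
        ≈⟨ solve 8
          (λ G F T s q g M t →
            G :* F :* T :* (s :* q :* g :* M :* t)
            := G :* T :* (g :* M) :* s :* q :* (t :* F)) ≈-refl
             G F T (sg C) q₀ G₀ M _ ⟩
      G * T * (G₀ * M) * sg C * q₀ * ((Q 1 * θ-term n k + ϑ-term n k) * F)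
        ≈⟨ *-cong (*-congˡ Q-e₀) (θϑ-term n k l n≡) ⟩
      G * T * (G₀ * M) * sg C * (qe * Qs) * (sg j * E N * S * r)
        ≈⟨ solve 8
          (λ x s q u v e S r →
            x :* s :* (q :* u) :* (v :* e :* S :* r)
            := (s :* v) :* (x :* (q :* u) :* e :* (S :* r))) ≈-refl
             (G * T * (G₀ * M)) (sg C) qe Qs (sg j) (E N) S r ⟩
      (sg C * sg j) * (G * T * (G₀ * M) * (qe * Qs) * E N * (S * r))
        ≈⟨ *-congʳ sg-C ⟩
      sK * (G * T * (G₀ * M) * (qe * Qs) * E N * (S * r))
        ≈⟨ solve 10
          (λ s G T g M q Q e S r →
            s :* (G :* T :* (g :* M) :* (q :* Q) :* e :* (S :* r))
            := M :* e :* (s :* q :* g) :* (Q :* S :* r :* G :* T)) ≈-refl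
             sK G T G₀ M qe Qs (E N) S r ⟩
      M * E N * p * Y₂ ∎
      where Qs = Q (B ℕ.* j) * Q (tri j ℕ.+ j)
    step : ∃[ d ] E C ≈ d * E N × d ~ M → Y₁ ~ Y₂ →
      ∃[ w ] clearing j * (Q 1 * τ-term K j - leading * M * (Q 1 * θ-term n k + ϑ-term n k))
             ≈ w * (E N * E N)
    step (d , EC≈ , w₁ , d≈) (w₂ , Y≈) = _ , combine
      (1# ⊙ left ⊕ - 1# ⊙ right ⊕ p * Y₁ ⊙ EC≈ ⊕ p * E N * d ⊙ Y≈ ⊕ p * E N * Y₂ ⊙ d≈)
      (solve 12
        (λ u x v p Y₁ Y d w₁ w₂ M e ec →
          u :* (x :- v) :+ (con (+ 1) :* (ec :* p :* Y₁) :+ (:- con (+ 1)) :* (M :* e :* p :*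
          Y) :+ (p :* Y₁) :* (d :* e) :+ (p :* e :* d) :* (Y :+ w₂ :* e) :+ (p :* e :* Y) :*
          (M :+ w₁ :* e))
          := p :* (w₁ :* Y :+ d :* w₂) :* (e :* e) :+ (con (+ 1) :* (u :* x) :+ (:- con (+ 1))
          :* (u :* v) :+ (p :* Y₁) :* ec :+ (p :* e :* d) :* Y₁ :+ (p :* e :* Y) :* d)) ≈-refl
        (clearing j) _ _ p Y₁ Y₂ d w₁ w₂ M (E N) (E C))

  θ-poly qϑ-poly : Carrier
  θ-poly  = pent (suc (suc n)) - Q (suc n) * pent n
  qϑ-poly = Q 1 * pent (suc (suc n)) - pent n

  -- The term 2 q is the summand j = 0 of A_N, counted once in q θ and once in q ϑ. It cancels the 2
  -- in the braces, so that q (2 - θ - ϑ) is minus the sum over j > 0.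
  θϑ-sum : ∀ h → n < h ℕ.+ h →
    Q 1 * θ-poly + qϑ-poly ≈ (1# + 1#) * Q 1 + ∑ h (λ k → Q 1 * θ-term n k + ϑ-term n k)
  θϑ-sum h n<2h = combine
    (- ((1# + 1#) * Q 1) ⊙ ∑α≈pent (suc h) N (s≤s
      (subst (suc n <_) (≡.sym (ℕP.+-suc h h)) (s≤s n<2h)))
      ⊕ (Q 1 * Q (suc n) + 1#) ⊙ ∑α≈pent h n n<2h
      ⊕ (1# + 1#) * Q 1 ⊙ ∑-front h (α N)
      ⊕ (1# + 1#) * Q 1 ⊙ Q-0
      ⊕ 1# ⊙ ∑-split h)
    (solve 9
      (λ z N₁ p₂ p a₂ a f o t →
        z :* (p₂ :- N₁ :* p) :+ (z :* p₂ :- p) :+ ((:- ((con (+ 1) :+ con (+ 1)) :* z)) :*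
        p₂ :+ (z :* N₁ :+ con (+ 1)) :* p :+ ((con (+ 1) :+ con (+ 1)) :* z) :* (con (+ 1)
        :* o :* con (+ 1) :+ f) :+ ((con (+ 1) :+ con (+ 1)) :* z) :* con (+ 1) :+ con (+ 1)
        :* t)
        := (con (+ 1) :+ con (+ 1)) :* z :+ t :+ ((:- ((con (+ 1) :+ con (+ 1)) :* z)) :* a₂
        :+ (z :* N₁ :+ con (+ 1)) :* a :+ ((con (+ 1) :+ con (+ 1)) :* z) :* a₂ :+ ((con (+
        1) :+ con (+ 1)) :* z) :* o :+ con (+ 1) :* ((con (+ 1) :+ con (+ 1)) :* z :* f :-
        (z :* N₁ :+ con (+ 1)) :* a))) ≈-refl
      (Q 1) (Q (suc n)) (pent N) (pent n) (∑ (suc h) (α N)) (∑ h (α n)) _ (Q 0) _)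
    where
    ∑-split : ∀ h → (1# + 1#) * Q 1 * ∑ h (λ k → α N (suc k)) - (Q 1 * Q (suc n) + 1#) * ∑ h (α n)
              ≈ ∑ h (λ k → Q 1 * θ-term n k + ϑ-term n k)
    ∑-split zero    = solve 2
      (λ z N₁ →
        (con (+ 1) :+ con (+ 1)) :* z :* con (+ 0) :- (z :* N₁ :+ con (+ 1)) :* con (+ 0)
        := con (+ 0)) ≈-refl (Q 1) (Q (suc n))
    ∑-split (suc h) = combine (1# ⊙ ∑-split h)
      (solve 7
        (λ z N₁ f g a b t →
          (con (+ 1) :+ con (+ 1)) :* z :* (f :+ a) :- (z :* N₁ :+ con (+ 1)) :* (g :+ b) :+
          (con (+ 1) :* t)
          := t :+ (z :* (a :- N₁ :* b) :+ (z :* a :- b)) :+ (con (+ 1) :* ((con (+ 1) :+ con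
          (+ 1)) :* z :* f :- (z :* N₁ :+ con (+ 1)) :* g))) ≈-refl
        (Q 1) (Q (suc n)) _ _ (α N (suc h)) (α n h) _)

  -- `P` will be comaximality with the cyclotomic factor. The common clearing factor is the product
  -- of the individual ones, so closure under products keeps it admissible.
  ∑-clear : (P : Carrier → Set) → P 1# → (∀ {x y} → P x → P y → P (x * y)) →
    ∀ m h (f : ℕ → Carrier) →
    (∀ k → k < h → ∃[ u ] P u × ∃[ w ] u * f k ≈ w * m) →
    ∃[ u ] P u × ∃[ w ] u * ∑ h f ≈ w * m
  ∑-clear P P-1 P-* m zero    f s = 1# , P-1 , 0# , solve 1
    (λ m →
      con (+ 1) :* con (+ 0) := con (+ 0) :* m) ≈-refl m
  ∑-clear P P-1 P-* m (suc h) f s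
    with ∑-clear P P-1 P-* m h f (λ k k<h → s k (ℕP.m<n⇒m<1+n k<h)) | s h (ℕP.n<1+n h)
  ... | u , Pu , w , u≈ | v , Pv , x , v≈ = u * v , P-* Pu Pv , v * w + u * x
    , combine (v ⊙ u≈ ⊕ u ⊙ v≈)
      (solve 7
        (λ u v w x s t m →
          u :* v :* (s :+ t) :+ (v :* (w :* m) :+ u :* (x :* m))
          := (v :* w :+ u :* x) :* m :+ (v :* (u :* s) :+ u :* (v :* t))) ≈-refl u v w x _ _ m)

  clear : 0 < c → ∀ k → suc k ℕ.+ suc k ≤ N → ∃[ w ]
    clearing (suc k) * (Q 1 * τ-term (C ℕ.∸ suc k) (suc k)
                        - leading * fromℕ c * (Q 1 * θ-term n k + ϑ-term n k)) ≈ w * (E N * E N)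
  clear 0<c k 2j≤N = summand k (n ℕ.∸ (k ℕ.+ k)) (C ℕ.∸ suc k) (≡.sym (ℕP.m+[n∸m]≡n 2k≤n))
    (ℕP.m∸n+n≡m j≤C)
    where
    j≤C : suc k ≤ C
    j≤C = ℕP.≤-trans (ℕP.≤-trans (ℕP.m≤m+n (suc k) (suc k)) 2j≤N) (ℕP.m≤n*m N c ⦃ ℕ.>-nonZero 0<c ⦄)
    2k≤n : k ℕ.+ k ≤ n
    2k≤n = ℕP.≤-pred (ℕP.≤-pred (subst (_≤ N) (cong suc (ℕP.+-suc k k)) 2j≤N))

  -- The summand j = 0 cancels against `leading * Q 1`, and `θϑ-sum` distributes the rest over j >
  -- 0, where `clear` applies. The bounds on `h` say that it is the integer part of N/2.
  τ-sum : (P : Carrier → Set) → P 1# → (∀ {x y} → P x → P y → P (x * y)) →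
    (∀ k → suc k ℕ.+ suc k ≤ N → P (clearing (suc k))) →
    0 < c → ∀ h → h ℕ.+ h ≤ N → n < h ℕ.+ h →
    ∃[ u ] P u × ∃[ w ]
      u * (Q 1 * ∑ (suc h) (λ j → τ-term (C ℕ.∸ j) j)
           - leading * (Q 1 - fromℕ c * ((1# + 1#) * Q 1 - Q 1 * θ-poly - qϑ-poly)))
      ≈ w * (E N * E N)
  τ-sum P P-1 P-* P-c 0<c h 2h≤N n<2h =
    map₂ (map₂ (map₂ (≈-trans (*-congˡ total)))) (∑-clear P P-1 P-* (E N * E N) h
      (λ k → Q 1 * τ-term (C ℕ.∸ suc k) (suc k)
             - leading * fromℕ c * (Q 1 * θ-term n k + ϑ-term n k))
      (λ k k<h → let 2j≤N = ℕP.≤-trans (ℕP.+-mono-≤ k<h k<h) 2h≤N in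
        clearing (suc k) , P-c k 2j≤N , clear 0<c k 2j≤N))
    where
    total : Q 1 * ∑ (suc h) (λ j → τ-term (C ℕ.∸ j) j)
              - leading * (Q 1 - fromℕ c * ((1# + 1#) * Q 1 - Q 1 * θ-poly - qϑ-poly))
            ≈ ∑ h (λ k → Q 1 * τ-term (C ℕ.∸ suc k) (suc k)
                         - leading * fromℕ c * (Q 1 * θ-term n k + ϑ-term n k))
    total = combine
      (Q 1 ⊙ ∑-front h _ ⊕ leading * fromℕ c ⊙ ≈-sym (θϑ-sum h n<2h) ⊕ Q 1 ⊙ τ-summand-0 B C
        ⊕ 1# ⊙ ∑-split h)
      (solve 10
        (λ z f a t x s d M L r →
          z :* f :- L :* (z :- M :* ((con (+ 1) :+ con (+ 1)) :* z :- z :* x :- d)) :+ (z :*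
          (a :+ t) :+ (L :* M) :* (z :* x :+ d) :+ z :* L :+ con (+ 1) :* r)
          := r :+ (z :* f :+ (L :* M) :* ((con (+ 1) :+ con (+ 1)) :* z :+ s) :+ z :* a :+ con
          (+ 1) :* (z :* t :- L :* M :* s))) ≈-refl
        (Q 1) _ _ _ θ-poly _ qϑ-poly (fromℕ c) leading _)
      where
      ∑-split : ∀ h → Q 1 * ∑ h (λ k → τ-term (C ℕ.∸ suc k) (suc k)) - leading * fromℕ c * ∑ h
        (λ k → Q 1 * θ-term n k + ϑ-term n k) ≈ ∑ h
          (λ k → Q 1 * τ-term (C ℕ.∸ suc k) (suc k) - leading * fromℕ c *
            (Q 1 * θ-term n k + ϑ-term n k))
      ∑-split zero    = solve 2
        (λ z x →
          z :* con (+ 0) :- x :* con (+ 0) := con (+ 0)) ≈-refl (Q 1) (leading * fromℕ c)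
      ∑-split (suc h) = combine (1# ⊙ ∑-split h)
        (solve 7
          (λ z x s t f g r →
            z :* (s :+ f) :- x :* (t :+ g) :+ (con (+ 1) :* r)
            := r :+ (z :* f :- x :* g) :+ (con (+ 1) :* (z :* s :- x :* t))) ≈-refl
          (Q 1) (leading * fromℕ c) _ _ _ _ _)

-- Comaximality up to a non-zero integer.

module Comaximality (R : CommutativeRing 0ℓ 0ℓ)
  (ι : CommutativeRing.rawRing ℤP.+-*-commutativeRing
       -Raw-AlmostCommutative⟶ fromCommutativeRing R) where

  open RingTools R ι

  -- Comaximality over ℚ: the ideal (x, y) contains a non-zero integer.
  Comax : Carrier → Carrier → Set
  Comax x y = ∃[ u ] ∃[ v ] ∃[ c ] (¬ c ≡ + 0) × u * x + v * y ≈ ⟦ c ⟧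

  comax-sym : ∀ {x y} → Comax x y → Comax y x
  comax-sym (u , v , c , c≢0 , e) = v , u , c , c≢0 , ≈-trans (+-comm _ _) e

  comax-1 : ∀ {x} → Comax x 1#
  comax-1 {x} = 0# , 1# , + 1 , (λ ()) , ≈-trans (solve 1
    (λ x →
      con (+ 0) :* x :+ con (+ 1) :* con (+ 1) := con (+ 1)) ≈-refl x) (≈-sym 1-homo)

  *-≢0 : ∀ {c d} → ¬ c ≡ + 0 → ¬ d ≡ + 0 → ¬ c ℤ.* d ≡ + 0
  *-≢0 {c} c≢0 d≢0 cd≡0 with ℤP.i*j≡0⇒i≡0∨j≡0 c cd≡0
  ... | inj₁ c≡0 = c≢0 c≡0
  ... | inj₂ d≡0 = d≢0 d≡0

  comax-* : ∀ {x y z} → Comax x y → Comax x z → Comax x (y * z)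
  comax-* {x} {y} {z} (u , v , c , c≢0 , e) (u′ , v′ , c′ , c′≢0 , e′) =
    -- Multiply v y = c - u x by v′ z = c′ - u′ x and collect the multiples of x.
    ⟦ c ⟧ * u′ + u * ⟦ c′ ⟧ - u * u′ * x , v * v′ , c ℤ.* c′ , *-≢0 c≢0 c′≢0
    , ≈-trans (combine (v′ * z ⊙ e ⊕ (⟦ c ⟧ - u * x) ⊙ e′)
        (solve 9
          (λ x y z u v u′ v′ c c′ →
            (c :* u′ :+ u :* c′ :- u :* u′ :* x) :* x :+ v :* v′ :* (y :* z) :+ ((v′ :* z) :* c
            :+ (c :- u :* x) :* c′)
            := c :* c′ :+ ((v′ :* z) :* (u :* x :+ v :* y) :+ (c :- u :* x) :* (u′ :* x :+ v′ :*
            z))) ≈-refl x y z u v u′ v′ ⟦ c ⟧ ⟦ c′ ⟧))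
      (≈-sym (*-homo c c′))

  comax-∏ : ∀ {x} k {f} → (∀ i → i < k → Comax x (f i)) → Comax x (∏ k f)
  comax-∏ zero    e = comax-1
  comax-∏ (suc k) e =
    comax-* (comax-∏ k (λ i i<k → e i (ℕP.m<n⇒m<1+n i<k))) (e k (ℕP.n<1+n k))

  comax-factor : ∀ {x y z} w → y * w ≈ z → Comax x z → Comax x y
  comax-factor {x} {y} {z} w yw≈z (u , v , c , c≢0 , e) = u , v * w , c , c≢0
    , combine (v ⊙ yw≈z ⊕ 1# ⊙ e)
      (solve 7
        (λ x y z u v w c →
          u :* x :+ v :* w :* y :+ (v :* z :+ con (+ 1) :* c)
          := c :+ (v :* (y :* w) :+ con (+ 1) :* (u :* x :+ v :* z))) ≈-refl
        x y z u v w ⟦ c ⟧)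

  -- Multiply u x + v y = c by d m, then replace m by y t in the first term and d m by x s in the
  -- second; both become multiples of x y.
  comax-multiple : ∀ {x y m s t d} → Comax x y → ¬ d ≡ + 0 → x * s ≈ ⟦ d ⟧ * m → y * t ≈ m →
    ∃[ c ] (¬ c ≡ + 0) × ∃[ r ] x * y * r ≈ ⟦ c ⟧ * m
  comax-multiple {x} {y} {m} {s} {t} {d} (u , v , c , c≢0 , e) d≢0 xs yt =
    c ℤ.* d , *-≢0 c≢0 d≢0 , u * ⟦ d ⟧ * t + v * s
    , combine (⟦ d ⟧ * m ⊙ e ⊕ v * y ⊙ xs ⊕ u * x * ⟦ d ⟧ ⊙ yt ⊕ - m ⊙ *-homo c d)
      (solve 10
        (λ x y m s t d u v c cd →
          x :* y :* (u :* d :* t :+ v :* s) :+ ((d :* m) :* c :+ (v :* y) :* (d :* m) :+ (u :*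
          x :* d) :* m :+ (:- m) :* (c :* d))
          := cd :* m :+ ((d :* m) :* (u :* x :+ v :* y) :+ (v :* y) :* (x :* s) :+ (u :* x :*
          d) :* (y :* t) :+ (:- m) :* cd)) ≈-refl x y m s t ⟦ d ⟧ u v ⟦ c ⟧ ⟦ c ℤ.* d ⟧)

-- The very Boolean test of `properDivisors`, so that the products below agree with it by
-- computation.
dvd : ℕ → ℕ → Bool
dvd n i = (n ℕD.% suc i) ℕ.≡ᵇ 0

dvd⇒∣ : ∀ n i → dvd n i ≡ true → suc i ∣ n
dvd⇒∣ n i e = m%n≡0⇒n∣m n (suc i) (≡ᵇ0 (n ℕD.% suc i) e)
  where
  ≡ᵇ0 : ∀ m → (m ℕ.≡ᵇ 0) ≡ true → m ≡ 0
  ≡ᵇ0 zero _ = refl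

∣⇒dvd : ∀ n i → suc i ∣ n → dvd n i ≡ true
∣⇒dvd n i d = cong (ℕ._≡ᵇ 0) (n∣m⇒m%n≡0 n (suc i) d)

-- Factorisation of 1 - q^n and comaximality of its factors.

module Cyclotomic (R : CommutativeRing 0ℓ 0ℓ)
  (ι : CommutativeRing.rawRing ℤP.+-*-commutativeRing
       -Raw-AlmostCommutative⟶ fromCommutativeRing R)
  (Q : ℕ → CommutativeRing.Carrier R)
  (Q-0 : CommutativeRing._≈_ R (Q 0) (CommutativeRing.1# R))
  (Q-+ : ∀ i j → CommutativeRing._≈_ R (Q (i ℕ.+ j)) (CommutativeRing._*_ R (Q i) (Q j)))
  where

  open QSeries R ι Q Q-0 Q-+
  open Comaximality R ι

  E-+ : ∀ i j → E (i ℕ.+ j) ≈ E i + Q i * E j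
  E-+ i j = combine (- 1# ⊙ Q-+ i j)
    (solve 3
      (λ v x y →
        con (+ 1) :- v :+ ((:- con (+ 1)) :* (x :* y))
        := con (+ 1) :- x :+ x :* (con (+ 1) :- y) :+ ((:- con (+ 1)) :* v)) ≈-refl _ (Q i) (Q j))

  E-∣ : ∀ {i n} → i ∣ n → ∃[ r ] E i * r ≈ E n
  E-∣ {i} (divides k refl) with Congruence.E-multiple R ι Q Q-0 Q-+ i k
  ... | d , e , _ = d , ≈-trans (*-comm _ _) (≈-sym e)

  -- A Bézout relation g + y j = x m gives 1 - q^(xm) = (1 - q^g) + q^g (1 - q^(yj)), and 1 - q^m
  -- and 1 - q^j divide the outer terms. The other sign of Bézout is symmetric.
  E-gcd : ∀ m j → ∃[ u ] ∃[ v ] u * E m + v * E j ≈ E (gcd m j)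
  E-gcd m j with Bézout.identity (gcd-GCD m j)
  ... | Bézout.+- x y eq with E-∣ {m} (divides x refl) | E-∣ {j} (divides y refl)
  ...   | r , e | s , f = r , - Q (gcd m j) * s
    , combine (1# ⊙ e ⊕ - Q (gcd m j) ⊙ f
        ⊕ 1# ⊙ ≈-trans (E-≡ (≡.sym eq)) (E-+ (gcd m j) (y ℕ.* j)))
      (solve 8
        (λ M J r s q Mx Jy g →
          r :* M :+ (:- q) :* s :* J :+ (con (+ 1) :* Mx :+ (:- q) :* Jy :+ con (+ 1) :* (g :+
          q :* Jy))
          := g :+ (con (+ 1) :* (M :* r) :+ (:- q) :* (J :* s) :+ con (+ 1) :* Mx)) ≈-refl _ _ r s
            _ _ _ _)
  E-gcd m j | Bézout.-+ x y eq with E-∣ {m} (divides x refl) | E-∣ {j} (divides y refl)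
  ...   | r , e | s , f = - Q (gcd m j) * r , s
    , combine (- Q (gcd m j) ⊙ e ⊕ 1# ⊙ f
        ⊕ 1# ⊙ ≈-trans (E-≡ (≡.sym eq)) (E-+ (gcd m j) (x ℕ.* m)))
      (solve 8
        (λ M J r s q Mx Jy g →
          (:- q) :* r :* M :+ s :* J :+ ((:- q) :* Mx :+ con (+ 1) :* Jy :+ con (+ 1) :* (g :+
          q :* Mx))
          := g :+ ((:- q) :* (M :* r) :+ con (+ 1) :* (J :* s) :+ con (+ 1) :* Jy)) ≈-refl _ _ r s
            _ _ _ _)

  module Factorisation (ψ : ℕ → Carrier)
    (cancel-E : ∀ g x y → 0 < g → E g * x ≈ E g * y → x ≈ y) where

    sel : ℕ → ℕ → Carrier
    sel n i = if dvd n i then ψ (suc i) else 1#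

    -- The product of ψ_d over the divisors d ≤ k of n. The bound is separate from n so that
    -- divisors can be added one at a time and products for different n can be compared factor by
    -- factor.
    D : ℕ → ℕ → Carrier
    D k n = ∏ k (sel n)

    Factored : ℕ → Set
    Factored n = D n n ≈ E n

    D-ψ : ∀ m → D (suc m) (suc m) ≈ D m (suc m) * ψ (suc m)
    D-ψ m rewrite ∣⇒dvd (suc m) m (divides 1 (≡.sym (ℕP.*-identityˡ (suc m)))) = ≈-refl

    D-stable : ∀ g k → 0 < g → D (k ℕ.+ g) g ≈ D g g
    D-stable g zero    0<g = ≈-refl
    D-stable g (suc k) 0<g with dvd g (k ℕ.+ g) in eq
    ... | false = ≈-trans (*-identityʳ _) (D-stable g k 0<g)
    ... | true  = contradiction (ℕP.≤-trans (s≤s (ℕP.m≤n+m g k))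
                    (∣⇒≤ ⦃ ℕ.>-nonZero 0<g ⦄ (dvd⇒∣ g (k ℕ.+ g) eq))) (ℕP.<-irrefl refl)

    D-∣ : ∀ k {g n} → g ∣ n → ∃[ r ] D k g * r ≈ D k n
    D-∣ k {g} {n} g∣n = ∏ k (λ i → if dvd g i then 1# else sel n i)
      , ≈-trans (∏-* k _ _) (∏-cong k (λ i _ → pointwise i))
      where
      pointwise : ∀ i → sel g i * (if dvd g i then 1# else sel n i) ≈ sel n i
      pointwise i with dvd g i in eq
      ... | false = *-identityˡ _
      ... | true rewrite ∣⇒dvd n i (∣-trans (dvd⇒∣ g i eq) g∣n) = *-identityʳ _

    comax-E : ∀ m j → Factored (suc m) → (∀ g → 0 < g → g < suc m → Factored g) →
      ¬ suc m ∣ j → Comax (ψ (suc m)) (E j)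
    comax-E m j F-m F-< m∤j =
      step (gcd[m,n]∣m (suc m) j) (E-gcd (suc m) j) (D-∣ m (gcd[m,n]∣m (suc m) j))
      where
      g = gcd (suc m) j
      0<g : 0 < g
      0<g = ℕP.n≢0⇒n>0 (gcd[m,n]≢0 (suc m) j (inj₁ (λ ())))
      g≤m : g ≤ m
      g≤m with ℕP.m≤n⇒m<n∨m≡n (∣⇒≤ (gcd[m,n]∣m (suc m) j))
      ... | inj₁ (s≤s g≤m) = g≤m
      ... | inj₂ g≡m = contradiction (subst (_∣ j) g≡m (gcd[m,n]∣n (suc m) j)) m∤j
      D-g : D m g ≈ E g
      D-g = ≈-trans (reflexive (cong (λ i → D i g) (≡.sym (ℕP.m∸n+n≡m g≤m))))
        (≈-trans (D-stable g (m ℕ.∸ g) 0<g) (F-< g 0<g (s≤s g≤m)))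
      step : g ∣ suc m → ∃[ u ] ∃[ v ] u * E (suc m) + v * E j ≈ E g →
        ∃[ r ] D m g * r ≈ D m (suc m) → Comax (ψ (suc m)) (E j)
      step (divides k m≡kg) (u , v , uv) (r , Dr) =
        found (Congruence.E-multiple R ι Q Q-0 Q-+ g k)
        where
        found : _ → Comax (ψ (suc m)) (E j)
        found (d , Ekg , z , d≈) =
          -- k = d - z (1 - q^g), where d = ψ r and 1 - q^g = u E (m+1) + v E j. Since E (m+1) is
          -- itself a multiple of ψ, its part moves into the coefficient of ψ.
          r - z * u * D m (suc m) , - (z * v) , + k , k≢0 , ≈-trans (combine
            (1# ⊙ ψr≈d ⊕ - z ⊙ uv ⊕ 1# ⊙ d≈ ⊕ z * u ⊙ ≈-sym E-m)
            (solve 11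
              (λ p r z u v D e g d k m →
                (r :- z :* u :* D) :* p :+ (:- (z :* v)) :* e :+ (con (+ 1) :* d :+ (:- z) :* g :+
                con (+ 1) :* (k :+ z :* g) :+ (z :* u) :* (D :* p))
                := k :+ (con (+ 1) :* (p :* r) :+ (:- z) :* (u :* m :+ v :* e) :+ con (+ 1) :* d :+
                (z :* u) :* m)) ≈-refl
              (ψ (suc m)) r z u v (D m (suc m)) (E j) (E g) d (fromℕ k) (E (suc m))))
            (fromℕ≈⟦⟧ k)
          where
          E-m : D m (suc m) * ψ (suc m) ≈ E (suc m)
          E-m = ≈-trans (≈-sym (D-ψ m)) F-m
          -- E g * (ψ r) and E g * d are both E (m+1), because D m g = E g; the factor E g is then
          -- cancelled.
          ψr≈d : ψ (suc m) * r ≈ d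
          ψr≈d = cancel-E g _ _ 0<g (combine
            (- (ψ (suc m) * r) ⊙ D-g ⊕ ψ (suc m) ⊙ Dr ⊕ 1# ⊙ E-m
              ⊕ 1# ⊙ ≈-trans (E-≡ m≡kg) Ekg)
            (solve 7
              (λ g p r Dg D m d →
                g :* (p :* r) :+ ((:- (p :* r)) :* g :+ p :* D :+ con (+ 1) :* m :+ con (+ 1) :* (d
                :* g))
                := g :* d :+ ((:- (p :* r)) :* Dg :+ p :* (Dg :* r) :+ con (+ 1) :* (D :* p) :+ con
                (+ 1) :* m)) ≈-refl
              _ _ r _ _ _ d))
          k≢0 : ¬ + k ≡ + 0
          k≢0 e = ℕP.1+n≢0 (≡.trans m≡kg (cong (ℕ._* g) (ℤP.+-injective e)))

    -- Divisors are added in increasing order. The new factor ψ_(k+1) is comaximal with each earlier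
    -- ψ_i, since ψ_i divides 1 - q^i and k + 1 does not divide i ≤ k. As comaximality holds over ℚ,
    -- an integer c accumulates.
    D-divides : ∀ m → (∀ g → 0 < g → g < suc m → Factored g) → ∀ k → k ≤ m →
      ∃[ c ] (¬ c ≡ + 0) × ∃[ s ] D k (suc m) * s ≈ ⟦ c ⟧ * E (suc m)
    D-divides m F-< zero    _   = + 1 , (λ ()) , E (suc m) , *-congʳ (≈-sym 1-homo)
    D-divides m F-< (suc k) k<m with D-divides m F-< k (ℕP.<⇒≤ k<m) | dvd (suc m) k in eq
    ... | c , c≢0 , s , Ds | false = c , c≢0 , s , ≈-trans (*-congʳ (*-identityʳ _)) Ds
    ... | c , c≢0 , s , Ds | true  with E-∣ (dvd⇒∣ (suc m) k eq)
    ...   | r , Er = comax-multiple (comax-sym (comax-∏ k each)) c≢0 Ds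
              (≈-trans (≈-trans (≈-sym (*-assoc _ _ _)) (*-congʳ (ψ-E k k<m))) Er)
      where
      F : ∀ i → i < m → Factored (suc i)
      F i i<m = F-< (suc i) (s≤s z≤n) (s≤s i<m)
      ψ-E : ∀ i → i < m → ψ (suc i) * D i (suc i) ≈ E (suc i)
      ψ-E i i<m = ≈-trans (*-comm _ _) (≈-trans (≈-sym (D-ψ i)) (F i i<m))
      each : ∀ i → i < k → Comax (ψ (suc k)) (sel (suc m) i)
      each i i<k with dvd (suc m) i
      ... | false = comax-1
      ... | true  = comax-factor (D i (suc i)) (ψ-E i (ℕP.<-trans i<k k<m))
        (comax-E k (suc i) (F k k<m)
          (λ g 0<g g≤k → F-< g 0<g (ℕP.<-trans g≤k (s≤s k<m)))
          (λ k∣i → ℕP.<⇒≱ (s≤s i<k) (∣⇒≤ k∣i)))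

-- Specialisation to ℤ[q]: cancellation and degrees.

private
  0∷-* : ∀ p r → (+ 0 ∷ p) *P r ≋ + 0 ∷ (p *P r)
  0∷-* p r = ≋-in λ
    { zero    → coeff-*-zero (+ 0 ∷ p) r
    ; (suc i) → ≡.trans (coeff-*-suc (+ 0) p r i) (ℤP.+-identityˡ _) }

  0∷-cong : ∀ {p r} → p ≋ r → + 0 ∷ p ≋ + 0 ∷ r
  0∷-cong p≋r = ≋-in λ { zero → refl ; (suc i) → ≋-out p≋r i }

qP-+ : ∀ i j → qP (i ℕ.+ j) ≋ qP i *P qP j
qP-+ zero    j = CommutativeRing.sym polyRing (CommutativeRing.*-identityˡ polyRing (qP j))
qP-+ (suc i) j = CommutativeRing.trans polyRing (0∷-cong (qP-+ i j))
  (CommutativeRing.sym polyRing (0∷-* (qP i) (qP j)))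

open QSeries polyRing constP-hom qP (CommutativeRing.refl polyRing) qP-+
open Comaximality polyRing constP-hom
open Cyclotomic polyRing constP-hom qP ≈-refl qP-+

coeff-constP-* : ∀ c p i → coeff (constP c *P p) i ≡ c ℤ.* coeff p i
coeff-constP-* c p zero    = coeff-*-zero (constP c) p
coeff-constP-* c p (suc i) = ≡.trans (coeff-*-suc c [] p i) (ℤP.+-identityʳ _)

constP-cancel : ∀ {c p r} → ¬ c ≡ + 0 → constP c *P p ≋ constP c *P r → p ≋ r
constP-cancel {c} {p} {r} c≢0 e = ≋-in λ i →
  ℤP.*-cancelˡ-≡ c _ _ ⦃ ℤ.≢-nonZero c≢0 ⦄
    (≡.trans (≡.sym (coeff-constP-* c p i)) (≡.trans (≋-out e i) (coeff-constP-* c r i)))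

module _ (g : Poly) (g₀≡1 : coeff g 0 ≡ + 1) where

  -- Uniqueness of power series quotients: constant term 1 of `g` forces the constant term of `z` to
  -- vanish, and dropping it lowers all degrees by one.
  *-vanish-below : ∀ z N → (∀ i → i < N → coeff (g *P z) i ≡ + 0) → ∀ i → i < N → coeff z i ≡ + 0
  *-vanish-below []       N       _ i       _         = refl
  *-vanish-below (d ∷ ds) (suc N) h zero    _         = ≡.trans (≡.sym (ℤP.*-identityˡ d))
    (≡.trans (cong (ℤ._* d) (≡.sym g₀≡1)) (≡.trans (≡.sym (coeff-*-zero g (d ∷ ds)))
      (h 0 (s≤s z≤n))))
  *-vanish-below (d ∷ ds) (suc N) h (suc i) (s≤s i<N) = *-vanish-below ds N tail i i<N
    where
    d≡0 : d ≡ + 0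
    d≡0 = *-vanish-below (d ∷ ds) (suc N) h 0 (s≤s z≤n)
    tail : ∀ i → i < N → coeff (g *P ds) i ≡ + 0
    tail i i<N = begin
      coeff (g *P ds) i                              ≡⟨ ≡.sym (ℤP.+-identityˡ _) ⟩
      + 0 ℤ.* coeff g (suc i) ℤ.+ coeff (g *P ds) i
        ≡⟨ cong (λ x → x ℤ.* _ ℤ.+ coeff (g *P ds) i) (≡.sym d≡0) ⟩
      d ℤ.* coeff g (suc i) ℤ.+ coeff (g *P ds) i    ≡⟨ ≡.sym (coeff-*-sucʳ g d ds i) ⟩
      coeff (g *P (d ∷ ds)) (suc i)                  ≡⟨ h (suc i) (s≤s i<N) ⟩
      + 0                                            ∎
      where open ≡.≡-Reasoning

  *-cancel : ∀ {x y} → g *P x ≋ g *P y → x ≋ y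
  *-cancel {x} {y} e = begin
    x           ≈⟨ solve 2
      (λ x y →
        x := x :- y :+ y) ≈-refl x y ⟩
    x - y + y   ≈⟨ +-congʳ {y} {x - y} {0#} (≋-in λ i → *-vanish-below (x - y) (suc i)
      (λ j _ → ≋-out gz j) i ℕP.≤-refl) ⟩
    0# + y      ≈⟨ +-identityˡ y ⟩
    y           ∎
    where
    open ≈-Reasoning
    gz : g * (x - y) ≋ 0#
    gz = combine (1# ⊙ e) (solve 3
      (λ g x y →
        g :* (x :- y) :+ (con (+ 1) :* (g :* y))
        := con (+ 0) :+ (con (+ 1) :* (g :* x))) ≈-refl g x y)

-- Degree d with its non-zero leading coefficient. Lists may end in zeros, so their length does not
-- determine it.
Top : Poly → ℕ → Set
Top p d = (¬ coeff p d ≡ + 0) × (∀ i → d < i → coeff p i ≡ + 0)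

top : ∀ p → (∀ i → coeff p i ≡ + 0) ⊎ (∃[ d ] Top p d)
top []       = inj₁ λ i → refl
top (c ∷ cs) with top cs | c ℤP.≟ + 0
... | inj₂ (d , d≢0 , above) | _       = inj₂ (suc d , d≢0 , λ { (suc i) (s≤s d<i) → above i d<i })
... | inj₁ cs≡0              | yes c≡0 = inj₁ λ { zero → c≡0 ; (suc i) → cs≡0 i }
... | inj₁ cs≡0              | no c≢0  = inj₂ (0 , c≢0 , λ { (suc i) _ → cs≡0 i })

coeff-*-top : ∀ p r d t → (∀ i → d < i → coeff p i ≡ + 0) → (∀ i → t < i → coeff r i ≡ + 0) →
  coeff (p *P r) (d ℕ.+ t) ≡ coeff p d ℤ.* coeff r t
coeff-*-top []       r d       t _ _ = refl
coeff-*-top (c ∷ cs) r zero    zero    _  _  = coeff-*-zero (c ∷ cs) r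
coeff-*-top (c ∷ cs) r zero    (suc t) p≡ _  = ≡.trans (coeff-*-suc c cs r t)
  (≡.trans (cong (λ x → c ℤ.* coeff r (suc t) ℤ.+ x) (zero-* cs (λ i → p≡ (suc i) (s≤s z≤n)) t))
    (ℤP.+-identityʳ _))
  where
  zero-* : ∀ p → (∀ i → coeff p i ≡ + 0) → ∀ i → coeff (p *P r) i ≡ + 0
  zero-* p p≡0 i = ≋-out (≈-trans (*-congʳ {r} {p} {[]} (≋-in p≡0)) (zeroˡ r)) i
coeff-*-top (c ∷ cs) r (suc d) t       p≡ r≡ = ≡.trans (coeff-*-suc c cs r (d ℕ.+ t))
  (≡.trans (cong (λ x → c ℤ.* x ℤ.+ coeff (cs *P r) (d ℕ.+ t)) (r≡ _ (s≤s (ℕP.m≤n+m t d))))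
    (≡.trans (cong (ℤ._+ coeff (cs *P r) (d ℕ.+ t)) (ℤP.*-zeroʳ c))
      (≡.trans (ℤP.+-identityˡ _) (coeff-*-top cs r d t (λ i d<i → p≡ (suc i) (s≤s d<i)) r≡))))

top-* : ∀ {p r d t} → Top p d → Top r t → ¬ coeff (p *P r) (d ℕ.+ t) ≡ + 0
top-* {p} {r} {d} {t} (p≢0 , p≡) (r≢0 , r≡) e =
  *-≢0 p≢0 r≢0 (≡.trans (≡.sym (coeff-*-top p r d t p≡ r≡)) e)

-- Exactness of `divSeries`.

-- Its only purpose is to put a term into a type, where unification can compare it.
data Is {A : Set} : A → Set where
  is : ∀ x → Is x

-- The recursions inside the definition of divSeries have no names outside of it; the
-- unsolved bodies below are determined by unification with the unfolded quotient.
mutual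
  loop : Poly → Poly → ℕ → ℕ → ℕ → List ℤ → Poly
  loop = _

  loop-is : ∀ f g m → Is (divSeries f g (suc m))
  loop-is f g m with suc m | m | 1 | (coeff f 0 ℤ.- + 0) ∷ []
  ... | w | k | i | hs = is (loop f g w k i hs)

mutual
  conv : Poly → Poly → ℕ → ℕ → List ℤ → ℤ
  conv = _

  conv-is : ∀ f g w i hs → Is (loop f g w 1 i hs)
  conv-is f g w i hs with 1
  ... | j = is (foldl (λ xs x → x ∷ xs) ((coeff f i ℤ.- conv f g w j hs) ∷ []) hs)

coeff-*-snoc : ∀ g p x k → coeff (g *P (p ++ x ∷ [])) (length p ℕ.+ k)
                           ≡ coeff (g *P p) (length p ℕ.+ k) ℤ.+ x ℤ.* coeff g k
coeff-*-snoc g []       x k = begin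
  coeff (g *P (x ∷ [])) k                    ≡⟨ *P-comm g (x ∷ []) k ⟩
  coeff (constP x *P g) k                    ≡⟨ coeff-constP-* x g k ⟩
  x ℤ.* coeff g k                            ≡⟨ ≡.sym (ℤP.+-identityˡ _) ⟩
  + 0 ℤ.+ x ℤ.* coeff g k                    ≡⟨ cong (ℤ._+ x ℤ.* coeff g k)
    (≡.sym (coeff-*-[] g k)) ⟩
  coeff (g *P []) k ℤ.+ x ℤ.* coeff g k      ∎
  where open ≡.≡-Reasoning
coeff-*-snoc g (d ∷ ds) x k
  rewrite coeff-*-sucʳ g d (ds ++ x ∷ []) (length ds ℕ.+ k) | coeff-*-sucʳ g d ds (length ds ℕ.+ k)
        | coeff-*-snoc g ds x k = ≡.sym (ℤP.+-assoc (d ℤ.* coeff g (suc (length ds ℕ.+ k))) _ _)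

coeff-*-snoc-< : ∀ g p x i → i < length p → coeff (g *P (p ++ x ∷ [])) i ≡ coeff (g *P p) i
coeff-*-snoc-< g (d ∷ ds) x zero    _ =
  ≡.trans (coeff-*-zero g _) (≡.sym (coeff-*-zero g (d ∷ ds)))
coeff-*-snoc-< g (d ∷ ds) x (suc i) (s≤s i<) =
  ≡.trans (coeff-*-sucʳ g d _ i) (≡.trans (cong (λ y → d ℤ.* coeff g (suc i) ℤ.+ y)
    (coeff-*-snoc-< g ds x i i<))
    (≡.sym (coeff-*-sucʳ g d ds i)))

-- `hs` lists the known coefficients from the latest down, so along `conv` the index of g rises as
-- that of h falls; the index sum stays equal to m.
conv-coeff : ∀ f g w j hs m → suc m ≡ length hs ℕ.+ j →
  conv f g w j hs ≡ coeff (g *P reverse hs) m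
conv-coeff f g w j []       m _ = ≡.sym (coeff-*-[] g m)
conv-coeff f g w j (x ∷ xs) m m≡ = begin
  coeff g j ℤ.* x ℤ.+ conv f g w (suc j) xs
    ≡⟨ cong (λ y → coeff g j ℤ.* x ℤ.+ y) (conv-coeff f g w (suc j) xs m
      (≡.trans m≡ (≡.sym (ℕP.+-suc (length xs) j)))) ⟩
  coeff g j ℤ.* x ℤ.+ coeff (g *P reverse xs) m
    ≡⟨ ≡.trans (ℤP.+-comm _ (coeff (g *P reverse xs) m))
      (cong (λ y → coeff (g *P reverse xs) m ℤ.+ y) (ℤP.*-comm (coeff g j) x)) ⟩
  coeff (g *P reverse xs) m ℤ.+ x ℤ.* coeff g j
    ≡⟨ cong (λ i → coeff (g *P reverse xs) i ℤ.+ x ℤ.* coeff g j) m≡′ ⟩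
  coeff (g *P reverse xs) (length (reverse xs) ℕ.+ j) ℤ.+ x ℤ.* coeff g j
    ≡⟨ ≡.sym (coeff-*-snoc g (reverse xs) x j) ⟩
  coeff (g *P (reverse xs ++ x ∷ [])) (length (reverse xs) ℕ.+ j)
    ≡⟨ cong₂ (λ p i → coeff (g *P p) i) (≡.sym (ListP.unfold-reverse x xs)) (≡.sym m≡′) ⟩
  coeff (g *P reverse (x ∷ xs)) m ∎
  where
  open ≡.≡-Reasoning
  m≡′ : m ≡ length (reverse xs) ℕ.+ j
  m≡′ = ≡.trans (ℕP.suc-injective m≡) (cong (ℕ._+ j) (≡.sym (ListP.length-reverse xs)))

-- Loop invariant: g times the coefficients found so far agrees with f below degree i. The next
-- coefficient is the defect in degree i, which is correct because g has constant term 1.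
loop-exact : ∀ f g w → coeff g 0 ≡ + 1 → ∀ k i hs → length hs ≡ i →
  (∀ j → j < i → coeff (g *P reverse hs) j ≡ coeff f j) →
  length (loop f g w k i hs) ≡ k ℕ.+ i
  × (∀ j → j < k ℕ.+ i → coeff (g *P loop f g w k i hs) j ≡ coeff f j)
loop-exact f g w g₀ zero    i hs len exact = ≡.trans (ListP.length-reverse hs) len , exact
loop-exact f g w g₀ (suc k) i hs refl exact
  rewrite ≡.sym (ℕP.+-suc k (length hs)) = loop-exact f g w g₀ k (suc i) (h ∷ hs) refl exact′
  where
  h = coeff f i ℤ.- conv f g w 1 hs
  exact′ : ∀ j → j < suc i → coeff (g *P reverse (h ∷ hs)) j ≡ coeff f j
  exact′ j (s≤s j≤i) rewrite ListP.unfold-reverse h hs with ℕP.m≤n⇒m<n∨m≡n j≤i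
  ... | inj₁ j<i = ≡.trans (coeff-*-snoc-< g (reverse hs) h j
                     (subst (j <_) (≡.sym (ListP.length-reverse hs)) j<i)) (exact j j<i)
  ... | inj₂ refl = begin
    coeff (g *P (reverse hs ++ h ∷ [])) i
      ≡⟨ cong (coeff (g *P (reverse hs ++ h ∷ []))) i≡ ⟩
    coeff (g *P (reverse hs ++ h ∷ [])) (length (reverse hs) ℕ.+ 0)
      ≡⟨ coeff-*-snoc g (reverse hs) h 0 ⟩
    coeff (g *P reverse hs) (length (reverse hs) ℕ.+ 0) ℤ.+ h ℤ.* coeff g 0
      ≡⟨ cong₂ (λ x y → coeff (g *P reverse hs) x ℤ.+ h ℤ.* y) (≡.sym i≡) g₀ ⟩
    coeff (g *P reverse hs) i ℤ.+ h ℤ.* + 1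
      ≡⟨ cong (λ x → coeff (g *P reverse hs) i ℤ.+ (coeff f i ℤ.- x) ℤ.* + 1)
           (conv-coeff f g w 1 hs i (ℕP.+-comm 1 (length hs))) ⟩
    coeff (g *P reverse hs) i ℤ.+ (coeff f i ℤ.- coeff (g *P reverse hs) i) ℤ.* + 1
      ≡⟨ lemma (coeff (g *P reverse hs) i) (coeff f i) ⟩
    coeff f i ∎
    where
    open ≡.≡-Reasoning
    i≡ : i ≡ length (reverse hs) ℕ.+ 0
    i≡ = ≡.trans (≡.sym (ListP.length-reverse hs)) (≡.sym (ℕP.+-identityʳ _))
    lemma : ∀ x y → x ℤ.+ (y ℤ.- x) ℤ.* + 1 ≡ y
    lemma = ℤ-Solver.solve-∀

coeff-≥length : ∀ p i → length p ≤ i → coeff p i ≡ + 0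
coeff-≥length []       i       _       = refl
coeff-≥length (c ∷ cs) (suc i) (s≤s l) = coeff-≥length cs i l

-- Below degree N, y and c h agree by uniqueness of the series quotient h. From N on both vanish: h
-- by its length, y because degrees add and g y = c f has degree below N. Hence y = c h, and the
-- integer c cancels.
divSeries-exact : ∀ f g y c N → coeff g 0 ≡ + 1 → ¬ c ≡ + 0 → g *P y ≋ constP c *P f →
  (∀ i → N ≤ i → coeff f i ≡ + 0) → g *P divSeries f g N ≋ f
divSeries-exact f g y c N g₀ c≢0 gy f≡0 = constP-cancel c≢0 (begin
  constP c * (g * h)  ≈⟨ solve 3
    (λ c g h →
      c :* (g :* h) := g :* (c :* h)) ≈-refl (constP c) g h ⟩
  g * (constP c * h)  ≈⟨ *-congˡ {g} (≈-sym y≋ch) ⟩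
  g * y               ≈⟨ gy ⟩
  constP c * f        ∎)
  where
  open ≈-Reasoning
  h = divSeries f g N
  spec = loop-exact f g N g₀ N 0 [] refl (λ _ ())
  N+0 = ℕP.+-identityʳ N
  z = y - constP c * h
  gz : g * z ≋ constP c * (f - g * h)
  gz = combine (1# ⊙ gy)
    (solve 5
      (λ g y c h f →
        g :* (y :- c :* h) :+ (con (+ 1) :* (c :* f))
        := c :* (f :- g :* h) :+ (con (+ 1) :* (g :* y))) ≈-refl g y (constP c) h f)
  coeff-- : ∀ p r i → coeff (p - r) i ≡ coeff p i ℤ.- coeff r i
  coeff-- p r i = ≡.trans (coeff-+ p (-P r) i) (cong (λ x → coeff p i ℤ.+ x) (coeff-neg r i))
  below : ∀ i → i < N → coeff z i ≡ + 0
  below = *-vanish-below g g₀ z N λ i i<N → ≡.trans (≋-out gz i)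
    (≡.trans (coeff-constP-* c (f - g * h) i) (≡.trans (cong (c ℤ.*_) (≡.trans (coeff-- f (g * h) i)
      (≡.trans (cong (λ x → coeff f i ℤ.- x) (proj₂ spec i (subst (i <_) (≡.sym N+0) i<N)))
        (ℤP.+-inverseʳ (coeff f i))))) (ℤP.*-zeroʳ c)))
  cf≡0 : ∀ i → N ≤ i → coeff (g *P y) i ≡ + 0
  cf≡0 i N≤i = ≡.trans (≋-out gy i) (≡.trans (coeff-constP-* c f i)
    (≡.trans (cong (c ℤ.*_) (f≡0 i N≤i)) (ℤP.*-zeroʳ c)))
  y≡0 : ∀ i → N ≤ i → coeff y i ≡ + 0
  y≡0 i N≤i with top g | top y
  ... | inj₁ g≡0 | _ = contradiction (≡.trans (≡.sym g₀) (g≡0 0)) (λ ())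
  ... | inj₂ _ | inj₁ y≡0 = y≡0 i
  ... | inj₂ (d , Tg) | inj₂ (t , Ty) with N ℕP.≤? t
  ...   | yes N≤t = contradiction (cf≡0 (d ℕ.+ t) (ℕP.≤-trans N≤t (ℕP.m≤n+m t d)))
    (top-* {g} {y} Tg Ty)
  ...   | no N≰t = proj₂ Ty i (ℕP.<-≤-trans (ℕP.≰⇒> N≰t) N≤i)
  h≡0 : ∀ i → N ≤ i → coeff h i ≡ + 0
  h≡0 i N≤i = coeff-≥length h i (subst (_≤ i) (≡.sym (≡.trans (proj₁ spec) N+0)) N≤i)
  z≋0 : z ≋ 0#
  z≋0 = ≋-in λ i → at i (N ℕP.≤? i)
    where
    at : ∀ i → _ → coeff z i ≡ + 0
    at i (no N≰i) = below i (ℕP.≰⇒> N≰i)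
    at i (yes N≤i) = ≡.trans (coeff-- y (constP c * h) i)
      (cong₂ ℤ._-_ (y≡0 i N≤i) (≡.trans (coeff-constP-* c h i)
        (≡.trans (cong (c ℤ.*_) (h≡0 i N≤i)) (ℤP.*-zeroʳ c))))
  y≋ch : y ≋ constP c * h
  y≋ch = combine (1# ⊙ z≋0) (solve 2
    (λ y w →
      y :+ (con (+ 1) :* con (+ 0)) := w :+ (con (+ 1) :* (y :- w))) ≈-refl y (constP c * h))

-- The factors `psi` and their coprimality properties.

mutual
  -- Names the local filter of `properDivisors` by unification, as above; the `with` turns its
  -- arguments into variables, so that the solution is unique.
  filt : ℕ → (ℕ → Bool) → List ℕ → List ℕ
  filt = _

  filt-is : ∀ n → Is (properDivisors n)
  filt-is n with (λ i → (n ℕD.% suc i) ℕ.≡ᵇ 0) | upTo (n ℕ.∸ 1)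
  ... | p | xs = is (filt n p xs)

map-filt-cong : ∀ n p {h h′ : ℕ → Poly} {xs} → All (λ i → h (suc i) ≡ h′ (suc i)) xs →
  map h (filt n p xs) ≡ map h′ (filt n p xs)
map-filt-cong n p All.[] = refl
map-filt-cong n p (All._∷_ {x} e es) with p x
... | true  = cong₂ _∷_ e (map-filt-cong n p es)
... | false = map-filt-cong n p es

prodP-filt : ∀ n p h k f →
  prodP (map h (filt n p (applyUpTo f k))) ≋ ∏ k (λ i → if p (f i) then h (suc (f i)) else oneP)
prodP-filt n p h zero    f = ≈-refl
prodP-filt n p h (suc k) f = ≈-trans step (≈-sym (∏-front k _))
  where
  tail = prodP-filt n p h k (λ i → f (suc i))
  step : prodP (map h (filt n p (applyUpTo f (suc k))))
         ≋ (if p (f 0) then h (suc (f 0)) else oneP)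
           *P ∏ k (λ i → if p (f (suc i)) then h (suc (f (suc i))) else oneP)
  step with p (f 0)
  ... | true  = *-congˡ {h (suc (f 0))} tail
  ... | false = ≈-trans tail (≈-sym (*-identityˡ _))

psi-fuel : ∀ f f′ n → n ≤ f → n ≤ f′ → psi f n ≡ psi f′ n
psi-fuel zero    zero     zero          _ _ = refl
psi-fuel zero    (suc f′) zero          _ _ = refl
psi-fuel (suc f) zero     zero          _ _ = refl
psi-fuel (suc f) (suc f′) zero          _ _ = refl
psi-fuel (suc f) (suc f′) (suc zero)    _ _ = refl
psi-fuel (suc f) (suc f′) (suc (suc k)) (s≤s k<f) (s≤s k<f′) =
  cong (λ ps → divSeries (oneP -P qP (suc (suc k))) (prodP ps) (suc (suc (suc k))))
    (map-filt-cong (suc (suc k)) (λ i → (suc (suc k) ℕD.% suc i) ℕ.≡ᵇ 0) {psi f} {psi f′}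
      (AllP.applyUpTo⁺₁ (λ i → i) (suc k) λ {i} i<k →
        psi-fuel f f′ (suc i) (ℕP.≤-trans i<k k<f) (ℕP.≤-trans i<k k<f′)))

Ψ : ℕ → Poly
Ψ n = psi n n

E-cancel : ∀ g x y → 0 < g → E g *P x ≋ E g *P y → x ≋ y
E-cancel (suc g) x y _ = *-cancel (E (suc g)) refl {x} {y}

open Factorisation Ψ E-cancel

coeff-qP : ∀ k i → k < i → coeff (qP k) i ≡ + 0
coeff-qP zero    (suc i) _         = refl
coeff-qP (suc k) (suc i) (s≤s k<i) = coeff-qP k i k<i

coeff-E : ∀ k i → k < i → coeff (E k) i ≡ + 0
coeff-E k (suc i) k<i = ≡.trans (coeff-+ oneP (-P (qP k)) (suc i))
  (≡.trans (ℤP.+-identityˡ _) (≡.trans (coeff-neg (qP k) (suc i))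
    (cong ℤ.-_ (coeff-qP k (suc i) k<i))))

∏-coeff₀ : ∀ k f → (∀ i → i < k → coeff (f i) 0 ≡ + 1) → coeff (∏ k f) 0 ≡ + 1
∏-coeff₀ zero    f h = refl
∏-coeff₀ (suc k) f h = ≡.trans (coeff-*-zero (∏ k f) (f k))
  (cong₂ ℤ._*_ (∏-coeff₀ k f (λ i i<k → h i (ℕP.m<n⇒m<1+n i<k))) (h k (ℕP.n<1+n k)))

sel-coeff₀ : ∀ n i → coeff (Ψ (suc i)) 0 ≡ + 1 → coeff (sel n i) 0 ≡ + 1
sel-coeff₀ n i h with dvd n i
... | true  = h
... | false = refl

-- The two claims need each other: constant terms 1 of the earlier factors make the series division
-- by their product legitimate, and the resulting factorisation of 1 - q^n gives the constant term
-- of the new factor.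
Ψ-spec : ∀ b n → 0 < n → n ≤ b → Factored n × coeff (Ψ n) 0 ≡ + 1
Ψ-spec (suc b) (suc zero)    _ _         = *-identityˡ (Ψ 1) , refl
Ψ-spec (suc b) (suc (suc k)) _ (s≤s k<b) = ≈-trans (D-ψ (suc k)) DΨ , Ψ₀
  where
  n = suc (suc k)
  G = prodP (map (psi (suc k)) (properDivisors n))
  below : ∀ g → 0 < g → g < n → Factored g × coeff (Ψ g) 0 ≡ + 1
  below g 0<g (s≤s g≤k) = Ψ-spec b g 0<g (ℕP.≤-trans g≤k k<b)
  G≋D : G ≋ D (suc k) n
  G≋D = ≈-trans (reflexive (cong prodP
    (map-filt-cong n (λ i → (n ℕD.% suc i) ℕ.≡ᵇ 0) {psi (suc k)} {Ψ}
      (AllP.applyUpTo⁺₁ (λ i → i) (suc k) λ {i} i<k → psi-fuel (suc k) (suc i)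
        (suc i) i<k ℕP.≤-refl))))
    (prodP-filt n (λ i → (n ℕD.% suc i) ℕ.≡ᵇ 0) Ψ (suc k) (λ i → i))
  D₀ : coeff (D (suc k) n) 0 ≡ + 1
  D₀ = ∏-coeff₀ (suc k) (sel n) λ i i<k → sel-coeff₀ n i (proj₂ (below (suc i) (s≤s z≤n) (s≤s i<k)))
  exact : ∃[ c ] (¬ c ≡ + 0) × ∃[ s ] D (suc k) n *P s ≋ constP c *P E n → G *P Ψ n ≋ E n
  exact (c , c≢0 , s , Ds) = divSeries-exact (E n) G s c (suc n)
    (≡.trans (≋-out G≋D 0) D₀) c≢0 (≈-trans (*-congʳ {s} G≋D) Ds) (coeff-E n)
  DΨ : D (suc k) n *P Ψ n ≋ E n
  DΨ = ≈-trans (*-congʳ {Ψ n} (≈-sym G≋D))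
    (exact (D-divides (suc k) (λ g 0<g g<n → proj₁ (below g 0<g g<n)) (suc k) ℕP.≤-refl))
  Ψ₀ : coeff (Ψ n) 0 ≡ + 1
  Ψ₀ = ≡.trans (≡.sym (ℤP.*-identityˡ _)) (≡.trans (cong (ℤ._* coeff (Ψ n) 0) (≡.sym D₀))
    (≡.trans (≡.sym (coeff-*-zero (D (suc k) n) (Ψ n))) (≋-out DΨ 0)))

Ψ-factored : ∀ n → 0 < n → Factored n
Ψ-factored n 0<n = proj₁ (Ψ-spec n n 0<n ℕP.≤-refl)

Ψ-∣-E : ∀ m → Ψ (suc m) *P D m (suc m) ≋ E (suc m)
Ψ-∣-E m = ≈-trans (*-comm (Ψ (suc m)) (D m (suc m)))
  (≈-trans (≈-sym (D-ψ m)) (Ψ-factored (suc m) (s≤s z≤n)))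

Ψ-comax-E : ∀ m j → ¬ suc m ∣ j → Comax (Ψ (suc m)) (E j)
Ψ-comax-E m j = comax-E m j (Ψ-factored (suc m) (s≤s z≤n)) (λ g 0<g _ → Ψ-factored g 0<g)

Ψ-comax-qP : ∀ m k → Comax (Ψ (suc m)) (qP k)
Ψ-comax-qP m zero    = comax-1
Ψ-comax-qP m (suc k) = comax-factor {y = qP (suc k)} oneP
  (≈-trans (*-identityʳ (qP (suc k))) (qP-+ 1 k)) (comax-* {y =
    qP 1} {qP k} comax-q (Ψ-comax-qP m k))
  where
  comax-q : Comax (Ψ (suc m)) (qP 1)
  -- Ψ D is 1 - q^(m+1), and adding q q^m gives 1.
  comax-q = D m (suc m) , qP m , + 1 , (λ ()) , combine
    (1# ⊙ Ψ-∣-E m ⊕ - 1# ⊙ qP-+ 1 m)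
    (solve 5
      (λ p d q x N →
        d :* p :+ x :* q :+ (con (+ 1) :* (con (+ 1) :- N) :+ (:- con (+ 1)) :* (q :* x))
        := con (+ 1) :+ (con (+ 1) :* (p :* d) :+ (:- con (+ 1)) :* N)) ≈-refl
      (Ψ (suc m)) (D m (suc m)) (qP 1) (qP m) (qP (suc m)))

-- A common divisor divides a non-zero integer, so it is a constant; it is ±1 because
-- the constant term of Ψ is 1.
comax⇒coprime : ∀ m {x} → Comax (Ψ (suc m)) x → CoprimeP x (Ψ (suc m))
comax⇒coprime m {x} (u , v , c , c≢0 , uv) d (e₁ , de₁) (e₂ , de₂) = go (top d) (top w)
  where
  w = u *P e₂ +P v *P e₁
  dw : d *P w ≋ constP c
  dw = combine (u ⊙ ≋-in {d *P e₂} {Ψ (suc m)} de₂ ⊕ v ⊙ ≋-in {d *P e₁} {x} de₁ ⊕ 1# ⊙ uv)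
    (solve 8
      (λ d u v a b p x c →
        d :* (u :* a :+ v :* b) :+ (u :* p :+ v :* x :+ con (+ 1) :* c)
        := c :+ (u :* (d :* a) :+ v :* (d :* b) :+ con (+ 1) :* (u :* p :+ v :* x))) ≈-refl
      d u v e₂ e₁ (Ψ (suc m)) x (constP c))
  de₀ : coeff d 0 ℤ.* coeff e₂ 0 ≡ + 1
  de₀ = ≡.trans (≡.sym (coeff-*-zero d e₂))
    (≡.trans (de₂ 0) (proj₂ (Ψ-spec (suc m) (suc m) (s≤s z≤n) ℕP.≤-refl)))
  go : (∀ i → coeff d i ≡ + 0) ⊎ (∃[ t ] Top d t) → (∀ i → coeff w i ≡ + 0) ⊎ (∃[ t ] Top w t) →
       d ∣P oneP
  go (inj₁ d≡0) _ = contradiction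
    (≡.trans (≡.sym de₀) (cong (ℤ._* coeff e₂ 0) (d≡0 0))) (λ ())
  go _ (inj₁ w≡0) = contradiction
    (≡.trans (≡.sym (≋-out dw 0)) (≡.trans (coeff-*-zero d w)
      (≡.trans (cong (coeff d 0 ℤ.*_) (w≡0 0)) (ℤP.*-zeroʳ (coeff d 0))))) c≢0
  go (inj₂ (suc t , Td)) (inj₂ (s , Tw)) = contradiction (≋-out dw (suc t ℕ.+ s))
    (top-* {d} {w} Td Tw)
  go (inj₂ (zero , _ , above)) _ = constP (coeff e₂ 0) , λ
    { zero → ≡.trans (coeff-*-zero d _) de₀
    ; (suc i) → ≡.trans (coeff-*-sucʳ d (coeff e₂ 0) [] i)
        (cong₂ ℤ._+_ (≡.trans (cong (coeff e₂ 0 ℤ.*_) (above (suc i) (s≤s z≤n)))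
          (ℤP.*-zeroʳ (coeff e₂ 0)))
          (coeff-*-[] d i)) }

-- From fractions to polynomials.

-- The denominators occurring in Frac may vanish modulo Φ, so fractions are compared with p / s
-- for an s under control.
record Rep (x : Frac) (s p : Poly) : Set where
  constructor rep
  field unrep : num x *P s ≋ p *P den x
open Rep public

Rep-≋ : ∀ {x s p r} → p ≋ r → Rep x s p → Rep x s r
Rep-≋ {x} p≋r (rep e) = rep (≈-trans e (*-congʳ {den x} p≋r))

Rep-q : ∀ {x p} → Rep x oneP p → Rep x (qP 1) (qP 1 *P p)
Rep-q {x} {p} (rep e) = rep (combine (qP 1 ⊙ e)
  (solve 4
    (λ a p t d →
      a :* t :+ (t :* (p :* d)) := t :* p :* d :+ (t :* (a :* con (+ 1)))) ≈-refl (num x) p (qP 1)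
        (den x)))

-- The scale `s` is allowed in one factor only, so that it does not become a square in products.
Rep-* : ∀ {x y s p r} → Rep x oneP p → Rep y s r → Rep (x *F y) s (p *P r)
Rep-* {x} {y} {s} {p} {r} (rep e) (rep f) = rep (combine (num y *P s ⊙ e ⊕ p *P den x ⊙ f)
  (solve 7
    (λ a b c d s p r →
      a :* c :* s :+ ((c :* s) :* (p :* b) :+ (p :* b) :* (r :* d))
      := p :* r :* (b :* d) :+ ((c :* s) :* (a :* con (+ 1)) :+ (p :* b) :* (c :* s)))
      ≈-refl
    (num x) (den x) (num y) (den y) s p r))

Rep-+ : ∀ {x y s p r} → Rep x s p → Rep y s r → Rep (x +F y) s (p +P r)
Rep-+ {x} {y} {s} {p} {r} (rep e) (rep f) = rep (combine (den y ⊙ e ⊕ den x ⊙ f)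
  (solve 7
    (λ a b c d s p r →
      (a :* d :+ c :* b) :* s :+ (d :* (p :* b) :+ b :* (r :* d))
      := (p :+ r) :* (b :* d) :+ (d :* (a :* s) :+ b :* (c :* s))) ≈-refl
    (num x) (den x) (num y) (den y) s p r))

Rep-neg : ∀ {x s p} → Rep x s p → Rep (-F x) s (-P p)
Rep-neg {x} {s} {p} (rep e) = rep (combine (- 1# ⊙ e)
  (solve 4
    (λ a b s p →
      (:- a) :* s :+ ((:- con (+ 1)) :* (p :* b))
      := (:- p) :* b :+ ((:- con (+ 1)) :* (a :* s))) ≈-refl (num x) (den x) s p))

Rep-poly : ∀ p → Rep (p , oneP) oneP p
Rep-poly p = rep ≈-refl

Rep-sum : ∀ k (x : ℕ → Frac) f p → (∀ i → i < k → Rep (x (f i)) oneP (p i)) →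
  Rep (sumF (map x (applyUpTo f k))) oneP (∑ k p)
Rep-sum zero    x f p e = rep (*-congʳ {oneP} constP-0)
Rep-sum (suc k) x f p e = Rep-≋ {sumF (map x (applyUpTo f (suc k)))} (≈-sym (∑-front k p))
  (Rep-+ {x (f 0)} {sumF (map x (applyUpTo (λ i → f (suc i)) k))} {oneP} {p 0}
    {∑ k (λ i → p (suc i))}
    (e 0 (s≤s z≤n)) (Rep-sum k x (λ i → f (suc i)) (λ i → p (suc i))
      (λ i i<k → e (suc i) (s≤s i<k))))

sg≡ : ∀ k → constP (sgn k) ≡ sg k
sg≡ zero    = refl
sg≡ (suc k) = cong -P_ (sg≡ k)

Rep-sgn : ∀ k → Rep (intF (sgn k)) oneP (sg k)
Rep-sgn k = subst (λ p → Rep (p , oneP) oneP (sg k)) (≡.sym (sg≡ k)) (Rep-poly (sg k))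

prodP-upTo : ∀ k (h : ℕ → Poly) f → prodP (map h (applyUpTo f k)) ≋ ∏ k (λ i → h (f i))
prodP-upTo zero    h f = ≈-refl
prodP-upTo (suc k) h f =
  ≈-trans (*-congˡ {h (f 0)} (prodP-upTo k h (λ i → f (suc i)))) (≈-sym (∏-front k (λ i → h (f i))))

∏E-descending : ∀ m l → ∏ m (λ i → E (m ℕ.+ l ℕ.∸ i)) ≋ ∏E l m
∏E-descending zero    l = ≈-refl
∏E-descending (suc m) l = ≈-trans (∏-front m (λ i → E (suc m ℕ.+ l ℕ.∸ i)))
  (≈-trans (*-cong {E (suc m ℕ.+ l)} {E (l ℕ.+ suc m)} (E-≡ (ℕP.+-comm (suc m) l))
    (∏E-descending m l))
    (*-comm (E (l ℕ.+ suc m)) (∏E l m)))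

Rep-qbinom′ : ∀ m l p → ∏E l m ≋ p *P ∏E 0 m → Rep (qbinom (m ℕ.+ l) m) oneP p
Rep-qbinom′ m l p e with m ℕ.≤ᵇ m ℕ.+ l | ℕP.≤⇒≤ᵇ (ℕP.m≤m+n m l)
... | true | _ = rep (≈-trans (*-identityʳ _)
  (≈-trans (prodP-upTo m (λ i → E (m ℕ.+ l ℕ.∸ i)) (λ i → i))
    (≈-trans (∏E-descending m l) (≈-trans e
      (*-congˡ {p} (≈-sym (prodP-upTo m (λ i → E (suc i)) (λ i → i))))))))

Rep-qbinom : ∀ m l → Rep (qbinom (m ℕ.+ l) m) oneP (gauss m l)
Rep-qbinom m l = Rep-qbinom′ m l (gauss m l) (≈-sym (gauss-∏E m l))

-- Symmetry of the q-binomial coefficient: the right-hand side has [an; bn], while the summand k =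
-- an - bn has [an; an - bn].
Rep-qbinom-flip : ∀ m l → Rep (qbinom (m ℕ.+ l) m) oneP (gauss l m)
Rep-qbinom-flip m l = Rep-qbinom′ m l (gauss l m) (≈-sym (flip m))
  where
  gauss-0 : ∀ l → gauss l 0 ≋ 1#
  gauss-0 zero    = ≈-refl
  gauss-0 (suc l) = ≈-refl
  flip : ∀ m → gauss l m *P ∏E 0 m ≋ ∏E l m
  flip zero    = ≈-trans (*-identityʳ (gauss l 0)) (gauss-0 l)
  flip (suc m) = combine (∏E 0 m ⊙ gauss-absorb₂ l m ⊕ E (suc (l ℕ.+ m)) ⊙ flip m
    ⊕ ∏E l m ⊙ E-≡ (≡.sym (ℕP.+-suc l m)))
    (solve 7
      (λ g h F r e x v →
        g :* (F :* x) :+ (F :* (h :* e) :+ e :* r :+ r :* v)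
        := r :* v :+ (F :* (g :* x) :+ e :* (h :* F) :+ r :* e)) ≈-refl
      (gauss l (suc m)) (gauss l m) (∏E 0 m) (∏E l m) (E (suc (l ℕ.+ m))) (E (suc m))
        (E (l ℕ.+ suc m)))

tri*2 : ∀ k → tri k ℕ.* 2 ≡ k ℕ.* (k ℕ.∸ 1)
tri*2 zero    = refl
tri*2 (suc k) = ≡.trans (lemma (tri k) k)
  (≡.trans (cong (ℕ._+ k) (tri-double k)) (ℕP.+-comm (k ℕ.* k) k))
  where
  lemma : ∀ t k → (t ℕ.+ k) ℕ.* 2 ≡ t ℕ.+ (t ℕ.+ k) ℕ.+ k
  lemma = ℕ-Solver.solve-∀

choose2≡tri : ∀ k → choose2 k ≡ tri k
choose2≡tri k = ≡.trans (cong _/2 (≡.sym (tri*2 k))) (ℕD.m*n/n≡m (tri k) 2)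

-- (B + C) C - C (C - 1) / 2 = C (2 B + C + 1) / 2, checked after doubling so that the division by 2
-- is visibly exact.
leading-exponent : ∀ B C → (C ℕ.* (B ℕ.+ C ℕ.+ B ℕ.+ 1)) /2 ≡ tauExp B C C
leading-exponent B C = ≡.trans (cong _/2 (≡.sym twice)) (ℕD.m*n/n≡m (tauExp B C C) 2)
  where
  lemma : ∀ B C → (B ℕ.+ C) ℕ.* C ℕ.* 2 ℕ.+ C ≡ C ℕ.* (B ℕ.+ C ℕ.+ B ℕ.+ 1) ℕ.+ C ℕ.* C
  lemma = ℕ-Solver.solve-∀
  split : ∀ e t C → e ℕ.* 2 ℕ.+ (t ℕ.+ (t ℕ.+ C)) ≡ (e ℕ.+ t) ℕ.* 2 ℕ.+ C
  split = ℕ-Solver.solve-∀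
  twice : tauExp B C C ℕ.* 2 ≡ C ℕ.* (B ℕ.+ C ℕ.+ B ℕ.+ 1)
  twice = ℕP.+-cancelʳ-≡ (C ℕ.* C) _ _ (≡.trans
    (cong (tauExp B C C ℕ.* 2 ℕ.+_) (≡.sym (tri-double C)))
    (≡.trans (split (tauExp B C C) (tri C) C)
      (≡.trans (cong (λ i → i ℕ.* 2 ℕ.+ C) (tauExp-tri B C C ℕP.≤-refl)) (lemma B C))))

2[an-k] : ∀ B K j → 2 ℕ.* (B ℕ.+ (K ℕ.+ j)) ℕ.∸ 2 ℕ.* K ≡ j ℕ.+ (B ℕ.+ B ℕ.+ j)
2[an-k] B K j = ≡.trans (cong (ℕ._∸ 2 ℕ.* K) (lemma B K j)) (ℕP.m+n∸m≡n (2 ℕ.* K) _)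
  where
  lemma : ∀ B K j → 2 ℕ.* (B ℕ.+ (K ℕ.+ j)) ≡ 2 ℕ.* K ℕ.+ (j ℕ.+ (B ℕ.+ B ℕ.+ j))
  lemma = ℕ-Solver.solve-∀

-- The local `term` of `tau0'` with an and an - bn as free arguments, so that both can be rewritten
-- after setting a = b + c.
tauTerm : ℕ → ℕ → ℕ → Frac
tauTerm A C k = intF (sgn k) *F qF (A ℕ.* k ℕ.∸ choose2 k) *F qbinom A k
                *F qbinom (2 ℕ.* A ℕ.∸ 2 ℕ.* k) (C ℕ.∸ k)

Rep-tauTerm : ∀ B C K j → K ℕ.+ j ≡ C → Rep (tauTerm (B ℕ.+ C) C K) oneP (τ-summand B C K j)
Rep-tauTerm B C K j refl = subst (λ x → Rep x oneP (τ-summand B C K j)) (≡.sym term≡)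
  (Rep-* {x = a *F b *F c} {d} (Rep-* {x = a *F b} {c} (Rep-* {x = a} {b} (Rep-sgn K) (Rep-poly _))
    (subst (λ i → Rep (qbinom i K) oneP (gauss K (B ℕ.+ j))) (lemma B K j)
      (Rep-qbinom K (B ℕ.+ j))))
    (Rep-qbinom j (B ℕ.+ B ℕ.+ j)))
  where
  lemma : ∀ B K j → K ℕ.+ (B ℕ.+ j) ≡ B ℕ.+ (K ℕ.+ j)
  lemma = ℕ-Solver.solve-∀
  a = intF (sgn K)
  b = qF (tauExp B (K ℕ.+ j) K)
  c = qbinom (B ℕ.+ (K ℕ.+ j)) K
  d = qbinom (j ℕ.+ (B ℕ.+ B ℕ.+ j)) j
  term≡ : tauTerm (B ℕ.+ (K ℕ.+ j)) (K ℕ.+ j) K ≡ a *F b *F c *F d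
  term≡ = cong₂ (λ e x → a *F qF e *F c *F x)
    (cong ((B ℕ.+ (K ℕ.+ j)) ℕ.* K ℕ.∸_) (choose2≡tri K))
    (cong₂ qbinom (2[an-k] B K j) (ℕP.m+n∸m≡n K j))

private
  an≡ : ∀ b c n → (b ℕ.+ c) ℕ.* n ℕ.∸ b ℕ.* n ≡ c ℕ.* n
  an≡ b c n = ≡.trans (cong (ℕ._∸ b ℕ.* n) (ℕP.*-distribʳ-+ n b c)) (ℕP.m+n∸m≡n (b ℕ.* n) (c ℕ.* n))

-- The hypothesis keeps the lower limit an - bn - ⌊n/2⌋ from being truncated at 0. The order of
-- summation is reversed, from k to j = an - bn - k.
Rep-tau : ∀ b c n → n /2 ≤ c ℕ.* n →
  let B = b ℕ.* n ; C = c ℕ.* n in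
  Rep (tau0' (b ℕ.+ c) b n) oneP (∑ (suc (n /2)) (λ j → τ-summand B C (C ℕ.∸ j) j))
Rep-tau b c n h≤C = subst (λ x → Rep x oneP (∑ (suc h) (λ j → τ-summand B C (C ℕ.∸ j) j)))
  (≡.sym tau≡)
  (Rep-≋ {sumF (map term (upTo (suc h)))} (∑-reverse h (λ j → τ-summand B C (C ℕ.∸ j) j))
    (Rep-sum (suc h) term (λ i → i) _ each))
  where
  B = b ℕ.* n
  C = c ℕ.* n
  h = n /2
  lo = C ℕ.∸ h
  term : ℕ → Frac
  term i = tauTerm (B ℕ.+ C) C (lo ℕ.+ i)
  tau≡ : tau0' (b ℕ.+ c) b n ≡ sumF (map term (upTo (suc h)))
  tau≡ = ≡.trans
    (cong₂ (λ A C → sumF (map (tauTerm A C) (map ((C ℕ.∸ h) ℕ.+_) (upTo (suc h)))))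
      (ℕP.*-distribʳ-+ n b c) (an≡ b c n))
    (cong sumF (≡.sym (ListP.map-∘ {g = tauTerm (B ℕ.+ C) C} {f = lo ℕ.+_} (upTo (suc h)))))
  each : ∀ i → i < suc h → Rep (term i) oneP (τ-summand B C (C ℕ.∸ (h ℕ.∸ i)) (h ℕ.∸ i))
  each i (s≤s i≤h) =
    subst (λ k → Rep (tauTerm (B ℕ.+ C) C k) oneP (τ-summand B C (C ℕ.∸ (h ℕ.∸ i)) (h ℕ.∸ i))) k≡
      (Rep-tauTerm B C (C ℕ.∸ (h ℕ.∸ i)) (h ℕ.∸ i) (ℕP.m∸n+n≡m h-i≤C))
    where
    h-i≤C : h ℕ.∸ i ≤ C
    h-i≤C = ℕP.≤-trans (ℕP.m∸n≤m h i) h≤C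
    k≡ : C ℕ.∸ (h ℕ.∸ i) ≡ lo ℕ.+ i
    k≡ = ℕP.+-cancelʳ-≡ (h ℕ.∸ i) _ _ (≡.trans (ℕP.m∸n+n≡m h-i≤C)
      (≡.sym (≡.trans (ℕP.+-assoc lo i (h ℕ.∸ i))
        (≡.trans (cong (lo ℕ.+_) (ℕP.m+[n∸m]≡n i≤h)) (ℕP.m∸n+n≡m h≤C)))))

rhsForm : ℕ → ℕ → ℕ → ℕ → ℤ → ℕ → Frac
rhsForm n C e A z B =
  intF (sgn C) *F qF e *F qbinom A B *F (oneF -F intF z *F (intF (+ 2) -F θ n -F ϑ n))

rhs≡ : ∀ b c n → let B = b ℕ.* n ; C = c ℕ.* n in
  rhs (b ℕ.+ c) b n ≡ rhsForm n C (tauExp B C C) (B ℕ.+ C) (+ c) B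
rhs≡ b c n = begin
  rhs (b ℕ.+ c) b n
    ≡⟨ cong₂ (λ A z → rhsForm n (A ℕ.∸ B) (((A ℕ.∸ B) ℕ.* (A ℕ.+ B ℕ.+ 1)) /2) A z B)
         (ℕP.*-distribʳ-+ n b c) (≡.trans (cong (ℤ._- + b) (ℤP.pos-+ b c)) (+-cancel (+ b) (+ c))) ⟩
  rhsForm n (B ℕ.+ C ℕ.∸ B) (((B ℕ.+ C ℕ.∸ B) ℕ.* (B ℕ.+ C ℕ.+ B ℕ.+ 1)) /2) (B ℕ.+ C) (+ c) B
    ≡⟨ cong (λ d → rhsForm n d ((d ℕ.* (B ℕ.+ C ℕ.+ B ℕ.+ 1)) /2) (B ℕ.+ C) (+ c) B)
      (ℕP.m+n∸m≡n B C) ⟩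
  rhsForm n C ((C ℕ.* (B ℕ.+ C ℕ.+ B ℕ.+ 1)) /2) (B ℕ.+ C) (+ c) B
    ≡⟨ cong (λ e → rhsForm n C e (B ℕ.+ C) (+ c) B) (leading-exponent B C) ⟩
  rhsForm n C (tauExp B C C) (B ℕ.+ C) (+ c) B ∎
  where
  open ≡.≡-Reasoning
  B = b ℕ.* n
  C = c ℕ.* n
  +-cancel : ∀ x y → x ℤ.+ y ℤ.- x ≡ y
  +-cancel = ℤ-Solver.solve-∀

Rep-rhs : ∀ b c n {p r} → Rep (θ n) oneP p → Rep (ϑ n) (qP 1) r →
  Rep (rhs (b ℕ.+ c) b n) (qP 1)
    (τ-leading (b ℕ.* n) (c ℕ.* n) * (qP 1 - fromℕ c * ((1# + 1#) * qP 1 - qP 1 * p - r)))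
Rep-rhs b c n {p} {r} θ-rep ϑ-rep
  = subst (λ x → Rep x (qP 1) (τ-leading B C *
    (qP 1 - fromℕ c * ((1# + 1#) * qP 1 - qP 1 * p - r))))
    (≡.sym (rhs≡ b c n)) (
  Rep-* {x = x₁ *F x₂ *F x₃} {x₄}
    (Rep-* {x = x₁ *F x₂} {x₃} (Rep-* {x = x₁} {x₂} (Rep-sgn C) (Rep-poly (qP (tauExp B C C))))
      (Rep-qbinom-flip B C))
    (Rep-≋ {x₄} (solve 3
      (λ q m s →
        q :* con (+ 1) :+ (:- (m :* s)) := q :- m :* s) ≈-refl (qP 1) (fromℕ c)
          ((1# + 1#) * qP 1 - qP 1 * p - r))
      (Rep-+ {oneF} { -F (y *F z)} (Rep-q {oneF} {oneP} (rep ≈-refl))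
        (Rep-neg {y *F z} (Rep-* {x = y} {z} (Rep-≋ {y} (≈-sym (fromℕ≈⟦⟧ c))
          (Rep-poly (constP (+ c))))
          (Rep-≋ {z} (solve 3
            (λ q p r →
              q :* (con (+ 1) :+ con (+ 1)) :+ (:- (q :* p)) :+ (:- r)
              := (con (+ 1) :+ con (+ 1)) :* q :- q :* p :- r) ≈-refl (qP 1) p r)
            (Rep-+ {intF (+ 2) -F θ n} { -F ϑ n}
              (Rep-+ {intF (+ 2)} { -F θ n} (Rep-q {intF (+ 2)} {1# + 1#} (rep ≈-refl))
                (Rep-neg {θ n} (Rep-q {θ n} {p} θ-rep)))
              (Rep-neg {ϑ n} {qP 1} {r} ϑ-rep))))))))
  where
  B = b ℕ.* n
  C = c ℕ.* n
  x₁ = intF (sgn C)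
  x₂ = qF (tauExp B C C)
  x₃ = qbinom (B ℕ.+ C) B
  y = intF (+ c)
  z = intF (+ 2) -F θ n -F ϑ n
  x₄ = oneF -F y *F z

-- The closed forms of θ and ϑ.

-- pentˡ m = m (3 m - 1) / 2 and pentʳ m = m (3 m + 1) / 2.
pentˡ pentʳ : ℕ → ℕ
pentˡ zero    = 0
pentˡ (suc m) = suc (m ℕ.* 3) ℕ.+ pentˡ m
pentʳ zero    = 0
pentʳ (suc m) = suc (suc (m ℕ.* 3)) ℕ.+ pentʳ m

pent-3m : ∀ m → pent (m ℕ.* 3) ≋ sg m *P qP (pentˡ m)
pent-3m zero    = ≈-refl
pent-3m (suc m) = combine (- N ⊙ pent-3m m ⊕ sg m ⊙ qP-+ (suc (m ℕ.* 3)) (pentˡ m))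
  (solve 5
    (λ x p s t v →
      (:- (x :* p)) :+ ((:- x) :* (s :* t) :+ s :* (x :* t))
      := (:- s) :* v :+ ((:- x) :* p :+ s :* v)) ≈-refl
    N (pent (m ℕ.* 3)) (sg m) (qP (pentˡ m)) (qP (pentˡ (suc m))))
  where N = qP (suc (m ℕ.* 3))

pent-3m+1 : ∀ m → pent (suc (m ℕ.* 3)) ≋ sg m *P qP (pentʳ m)
pent-3m+1 zero    = ≈-refl
pent-3m+1 (suc m) = combine (- N ⊙ pent-3m+1 m ⊕ sg m ⊙ qP-+ (suc (suc (m ℕ.* 3))) (pentʳ m))
  (solve 5
    (λ x p s t v →
      (:- (x :* p)) :+ ((:- x) :* (s :* t) :+ s :* (x :* t))
      := (:- s) :* v :+ ((:- x) :* p :+ s :* v)) ≈-refl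
    N (pent (suc (m ℕ.* 3))) (sg m) (qP (pentʳ m)) (qP (pentʳ (suc m))))
  where N = qP (suc (suc (m ℕ.* 3)))

pent-3m+2 : ∀ m → pent (suc (suc (m ℕ.* 3))) ≋ 0#
pent-3m+2 zero    = ≈-refl
pent-3m+2 (suc m) = combine (- N ⊙ pent-3m+2 m)
  (solve 2
    (λ x p →
      (:- (x :* p)) :+ ((:- x) :* con (+ 0)) := con (+ 0) :+ ((:- x) :* p)) ≈-refl N
        (pent (suc (suc (m ℕ.* 3)))))
  where N = qP (suc (suc (suc (m ℕ.* 3))))

pentˡ*2 : ∀ m → pentˡ m ℕ.* 2 ℕ.+ m ≡ m ℕ.* (3 ℕ.* m)
pentˡ*2 zero    = refl
pentˡ*2 (suc m) = ≡.trans (lemma (pentˡ m) m)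
  (≡.trans (cong (ℕ._+ (6 ℕ.* m ℕ.+ 3)) (pentˡ*2 m)) (lemma′ m))
  where
  lemma : ∀ p m → (suc (m ℕ.* 3) ℕ.+ p) ℕ.* 2 ℕ.+ suc m ≡ p ℕ.* 2 ℕ.+ m ℕ.+ (6 ℕ.* m ℕ.+ 3)
  lemma = ℕ-Solver.solve-∀
  lemma′ : ∀ m → m ℕ.* (3 ℕ.* m) ℕ.+ (6 ℕ.* m ℕ.+ 3) ≡ suc m ℕ.* (3 ℕ.* suc m)
  lemma′ = ℕ-Solver.solve-∀

pentʳ≡ : ∀ m → pentʳ m ≡ pentˡ m ℕ.+ m
pentʳ≡ zero    = refl
pentʳ≡ (suc m) rewrite pentʳ≡ m = lemma (pentˡ m) m
  where
  lemma : ∀ p m → suc (suc (m ℕ.* 3)) ℕ.+ (p ℕ.+ m) ≡ suc (m ℕ.* 3) ℕ.+ p ℕ.+ suc m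
  lemma = ℕ-Solver.solve-∀

pentˡℤ : ∀ m → + (pentˡ m ℕ.* 2) ≡ + m ℤ.* (+ 3 ℤ.* + m ℤ.- + 1)
pentˡℤ m = ≡.trans (lemma (+ (pentˡ m ℕ.* 2)) (+ m))
  (≡.trans (cong (ℤ._- + m) (≡.trans (≡.sym (ℤP.pos-+ (pentˡ m ℕ.* 2) m))
    (≡.trans (cong +_ (pentˡ*2 m))
    (≡.trans (ℤP.pos-* m (3 ℕ.* m)) (cong (+ m ℤ.*_) (ℤP.pos-* 3 m))))))
    (lemma′ (+ m)))
  where
  lemma : ∀ x y → x ≡ x ℤ.+ y ℤ.- y
  lemma = ℤ-Solver.solve-∀
  lemma′ : ∀ x → x ℤ.* (+ 3 ℤ.* x) ℤ.- x ≡ x ℤ.* (+ 3 ℤ.* x ℤ.- + 1)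
  lemma′ = ℤ-Solver.solve-∀

pentʳℤ : ∀ m → + (pentʳ m ℕ.* 2) ≡ + m ℤ.* (+ 3 ℤ.* + m ℤ.+ + 1)
pentʳℤ m = begin
  + (pentʳ m ℕ.* 2)                  ≡⟨ cong +_
    (≡.trans (cong (ℕ._* 2) (pentʳ≡ m)) (ℕP.*-distribʳ-+ 2 (pentˡ m) m)) ⟩
  + (pentˡ m ℕ.* 2 ℕ.+ m ℕ.* 2)      ≡⟨ ℤP.pos-+ (pentˡ m ℕ.* 2) (m ℕ.* 2) ⟩
  + (pentˡ m ℕ.* 2) ℤ.+ + (m ℕ.* 2)  ≡⟨ cong₂ ℤ._+_ (pentˡℤ m) (ℤP.pos-* m 2) ⟩
  + m ℤ.* (+ 3 ℤ.* + m ℤ.- + 1) ℤ.+ + m ℤ.* + 2 ≡⟨ lemma (+ m) ⟩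
  + m ℤ.* (+ 3 ℤ.* + m ℤ.+ + 1)      ∎
  where
  open ≡.≡-Reasoning
  lemma : ∀ x → x ℤ.* (+ 3 ℤ.* x ℤ.- + 1) ℤ.+ x ℤ.* + 2 ≡ x ℤ.* (+ 3 ℤ.* x ℤ.+ + 1)
  lemma = ℤ-Solver.solve-∀

half-even : ∀ {z} e → + (e ℕ.* 2) ≡ z → half z ≡ + e
half-even e refl = ≡.trans (ℤP.*-identityˡ _) (cong +_ (ℕD.m*n/n≡m e 2))

Rep-qZ : ∀ {z} e → + (e ℕ.* 2) ≡ z → Rep (qZ (half z)) oneP (qP e)
Rep-qZ {z} e eq = subst (λ h → Rep (qZ h) oneP (qP e)) (≡.sym (half-even {z} e eq))
  (Rep-poly (qP e))

-- ϑ n may involve q ^ (-1), so it is the fraction with denominator q that is a polynomial.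
Rep-qZ-pred : ∀ {z} e → + (e ℕ.* 2) ℤ.- + 2 ≡ z → Rep (qZ (half z)) (qP 1) (qP e)
Rep-qZ-pred zero    refl = rep ≈-refl
Rep-qZ-pred {z} (suc e) eq = subst (λ h → Rep (qZ h) (qP 1) (qP (suc e)))
  (≡.sym (half-even {z} e eq))
  (rep (≈-trans (*-comm (qP e) (qP 1)) (≈-trans (≈-sym (qP-+ 1 e))
    (≈-sym (*-identityʳ (qP (suc e)))))))

-- These equations open the `with` on `n % 3` once per residue, so that the residue can later be
-- handled as a propositional equality.
θ-0 : ∀ n → n ℕD.% 3 ≡ 0 → let m = n ℕD./ 3 in
  θ n ≡ intF (sgn m) *F (oneF +F qF m) *F qZ (half (zm m ℤ.* (+ 3 ℤ.* zm m ℤ.- + 1)))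
θ-0 n e with n ℕD.% 3 | e
... | .0 | refl = refl

θ-1 : ∀ n → n ℕD.% 3 ≡ 1 → let m = n ℕD./ 3 in
  θ n ≡ intF (sgn m) *F qZ (half (zm m ℤ.* (+ 3 ℤ.* zm m ℤ.+ + 1)))
θ-1 n e with n ℕD.% 3 | e
... | .1 | refl = refl

θ-2 : ∀ n → n ℕD.% 3 ≡ 2 → let m = n ℕD./ 3 in
  θ n ≡ intF (sgn (suc m)) *F qZ (half ((zm m ℤ.+ + 1) ℤ.* (+ 3 ℤ.* zm m ℤ.+ + 2)))
θ-2 n e with n ℕD.% 3 | e
... | .2 | refl = refl

ϑ-0 : ∀ n → n ℕD.% 3 ≡ 0 → let m = n ℕD./ 3 in
  ϑ n ≡ intF (sgn m) *F (oneF +F qF (2 ℕ.* m)) *F qZ (half (zm m ℤ.* (+ 3 ℤ.* zm m ℤ.- + 5)))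
ϑ-0 n e with n ℕD.% 3 | e
... | .0 | refl = refl

ϑ-1 : ∀ n → n ℕD.% 3 ≡ 1 → let m = n ℕD./ 3 in
  ϑ n ≡ intF (sgn m) *F qZ (half (zm m ℤ.* (+ 3 ℤ.* zm m ℤ.+ + 1)))
ϑ-1 n e with n ℕD.% 3 | e
... | .1 | refl = refl

ϑ-2 : ∀ n → n ℕD.% 3 ≡ 2 → let m = n ℕD./ 3 in
  ϑ n ≡ intF (sgn (suc m)) *F qZ (half ((zm m ℤ.- + 1) ℤ.* (+ 3 ℤ.* zm m ℤ.+ + 2)))
ϑ-2 n e with n ℕD.% 3 | e
... | .2 | refl = refl

n≡%+/3 : ∀ n r → n ℕD.% 3 ≡ r → n ≡ r ℕ.+ n ℕD./ 3 ℕ.* 3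
n≡%+/3 n r refl = ℕD.m≡m%n+[m/n]*n n 3

Rep-θ-1 : ∀ n → n ℕD.% 3 ≡ 1 → Rep (θ n) oneP (sg (n ℕD./ 3) *P qP (pentʳ (n ℕD./ 3)))
Rep-θ-1 n e = subst (λ x → Rep x oneP (sg m *P qP (pentʳ m))) (≡.sym (θ-1 n e))
  (Rep-* {intF (sgn m)} {qZ (half (zm m ℤ.* (+ 3 ℤ.* zm m ℤ.+ + 1)))} (Rep-sgn m)
    (Rep-qZ (pentʳ m) (pentʳℤ m)))
  where m = n ℕD./ 3

Rep-ϑ-1 : ∀ n → n ℕD.% 3 ≡ 1 → Rep (ϑ n) (qP 1) (qP 1 *P (sg (n ℕD./ 3) *P qP (pentʳ (n ℕD./ 3))))
Rep-ϑ-1 n e = subst (λ x → Rep x (qP 1) (qP 1 *P (sg (n ℕD./ 3) *P qP (pentʳ (n ℕD./ 3)))))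
  (≡.trans (θ-1 n e) (≡.sym (ϑ-1 n e))) (Rep-q {θ n} (Rep-θ-1 n e))

θ-val ϑ-val : ℕ → Poly
θ-val n = pent (suc (suc n)) - qP (suc n) * pent n
ϑ-val n = qP 1 * pent (suc (suc n)) - pent n

-- For N = 3m both A_N and A_(N-2) are non-zero, whence the factors 1 + q^m and 1 + q^(2m). For N =
-- 3m + 1 only A_N survives, and θ and ϑ coincide; for N = 3m + 2 only A_(N-2) does.
Rep-θϑ : ∀ n → Rep (θ (suc (suc n))) oneP (θ-val n) × Rep (ϑ (suc (suc n))) (qP 1) (ϑ-val n)
Rep-θϑ n = cases (N ℕD.% 3) refl (ℕD.m%n<n N 3)
  where
  N = suc (suc n)
  m = N ℕD./ 3
  Goal = Rep (θ N) oneP (θ-val n) × Rep (ϑ N) (qP 1) (ϑ-val n)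
  cases : ∀ r → N ℕD.% 3 ≡ r → r < 3 → Goal
  cases 0 e _ = go m refl (n≡%+/3 N 0 e)
    where
    go : ∀ k → m ≡ k → N ≡ k ℕ.* 3 → Goal
    go (suc k) m≡ refl =
        Rep-≋ {θ N} θ≋ (subst (λ x → Rep x oneP θₖ)
          (≡.sym (≡.trans (θ-0 N e) (cong (λ m → intF (sgn m) *F (oneF +F qF m) *F qZ
            (half (zm m ℤ.* (+ 3 ℤ.* zm m ℤ.- + 1)))) m≡)))
          (Rep-* {intF (sgn (suc k)) *F (oneF +F qF (suc k))}
            (Rep-* {intF (sgn (suc k))} {oneF +F qF (suc k)} (Rep-sgn (suc k))
              (Rep-+ {oneF} {qF (suc k)} (Rep-poly oneP) (Rep-poly (qP (suc k)))))
            (Rep-qZ (pentˡ (suc k)) (pentˡℤ (suc k)))))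
      , Rep-≋ {ϑ N} ϑ≋ (subst (λ x → Rep x (qP 1) ϑₖ)
        (≡.sym (≡.trans (ϑ-0 N e) (cong (λ m → intF (sgn m) *F (oneF +F qF (2 ℕ.* m)) *F qZ
          (half (zm m ℤ.* (+ 3 ℤ.* zm m ℤ.- + 5)))) m≡)))
          (Rep-* {intF (sgn (suc k)) *F (oneF +F qF (2 ℕ.* suc k))}
            (Rep-* {intF (sgn (suc k))} {oneF +F qF (2 ℕ.* suc k)} (Rep-sgn (suc k))
              (Rep-+ {oneF} {qF (2 ℕ.* suc k)} (Rep-poly oneP) (Rep-poly (qP (2 ℕ.* suc k)))))
            (Rep-qZ-pred (pentʳ k) exponent)))
      where
      θₖ = sg (suc k) *P (oneP +P qP (suc k)) *P qP (pentˡ (suc k))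
      θ≋ : θₖ ≋ θ-val n
      θ≋ = combine (- 1# ⊙ pent-3m (suc k) ⊕ qP (suc n) ⊙ pent-3m+1 k
          ⊕ - sg k ⊙ qP-+ (suc n) (pentʳ k) ⊕ sg k ⊙ subst
            (λ i → qP i ≋ qP (pentˡ (suc k)) *P qP (suc k)) (≡.sym (pentʳ≡ (suc k)))
              (qP-+ (pentˡ (suc k)) (suc k)))
        (solve 8
          (λ s x l P y p r v →
            (:- s) :* (con (+ 1) :+ x) :* l :+ ((:- con (+ 1)) :* ((:- s) :* l) :+ y :* (s :* r)
            :+ (:- s) :* (y :* r) :+ s :* (l :* x))
            := P :- y :* p :+ ((:- con (+ 1)) :* P :+ y :* p :+ (:- s) :* v :+ s :* v)) ≈-refl
          (sg k) (qP (suc k)) (qP (pentˡ (suc k))) (pent (suc k ℕ.* 3)) (qP (suc n)) (pent n)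
            (qP (pentʳ k)) (qP (pentʳ (suc k))))
      ϑₖ = sg (suc k) *P (oneP +P qP (2 ℕ.* suc k)) *P qP (pentʳ k)
      ϑ≋ : ϑₖ ≋ ϑ-val n
      ϑ≋ = combine (- qP 1 ⊙ pent-3m (suc k) ⊕ 1# ⊙ pent-3m+1 k
          ⊕ - sg k ⊙ qP-+ 1 (pentˡ (suc k))
          ⊕ sg k ⊙ subst (λ i → qP i ≋ qP (2 ℕ.* suc k) *P qP (pentʳ k)) (lemma k)
            (qP-+ (2 ℕ.* suc k) (pentʳ k)))
        (solve 8
          (λ s y r q P p l v →
            (:- s) :* (con (+ 1) :+ y) :* r :+ ((:- q) :* ((:- s) :* l) :+ con (+ 1) :* (s :* r)
            :+ (:- s) :* (q :* l) :+ s :* (y :* r))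
            := q :* P :- p :+ ((:- q) :* P :+ con (+ 1) :* p :+ (:- s) :* v :+ s :* v)) ≈-refl
          (sg k) (qP (2 ℕ.* suc k)) (qP (pentʳ k)) (qP 1) (pent (suc k ℕ.* 3)) (pent n)
            (qP (pentˡ (suc k))) (qP (suc (pentˡ (suc k)))))
        where
        lemma : ∀ k → 2 ℕ.* suc k ℕ.+ pentʳ k ≡ suc (pentˡ (suc k))
        lemma k rewrite pentʳ≡ k = lemma′ (pentˡ k) k
          where
          lemma′ : ∀ p k → 2 ℕ.* suc k ℕ.+ (p ℕ.+ k) ≡ suc (suc (k ℕ.* 3) ℕ.+ p)
          lemma′ = ℕ-Solver.solve-∀
      exponent : + (pentʳ k ℕ.* 2) ℤ.- + 2 ≡ + suc k ℤ.* (+ 3 ℤ.* + suc k ℤ.- + 5)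
      exponent = ≡.trans (cong (ℤ._- + 2) (pentʳℤ k))
        (≡.trans (lemma (+ k)) (cong (λ x → x ℤ.* (+ 3 ℤ.* x ℤ.- + 5)) (≡.sym (ℤP.pos-+ 1 k))))
        where
        lemma : ∀ x → x ℤ.* (+ 3 ℤ.* x ℤ.+ + 1) ℤ.- + 2 ≡ (+ 1 ℤ.+ x) ℤ.*
          (+ 3 ℤ.* (+ 1 ℤ.+ x) ℤ.- + 5)
        lemma = ℤ-Solver.solve-∀
  cases 1 e _ = go m refl (n≡%+/3 N 1 e)
    where
    go : ∀ k → m ≡ k → N ≡ 1 ℕ.+ k ℕ.* 3 → Goal
    go (suc k) m≡ refl =
        Rep-≋ {θ N} (≈-trans (reflexive (cong (λ m → sg m *P qP (pentʳ m)) m≡)) θ≋) (Rep-θ-1 N e)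
      , Rep-≋ {ϑ N} (≈-trans (reflexive (cong (λ m → qP 1 *P (sg m *P qP (pentʳ m))) m≡)) ϑ≋)
        (Rep-ϑ-1 N e)
      where
      v = sg (suc k) *P qP (pentʳ (suc k))
      θ≋ : v ≋ θ-val n
      θ≋ = combine (- 1# ⊙ pent-3m+1 (suc k) ⊕ qP (suc n) ⊙ pent-3m+2 k)
        (solve 4
          (λ v P x p →
            v :+ ((:- con (+ 1)) :* v :+ x :* con (+ 0))
            := P :- x :* p :+ ((:- con (+ 1)) :* P :+ x :* p)) ≈-refl v (pent N) (qP (suc n))
              (pent n))
      ϑ≋ : qP 1 *P v ≋ ϑ-val n
      ϑ≋ = combine (- qP 1 ⊙ pent-3m+1 (suc k) ⊕ 1# ⊙ pent-3m+2 k)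
        (solve 4
          (λ v P q p →
            q :* v :+ ((:- q) :* v :+ con (+ 1) :* con (+ 0))
            := q :* P :- p :+ ((:- q) :* P :+ con (+ 1) :* p)) ≈-refl v (pent N) (qP 1) (pent n))
  cases 2 e _ = go m refl (n≡%+/3 N 2 e)
    where
    go : ∀ k → m ≡ k → N ≡ 2 ℕ.+ k ℕ.* 3 → Goal
    go k m≡ refl =
        Rep-≋ {θ N} θ≋ (subst (λ x → Rep x oneP θₖ)
          (≡.sym (≡.trans (θ-2 N e) (cong (λ m → intF (sgn (suc m)) *F qZ
            (half ((zm m ℤ.+ + 1) ℤ.* (+ 3 ℤ.* zm m ℤ.+ + 2)))) m≡)))
          (Rep-* {intF (sgn (suc k))} (Rep-sgn (suc k)) (Rep-qZ (pentˡ (suc k)) θ-exponent)))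
      , Rep-≋ {ϑ N} ϑ≋ (subst (λ x → Rep x (qP 1) ϑₖ)
        (≡.sym (≡.trans (ϑ-2 N e) (cong (λ m → intF (sgn (suc m)) *F qZ
          (half ((zm m ℤ.- + 1) ℤ.* (+ 3 ℤ.* zm m ℤ.+ + 2)))) m≡)))
          (Rep-* {intF (sgn (suc k))} (Rep-sgn (suc k)) (Rep-qZ-pred (pentˡ k) ϑ-exponent)))
      where
      θₖ = sg (suc k) *P qP (pentˡ (suc k))
      θ≋ : θₖ ≋ θ-val n
      θ≋ = combine (- 1# ⊙ pent-3m+2 k ⊕ qP (suc n) ⊙ pent-3m k ⊕ - sg k ⊙ qP-+ (suc n) (pentˡ k))
        (solve 6
          (λ s v P x p l →
            (:- s) :* v :+ ((:- con (+ 1)) :* con (+ 0) :+ x :* (s :* l) :+ (:- s) :* (x :* l))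
            := P :- x :* p :+ ((:- con (+ 1)) :* P :+ x :* p :+ (:- s) :* v)) ≈-refl
          (sg k) (qP (pentˡ (suc k))) (pent N) (qP (suc n)) (pent n) (qP (pentˡ k)))
      ϑₖ = sg (suc k) *P qP (pentˡ k)
      ϑ≋ : ϑₖ ≋ ϑ-val n
      ϑ≋ = combine (- qP 1 ⊙ pent-3m+2 k ⊕ 1# ⊙ pent-3m k)
        (solve 5
          (λ s P q p l →
            (:- s) :* l :+ ((:- q) :* con (+ 0) :+ con (+ 1) :* (s :* l))
            := q :* P :- p :+ ((:- q) :* P :+ con (+ 1) :* p)) ≈-refl
          (sg k) (pent N) (qP 1) (pent n) (qP (pentˡ k)))
      θ-exponent : + (pentˡ (suc k) ℕ.* 2) ≡ (+ k ℤ.+ + 1) ℤ.* (+ 3 ℤ.* + k ℤ.+ + 2)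
      θ-exponent = ≡.trans (pentˡℤ (suc k)) (≡.trans
        (cong (λ x → x ℤ.* (+ 3 ℤ.* x ℤ.- + 1)) (ℤP.pos-+ 1 k)) (lemma (+ k)))
        where
        lemma : ∀ x → (+ 1 ℤ.+ x) ℤ.* (+ 3 ℤ.* (+ 1 ℤ.+ x) ℤ.- + 1) ≡ (x ℤ.+ + 1) ℤ.*
          (+ 3 ℤ.* x ℤ.+ + 2)
        lemma = ℤ-Solver.solve-∀
      ϑ-exponent : + (pentˡ k ℕ.* 2) ℤ.- + 2 ≡ (+ k ℤ.- + 1) ℤ.* (+ 3 ℤ.* + k ℤ.+ + 2)
      ϑ-exponent = ≡.trans (cong (ℤ._- + 2) (pentˡℤ k)) (lemma (+ k))
        where
        lemma : ∀ x → x ℤ.* (+ 3 ℤ.* x ℤ.- + 1) ℤ.- + 2 ≡ (x ℤ.- + 1) ℤ.* (+ 3 ℤ.* x ℤ.+ + 2)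
        lemma = ℤ-Solver.solve-∀
  cases (suc (suc (suc r))) _ (s≤s (s≤s (s≤s ())))

-- Assembly of the congruence.

-- The denominator Q is q u: the factor q comes from the representation of the right-hand side, u
-- from clearing the summands.
Rep⇒CongΦ² : ∀ n x y {p r} u w → Rep x oneP p → Rep y (qP 1) r → CoprimeP (qP 1 *P u) (Φ n) →
  u *P (qP 1 *P p - r) ≋ w *P (Φ n *P Φ n) → CongΦ² n x y
Rep⇒CongΦ² n x y {p} {r} u w (rep e) (rep f) coprime cong² =
  w , qP 1 *P u , coprime , ≋-out
    {(num x *P den y -P num y *P den x) *P (qP 1 *P u)} {Φ n *P Φ n *P w *P den x *P den y} (combine
    (den y *P (qP 1 *P u) ⊙ e ⊕ - (u *P den x) ⊙ f ⊕ den x *P den y ⊙ cong²)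
    (solve 10
      (λ a b c d q u p r F w →
        (a :* d :- c :* b) :* (q :* u) :+ ((d :* (q :* u)) :* (p :* b) :+ (:- (u :* b)) :*
        (r :* d) :+ (b :* d) :* (w :* (F :* F)))
        := F :* F :* w :* b :* d :+ ((d :* (q :* u)) :* (a :* con (+ 1)) :+ (:- (u :* b)) :*
        (c :* q) :+ (b :* d) :* (u :* (q :* p :- r)))) ≈-refl
      (num x) (den x) (num y) (den y) (qP 1) u p r (Φ n) w))

∤-offset : ∀ m b i → suc i < suc m → ¬ suc m ∣ b ℕ.* suc m ℕ.+ suc i
∤-offset m b i i<m d = ℕP.<⇒≱ i<m (∣⇒≤ (∣m+n∣m⇒∣n d (n∣m*n b)))

-- q - (q - 1) = 1. The index 1 is separate because Φ_1 = q - 1 is the negative of Ψ_1.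
coprime-q : CoprimeP (qP 1 *P oneP) (Φ 1)
coprime-q d (e , de) (e′ , de′) = e -P e′ , ≋-out {d *P (e -P e′)} {oneP} (combine
  (1# ⊙ ≋-in {d *P e} {qP 1 *P oneP} de ⊕ - 1# ⊙ ≋-in {d *P e′} {qP 1 -P oneP} de′)
  (solve 4
    (λ d e e′ q →
      d :* (e :- e′) :+ (con (+ 1) :* (q :* con (+ 1)) :+ (:- con (+ 1)) :* (q :- con (+
      1)))
      := con (+ 1) :+ (con (+ 1) :* (d :* e) :+ (:- con (+ 1)) :* (d :* e′))) ≈-refl d e e′ (qP 1)))

-- For n = 1 the sum consists of j = 0 alone and θ_1 = ϑ_1 = 1, so both sides are equal and the
-- quotient is 0.
CongΦ²-1 : ∀ b c → CongΦ² 1 (tau0' (b ℕ.+ c) b 1) (rhs (b ℕ.+ c) b 1)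
CongΦ²-1 b c = Rep⇒CongΦ² 1 _ _ oneP [] (Rep-tau b c 1 z≤n)
  (Rep-rhs b c 1 (Rep-θ-1 1 refl) (Rep-ϑ-1 1 refl)) coprime-q
  (combine (qP 1 ⊙ τ-summand-0 (b ℕ.* 1) (c ℕ.* 1))
    (solve 5
      (λ q t L M F →
        con (+ 1) :* (q :* (con (+ 0) :+ t) :- L :* (q :- M :* ((con (+ 1) :+ con (+ 1)) :*
        q :- q :* (con (+ 1) :* con (+ 1)) :- q :* (con (+ 1) :* con (+ 1))))) :+ (q :* L)
        := con (+ 0) :* (F :* F) :+ (q :* t)) ≈-refl
      (qP 1) (τ-summand (b ℕ.* 1) (c ℕ.* 1) (c ℕ.* 1) 0) (τ-leading (b ℕ.* 1) (c ℕ.* 1)) (fromℕ c)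
        (Φ 1)))

CongΦ²-≥2 : ∀ b c n → 0 < c →
  let N = suc (suc n) in CongΦ² N (tau0' (b ℕ.+ c) b N) (rhs (b ℕ.+ c) b N)
CongΦ²-≥2 b c n 0<c = finish (TauSum.τ-sum polyRing constP-hom qP ≈-refl qP-+ n b c
    Unit comax-1 (λ {x} {y} → comax-* {y = x} {y}) clearing-unit 0<c h 2h≤N n<2h)
  where
  N = suc (suc n)
  h = N /2
  B = b ℕ.* N
  C = c ℕ.* N
  Unit : Poly → Set
  Unit = Comax (Ψ N)
  N≡ : N ≡ N ℕD.% 2 ℕ.+ (h ℕ.+ h)
  N≡ = ≡.trans (ℕD.m≡m%n+[m/n]*n N 2) (cong (N ℕD.% 2 ℕ.+_) (lemma h))
    where
    lemma : ∀ h → h ℕ.* 2 ≡ h ℕ.+ h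
    lemma = ℕ-Solver.solve-∀
  2h≤N : h ℕ.+ h ≤ N
  2h≤N = subst (h ℕ.+ h ≤_) (≡.sym N≡) (ℕP.m≤n+m (h ℕ.+ h) (N ℕD.% 2))
  n<2h : n < h ℕ.+ h
  n<2h = ℕP.≤-pred (subst (_≤ suc (h ℕ.+ h)) (≡.sym N≡)
    (ℕP.+-monoˡ-≤ (h ℕ.+ h) (ℕP.≤-pred (ℕD.m%n<n N 2))))
  N≤C : N ≤ C
  N≤C = ℕP.m≤n*m N c ⦃ ℕ.>-nonZero 0<c ⦄
  ∏E-unit : ∀ b j → j < N → Unit (∏E (b ℕ.* N) j)
  ∏E-unit b j j<N = comax-∏ j {λ i → E (b ℕ.* N ℕ.+ suc i)} λ i i<j →
    Ψ-comax-E (suc n) (b ℕ.* N ℕ.+ suc i) (∤-offset (suc n) b i (ℕP.≤-<-trans i<j j<N))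
  clearing-unit : ∀ k → suc k ℕ.+ suc k ≤ N → Unit
    (∏E B (suc k) *P ∏E 0 (suc k) *P qP (tri (suc k)))
  clearing-unit k 2j≤N = comax-* {y = ∏E B (suc k) *P ∏E 0 (suc k)} {qP (tri (suc k))}
    (comax-* {y = ∏E B (suc k)} {∏E 0 (suc k)} (∏E-unit b (suc k) j<N) (∏E-unit 0 (suc k) j<N))
    (Ψ-comax-qP (suc n) (tri (suc k)))
    where
    j<N : suc k < N
    j<N = ℕP.≤-trans (s≤s (ℕP.m≤n+m (suc k) k)) 2j≤N
  T = ∑ (suc h) (λ j → τ-summand B C (C ℕ.∸ j) j)
  V = τ-leading B C * (qP 1 - fromℕ c * ((1# + 1#) * qP 1 - qP 1 * θ-val n - ϑ-val n))
  finish : ∃[ u ] Unit u × ∃[ w ] u *P (qP 1 *P T - V) ≋ w *P (E N *P E N) →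
    CongΦ² N (tau0' (b ℕ.+ c) b N) (rhs (b ℕ.+ c) b N)
  -- 1 - q^N = Φ_N G, so the square of `G` joins the quotient when (1 - q^N)^2 is replaced by the
  -- square of Φ_N.
  finish (u , unit-u , w , e) = Rep⇒CongΦ² N _ _ u (w *P (G *P G))
    (Rep-tau b c N (ℕP.≤-trans (ℕP.≤-trans (ℕP.m≤m+n h h) 2h≤N) N≤C))
    (Rep-rhs b c N (proj₁ (Rep-θϑ n)) (proj₂ (Rep-θϑ n)))
    (comax⇒coprime (suc n) (comax-* {y = qP 1} {u} (Ψ-comax-qP (suc n) 1) unit-u))
    (combine (1# ⊙ e ⊕ - (w *P (Ψ N *P G + E N)) ⊙ Ψ-∣-E (suc n))
      (solve 5
        (λ x w G F e →
          x :+ (con (+ 1) :* (w :* (e :* e)) :+ (:- (w :* (F :* G :+ e))) :* e)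
          := w :* (G :* G) :* (F :* F) :+ (con (+ 1) :* x :+ (:- (w :* (F :* G :+ e))) :* (F
          :* G))) ≈-refl
        (u *P (qP 1 *P T - V)) w G (Ψ N) (E N)))
    where G = D (suc n) N

theorem1p3 : (a b n : ℕ) → 0 < a → 0 < b → 0 < n → b < a →
    CongΦ² n (tau0' a b n) (rhs a b n)
theorem1p3 a b n _ _ 0<n b<a =
  subst (λ a → CongΦ² n (tau0' a b n) (rhs a b n)) (ℕP.m+[n∸m]≡n (ℕP.<⇒≤ b<a))
    (cases n 0<n)
  where
  cases : ∀ n → 0 < n → CongΦ² n (tau0' (b ℕ.+ (a ℕ.∸ b)) b n) (rhs (b ℕ.+ (a ℕ.∸ b)) b n)
  cases (suc zero)    _ = CongΦ²-1 b (a ℕ.∸ b)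
  cases (suc (suc n)) _ = CongΦ²-≥2 b (a ℕ.∸ b) n (ℕP.m<n⇒0<n∸m b<a)
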